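{- Let $G$ be a connected graph with exactly $m$ edges, and suppose $G$ is not a $4$-cycle. Then \[\iota(G,\mathcal{C}') \le \frac{m+1}{6}.\] Moreover: (i) equality $\iota(G,\mathcal{C}') = \frac{m+1}{6}$ holds if and only if $G$ is a pure $(m,C_4)$-special graph or $G$ is isomorphic to the diamond graph $C_4'$ or to the $5$-cycle $C_5$; (ii) if $G$ is an $(m,C_4)$-special graph, then $\iota(G,\mathcal{C}') = \lfloor (m+1)/6 \rfloor$.
   Context: All graphs are finite and simple. For a graph $G$ and $v\in V(G)$, $N[v]$ is the closed neighbourhood of $v$; for $D\subseteq V(G)$, $N[D]=\bigcup_{v\in D}N[v]$. For a set $\mathcal{F}$ of graphs, an $\mathcal{F}$-graph is a graph isomorphic to a member of $\mathcal{F}$. A set $D\subseteq V(G)$ is an $\mathcal{F}$-isolating set of $G$ if $G-N[D]$ contains no $\mathcal{F}$-graph as a subgraph (equivalently, $N[D]$ meets the vertex set of every $\mathcal{F}$-graph contained in $G$); $\iota(G,\mathcal{F})$ is the minimum size of an $\mathcal{F}$-isolating set of $G$. $\mathcal{C}'$ denotes the set of all cycles of length at least $4$. $C_n$ is the $n$-cycle; the diamond graph $C_4'$ is the graph on $\{1,2,3,4\}$ with edges $12,23,34,41,13$. $(m,C_4)$-special graphs: let $m\ge 0$ and write $m+1 = 6q + r$ with integers $q\ge 0$, $0\le r\le 5$. If $q=0$, an $(m,C_4)$-special graph is any connected $m$-edge graph (it has no $C_4$-constituents). If $q\ge 1$: take distinct vertices $v_1,\dots,v_q$, and vertex-disjoint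 $4$-cycles $F_1,\dots,F_q$ (also disjoint from $\{v_1,\dots,v_q\}$); for each $i$ choose $w_i\in V(F_i)$ and let $G_i$ be the graph with vertex set $\{v_i\}\cup V(F_i)$ and edge set $E(F_i)\cup\{v_iw_i\}$. Let $T$ be any tree with vertex set $\{v_1,\dots,v_q\}$, and let $T'$ be any connected graph with exactly $r$ edges such that $V(T')\cap\bigcup_{i=1}^q V(G_i)=\{v_q\}$. The graph $G$ with $V(G)=V(T')\cup\bigcup_i V(G_i)$ and $E(G)=E(T)\cup E(T')\cup\bigcup_i E(G_i)$ is an $(m,C_4)$-special graph (a connected $m$-edge graph); the $G_i$ are its $C_4$-constituents, $T'$ is its remainder graph. It is pure if its remainder graph has no edges. -}

module Defs where

open import Data.Nat using (ℕ; zero; suc; _+_; _*_; _≤_; _<ᵇ_; _/_; _%_)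
open import Data.Bool using (Bool; true; false; _∧_; if_then_else_)
open import Data.Fin using (Fin; zero; suc; toℕ; inject₁; fromℕ)
open import Data.Fin.Subset using (Subset; _∈_)
open import Data.List using (List; map; allFin)
open import Data.Nat.ListAction using (sum)
open import Data.Product using (Σ; ∃; ∃-syntax; _×_; _,_)
open import Data.Sum using (_⊎_)
open import Relation.Nullary using (¬_)
open import Relation.Binary.PropositionalEquality using (_≡_; _≢_; refl)
open import Function.Definitions using (Injective)
open import Function.Bundles using (_↔_; Inverse)
open import Function.Bundles using (_⇔_) public

record Graph : Set where
  field
    n       : ℕ
    adj     : Fin n → Fin n → Bool
    adj-sym : ∀ x y → adj x y ≡ adj y x
    adj-irr : ∀ x → adj x x ≡ false
open Graph public

edgeCount : (k : ℕ) → (Fin k → Fin k → Bool) → ℕ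
edgeCount k a =
  sum (map (λ x → sum (map (λ y → if (toℕ x <ᵇ toℕ y) ∧ a x y then 1 else 0)
                           (allFin k)))
           (allFin k))

∥_∥ : Graph → ℕ
∥ G ∥ = edgeCount (n G) (adj G)

data Walk {A : Set} (R : A → A → Set) : A → A → Set where
  []  : ∀ {x} → Walk R x x
  _∷_ : ∀ {x y z} → R x y → Walk R y z → Walk R x z

ConnectedOn : {k : ℕ} → (Fin k → Bool) → (Fin k → Fin k → Bool) → Set
ConnectedOn {k} P e =
  (∃[ x ] P x ≡ true) ×
  (∀ x y → P x ≡ true → P y ≡ true → Walk (λ a b → e a b ≡ true) x y)

Connected : Graph → Set
Connected G = ConnectedOn {n G} (λ _ → true) (adj G)

-- a cycle with (suc k) distinct vertices in the graph with adjacency e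
record Cycle {m : ℕ} (e : Fin m → Fin m → Bool) (k : ℕ) : Set where
  field
    c     : Fin (suc k) → Fin m
    inj   : Injective _≡_ _≡_ c
    step  : ∀ (i : Fin k) → e (c (inject₁ i)) (c (suc i)) ≡ true
    close : e (c (fromℕ k)) (c zero) ≡ true
open Cycle public

Acyclic : {k : ℕ} → (Fin k → Fin k → Bool) → Set
Acyclic e = ∀ j → 2 ≤ j → ¬ Cycle e j

InN : (G : Graph) → Subset (n G) → Fin (n G) → Set
InN G D x = ∃[ u ] (u ∈ D × (u ≡ x ⊎ adj G u x ≡ true))

-- D is a C′-isolating set: G - N[D] contains no cycle of length ≥ 4
CIsolating : (G : Graph) → Subset (n G) → Set
CIsolating G D =
  ∀ j → 3 ≤ j → (C : Cycle (adj G) j) → ¬ (∀ i → ¬ InN G D (c C i))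

ιC′≡ : Graph → ℕ → Set
ιC′≡ G k =
  (Σ (Subset (n G)) λ D → CIsolating G D × Data.Fin.Subset.∣ D ∣ ≡ k) ×
  (∀ D → CIsolating G D → k ≤ Data.Fin.Subset.∣ D ∣)

_≅_ : Graph → Graph → Set
G ≅ H = Σ (Fin (n G) ↔ Fin (n H)) λ φ →
  ∀ x y → adj G x y ≡ adj H (Inverse.to φ x) (Inverse.to φ y)

UEdge : {k : ℕ} → Fin k → Fin k → Fin k → Fin k → Set
UEdge a b x y = (a ≡ x × b ≡ y) ⊎ (a ≡ y × b ≡ x)

next4 : Fin 4 → Fin 4
next4 zero = suc zero
next4 (suc zero) = suc (suc zero)
next4 (suc (suc zero)) = suc (suc (suc zero))
next4 (suc (suc (suc zero))) = zero

joint : {A : Set} {q : ℕ} → (Fin q → A) → (Fin q → Fin 4 → A) → Fin q → Fin 5 → A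
joint v f i zero = v i
joint v f i (suc j) = f i j

-- G is an (m,C₄)-special graph with q = suc q' C₄-constituents and
-- remainder with r edges, with vertices v₁..v_q, 4-cycles F_i, w_i, tree T,
-- remainder T' realised inside G (V(G) and E(G) are exactly the unions).
record SpecialStr (G : Graph) (q' r : ℕ) : Set where
  field
    v : Fin (suc q') → Fin (n G)
    -- F_i has vertices f i 0..3 and edges f i j — f i (j+1 mod 4)
    f : Fin (suc q') → Fin 4 → Fin (n G)
    -- w_i = f i (w i)
    w : Fin (suc q') → Fin 4
    g-inj : ∀ i j i' j' → joint v f i j ≡ joint v f i' j' → (i ≡ i' × j ≡ j')
    -- the tree T on {v_1..v_q} (indexed by Q)
    t     : Fin (suc q') → Fin (suc q') → Bool
    t-sym : ∀ i k → t i k ≡ t k i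
    t-irr : ∀ i → t i i ≡ false
    t-con : ConnectedOn (λ _ → true) t
    t-acy : Acyclic t
    -- the remainder graph T' : vertex set {x | R x}, adjacency tp
    R      : Fin (n G) → Bool
    tp     : Fin (n G) → Fin (n G) → Bool
    tp-sym : ∀ x y → tp x y ≡ tp y x
    tp-irr : ∀ x → tp x x ≡ false
    tp-R   : ∀ x y → tp x y ≡ true → R x ≡ true
    tp-con : ConnectedOn R tp
    tp-r   : edgeCount (n G) tp ≡ r
    R-meet : ∀ i j → (R (joint v f i j) ≡ true) ⇔ (i ≡ fromℕ q' × j ≡ zero)
    cover  : ∀ x → R x ≡ true ⊎ (∃[ i ] ∃[ j ] joint v f i j ≡ x)
    edges  : ∀ x y → (adj G x y ≡ true) ⇔
               ((∃[ i ] ∃[ k ] (t i k ≡ true × v i ≡ x × v k ≡ y))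
                ⊎ tp x y ≡ true
                ⊎ (∃[ i ] (UEdge (v i) (f i (w i)) x y
                           ⊎ ∃[ j ] UEdge (f i j) (f i (next4 j)) x y)))

-- G is an (m,C₄)-special graph, where m + 1 = 6q + r
Special : Graph → ℕ → Set
Special G m =
  (suc m / 6 ≡ 0 × Connected G × ∥ G ∥ ≡ m)
  ⊎ (∃[ q' ] (suc m / 6 ≡ suc q' × SpecialStr G q' (suc m % 6)))

PureSpecial : Graph → ℕ → Set
PureSpecial G m =
  ∃[ q' ] (suc m / 6 ≡ suc q' ×
           Σ (SpecialStr G q' (suc m % 6)) λ S →
             edgeCount (n G) (SpecialStr.tp S) ≡ 0)

C₄-adj : Fin 4 → Fin 4 → Bool
C₄-adj zero zero = false
C₄-adj zero (suc zero) = true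
C₄-adj zero (suc (suc zero)) = false
C₄-adj zero (suc (suc (suc zero))) = true
C₄-adj (suc zero) zero = true
C₄-adj (suc zero) (suc zero) = false
C₄-adj (suc zero) (suc (suc zero)) = true
C₄-adj (suc zero) (suc (suc (suc zero))) = false
C₄-adj (suc (suc zero)) zero = false
C₄-adj (suc (suc zero)) (suc zero) = true
C₄-adj (suc (suc zero)) (suc (suc zero)) = false
C₄-adj (suc (suc zero)) (suc (suc (suc zero))) = true
C₄-adj (suc (suc (suc zero))) zero = true
C₄-adj (suc (suc (suc zero))) (suc zero) = false
C₄-adj (suc (suc (suc zero))) (suc (suc zero)) = true
C₄-adj (suc (suc (suc zero))) (suc (suc (suc zero))) = false

C₄-sym : ∀ x y → C₄-adj x y ≡ C₄-adj y x
C₄-sym zero zero = refl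
C₄-sym zero (suc zero) = refl
C₄-sym zero (suc (suc zero)) = refl
C₄-sym zero (suc (suc (suc zero))) = refl
C₄-sym (suc zero) zero = refl
C₄-sym (suc zero) (suc zero) = refl
C₄-sym (suc zero) (suc (suc zero)) = refl
C₄-sym (suc zero) (suc (suc (suc zero))) = refl
C₄-sym (suc (suc zero)) zero = refl
C₄-sym (suc (suc zero)) (suc zero) = refl
C₄-sym (suc (suc zero)) (suc (suc zero)) = refl
C₄-sym (suc (suc zero)) (suc (suc (suc zero))) = refl
C₄-sym (suc (suc (suc zero))) zero = refl
C₄-sym (suc (suc (suc zero))) (suc zero) = refl
C₄-sym (suc (suc (suc zero))) (suc (suc zero)) = refl
C₄-sym (suc (suc (suc zero))) (suc (suc (suc zero))) = refl

C₄-irr : ∀ x → C₄-adj x x ≡ false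
C₄-irr zero = refl
C₄-irr (suc zero) = refl
C₄-irr (suc (suc zero)) = refl
C₄-irr (suc (suc (suc zero))) = refl

C₄ : Graph
C₄ = record { n = 4 ; adj = C₄-adj ; adj-sym = C₄-sym ; adj-irr = C₄-irr }

C₅-adj : Fin 5 → Fin 5 → Bool
C₅-adj zero zero = false
C₅-adj zero (suc zero) = true
C₅-adj zero (suc (suc zero)) = false
C₅-adj zero (suc (suc (suc zero))) = false
C₅-adj zero (suc (suc (suc (suc zero)))) = true
C₅-adj (suc zero) zero = true
C₅-adj (suc zero) (suc zero) = false
C₅-adj (suc zero) (suc (suc zero)) = true
C₅-adj (suc zero) (suc (suc (suc zero))) = false
C₅-adj (suc zero) (suc (suc (suc (suc zero)))) = false
C₅-adj (suc (suc zero)) zero = false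
C₅-adj (suc (suc zero)) (suc zero) = true
C₅-adj (suc (suc zero)) (suc (suc zero)) = false
C₅-adj (suc (suc zero)) (suc (suc (suc zero))) = true
C₅-adj (suc (suc zero)) (suc (suc (suc (suc zero)))) = false
C₅-adj (suc (suc (suc zero))) zero = false
C₅-adj (suc (suc (suc zero))) (suc zero) = false
C₅-adj (suc (suc (suc zero))) (suc (suc zero)) = true
C₅-adj (suc (suc (suc zero))) (suc (suc (suc zero))) = false
C₅-adj (suc (suc (suc zero))) (suc (suc (suc (suc zero)))) = true
C₅-adj (suc (suc (suc (suc zero)))) zero = true
C₅-adj (suc (suc (suc (suc zero)))) (suc zero) = false
C₅-adj (suc (suc (suc (suc zero)))) (suc (suc zero)) = false
C₅-adj (suc (suc (suc (suc zero)))) (suc (suc (suc zero))) = true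
C₅-adj (suc (suc (suc (suc zero)))) (suc (suc (suc (suc zero)))) = false

C₅-sym : ∀ x y → C₅-adj x y ≡ C₅-adj y x
C₅-sym zero zero = refl
C₅-sym zero (suc zero) = refl
C₅-sym zero (suc (suc zero)) = refl
C₅-sym zero (suc (suc (suc zero))) = refl
C₅-sym zero (suc (suc (suc (suc zero)))) = refl
C₅-sym (suc zero) zero = refl
C₅-sym (suc zero) (suc zero) = refl
C₅-sym (suc zero) (suc (suc zero)) = refl
C₅-sym (suc zero) (suc (suc (suc zero))) = refl
C₅-sym (suc zero) (suc (suc (suc (suc zero)))) = refl
C₅-sym (suc (suc zero)) zero = refl
C₅-sym (suc (suc zero)) (suc zero) = refl
C₅-sym (suc (suc zero)) (suc (suc zero)) = refl
C₅-sym (suc (suc zero)) (suc (suc (suc zero))) = refl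
C₅-sym (suc (suc zero)) (suc (suc (suc (suc zero)))) = refl
C₅-sym (suc (suc (suc zero))) zero = refl
C₅-sym (suc (suc (suc zero))) (suc zero) = refl
C₅-sym (suc (suc (suc zero))) (suc (suc zero)) = refl
C₅-sym (suc (suc (suc zero))) (suc (suc (suc zero))) = refl
C₅-sym (suc (suc (suc zero))) (suc (suc (suc (suc zero)))) = refl
C₅-sym (suc (suc (suc (suc zero)))) zero = refl
C₅-sym (suc (suc (suc (suc zero)))) (suc zero) = refl
C₅-sym (suc (suc (suc (suc zero)))) (suc (suc zero)) = refl
C₅-sym (suc (suc (suc (suc zero)))) (suc (suc (suc zero))) = refl
C₅-sym (suc (suc (suc (suc zero)))) (suc (suc (suc (suc zero)))) = refl

C₅-irr : ∀ x → C₅-adj x x ≡ false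
C₅-irr zero = refl
C₅-irr (suc zero) = refl
C₅-irr (suc (suc zero)) = refl
C₅-irr (suc (suc (suc zero))) = refl
C₅-irr (suc (suc (suc (suc zero)))) = refl

C₅ : Graph
C₅ = record { n = 5 ; adj = C₅-adj ; adj-sym = C₅-sym ; adj-irr = C₅-irr }

-- diamond C₄′ : vertices 1,2,3,4 of the paper are zero,1,2,3; edges 12,23,34,41,13
Diamond-adj : Fin 4 → Fin 4 → Bool
Diamond-adj zero zero = false
Diamond-adj zero (suc zero) = true
Diamond-adj zero (suc (suc zero)) = true
Diamond-adj zero (suc (suc (suc zero))) = true
Diamond-adj (suc zero) zero = true
Diamond-adj (suc zero) (suc zero) = false
Diamond-adj (suc zero) (suc (suc zero)) = true
Diamond-adj (suc zero) (suc (suc (suc zero))) = false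
Diamond-adj (suc (suc zero)) zero = true
Diamond-adj (suc (suc zero)) (suc zero) = true
Diamond-adj (suc (suc zero)) (suc (suc zero)) = false
Diamond-adj (suc (suc zero)) (suc (suc (suc zero))) = true
Diamond-adj (suc (suc (suc zero))) zero = true
Diamond-adj (suc (suc (suc zero))) (suc zero) = false
Diamond-adj (suc (suc (suc zero))) (suc (suc zero)) = true
Diamond-adj (suc (suc (suc zero))) (suc (suc (suc zero))) = false

Diamond-sym : ∀ x y → Diamond-adj x y ≡ Diamond-adj y x
Diamond-sym zero zero = refl
Diamond-sym zero (suc zero) = refl
Diamond-sym zero (suc (suc zero)) = refl
Diamond-sym zero (suc (suc (suc zero))) = refl
Diamond-sym (suc zero) zero = refl
Diamond-sym (suc zero) (suc zero) = refl
Diamond-sym (suc zero) (suc (suc zero)) = refl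
Diamond-sym (suc zero) (suc (suc (suc zero))) = refl
Diamond-sym (suc (suc zero)) zero = refl
Diamond-sym (suc (suc zero)) (suc zero) = refl
Diamond-sym (suc (suc zero)) (suc (suc zero)) = refl
Diamond-sym (suc (suc zero)) (suc (suc (suc zero))) = refl
Diamond-sym (suc (suc (suc zero))) zero = refl
Diamond-sym (suc (suc (suc zero))) (suc zero) = refl
Diamond-sym (suc (suc (suc zero))) (suc (suc zero)) = refl
Diamond-sym (suc (suc (suc zero))) (suc (suc (suc zero))) = refl

Diamond-irr : ∀ x → Diamond-adj x x ≡ false
Diamond-irr zero = refl
Diamond-irr (suc zero) = refl
Diamond-irr (suc (suc zero)) = refl
Diamond-irr (suc (suc (suc zero))) = refl

Diamond : Graph
Diamond = record { n = 4 ; adj = Diamond-adj ; adj-sym = Diamond-sym ; adj-irr = Diamond-irr }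

{-# OPTIONS --safe #-}

-- Sets of vertices are Boolean predicates P on the vertices of one fixed graph G, and all subgraphs are induced.
-- By strong induction, every connected P is a 4-cycle, or has an isolating set D with 6|D| ≤ m(P), or is extremal
-- (6k = m(P) + 1).  If P has a bridge, solutions of the two sides add up; two extremal sides give an extremal
-- graph unless one end of the bridge, once dominated, saves a vertex on its side; and if one side is a 4-cycle,
-- one dominates from the other end of the bridge.  If P is bridgeless, choose v of degree at least 3, dominate N[v]
-- and solve the components H of P − N[v]: each is joined to N[v] by at least two edges, and a component joined by
-- exactly two that is a 4-cycle or extremal can be exploited directly (tight-2-cut), so every component leaves a
-- surplus of edges.
-- Connectedness and bridges are expressed by edge cuts, and edge counts are doubled throughout.

module Submission where

open import Defs
open import Data.Bool as Bool using (Bool; true; false; _∧_; _∨_; not; if_then_else_)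
open import Data.Empty using (⊥; ⊥-elim)
open import Data.Fin using (Fin; zero; suc; toℕ; inject₁; fromℕ; fromℕ<; punchIn; punchOut)
open import Data.Fin.Patterns using (0F; 1F; 2F; 3F; 4F)
open import Data.Fin.Properties using (_≟_; any?; all?; injective⇒≤; toℕ-injective; toℕ-inject₁; toℕ-fromℕ; toℕ<n; toℕ-fromℕ<; punchIn-punchOut; +↔⊎)
open import Data.Fin.Relation.Unary.Top using (view; ‵fromℕ; ‵inject₁; view-inject₁; view-fromℕ)
open import Data.Fin.Subset using (Subset; ∣_∣)
open import Data.Fin.Subset.Properties using (anySubset?)
open import Data.List as List using (List; []; _∷_; _++_; length; map; allFin)
open import Data.List.Membership.Propositional using () renaming (_∈_ to _∈ˡ_)
open import Data.List.Properties using (length-++; map-tabulate)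
open import Data.List.Relation.Unary.Any as Any using (Any; here; there)
open import Data.List.Relation.Unary.Any.Properties using (++⁺ˡ; ++⁺ʳ)
open import Data.Nat as ℕ using (ℕ; zero; suc; _+_; _*_; _≤_; _<_; _∸_; _<ᵇ_; _/_; _%_; z≤n; s≤s; _≤?_)
open import Data.Nat.DivMod using (m≡m%n+[m/n]*n; m*n/n≡m; m*n%n≡0; /-monoˡ-≤)
open import Data.Nat.ListAction using () renaming (sum to sumᴸ)
open import Data.Nat.Properties hiding (_≟_)
open import Data.Nat.Tactic.RingSolver using (solve-∀)
open import Data.Product using (Σ; ∃; ∃-syntax; _×_; _,_; proj₁; proj₂)
open import Data.Sum using (_⊎_; inj₁; inj₂; [_,_]′; map₁; map₂)
open import Data.Sum.Function.Propositional using (_⊎-↔_)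
open import Data.Vec using (Vec; []; _∷_; lookup; tabulate)
open import Data.Vec.Properties using (lookup∘tabulate; []=⇒lookup; lookup⇒[]=)
open import Function using (_∘_; id; case_of_)
open import Function.Bundles using (_↔_; Inverse; mk↔ₛ′; mk⇔; Equivalence)
open import Function.Construct.Composition using (_↔-∘_)
open import Function.Construct.Identity using (↔-id)
open import Function.Construct.Symmetry using (↔-sym)
open import Function.Definitions using (Injective)
open import Relation.Binary.Definitions using (tri<; tri≈; tri>)
open import Relation.Binary.PropositionalEquality hiding (J)
open import Relation.Nullary using (¬_; Dec; yes; no; does)
open import Relation.Nullary.Decidable using (_×-dec_; _⊎-dec_; _→-dec_; ¬?; map′; dec-true; dec-false; decidable-stable; from-yes)
open import Algebra.Properties.Semiring.Sum +-*-semiring using (sum; sum-cong-≗; ∑-distrib-+; ∑-comm; *-distribˡ-sum)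

-- Count in edges: a chosen vertex costs 6. A 4-cycle then has deficit 2 and an extremal graph
-- deficit 1. A bridge contributes one edge: it covers one extremal side, with two extremal sides it
-- leaves deficit 1 again (so the extremal class reproduces itself), and it cannot cover a 4-cycle.
-- But a 4-cycle needs no vertex of its own once one of its vertices is dominated from outside.
-- Without bridges at least two edges leave each component, so even a 4-cycle breaks even. The
-- vertex v itself still costs 6 while its degree may be only 3; the rest must come from edges
-- between its neighbours or from surpluses of components. Attachment by exactly two edges is too
-- poor for this, hence the separate argument. A bound on size alone does not survive the induction.
-- Extremal pieces therefore carry solutions through any prescribed vertex, used to dominate the
-- other end of a bridge, and solutions one smaller for when a suitable vertex is already dominated.

-- The subtraction-free shape of the equation turns each linear estimate into a semiring identity
-- for `solve-∀`; `c` is the slack of the estimate.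
≤-by : ∀ {a b L R} c → L ≤ R → b + L ≡ a + R + c → a ≤ b
≤-by {a} {b} {L} {R} c L≤R eq = +-cancelʳ-≤ L a b (begin
  a + L     ≤⟨ +-monoʳ-≤ a L≤R ⟩
  a + R     ≤⟨ m≤m+n (a + R) c ⟩
  a + R + c ≡⟨ eq ⟨
  b + L     ∎)
  where open ≤-Reasoning

-- Indicators and finite sums

𝟙 : Bool → ℕ
𝟙 true  = 1
𝟙 false = 0

𝟙≤1 : ∀ p → 𝟙 p ≤ 1
𝟙≤1 true  = ≤-refl
𝟙≤1 false = z≤n

1≤𝟙⇒true : ∀ {p} → 1 ≤ 𝟙 p → p ≡ true
1≤𝟙⇒true {true} _ = refl

true≢false : ∀ {p} → p ≡ true → p ≡ false → ⊥
true≢false refl ()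

¬true⇒false : ∀ {p} → ¬ (p ≡ true) → p ≡ false
¬true⇒false {true}  h = ⊥-elim (h refl)
¬true⇒false {false} _ = refl

dec-Bool : ∀ p → (p ≡ true) ⊎ (p ≡ false)
dec-Bool true  = inj₁ refl
dec-Bool false = inj₂ refl

does⇒ : ∀ {P : Set} (d : Dec P) → does d ≡ true → P
does⇒ (yes p) _ = p

sum-zero : ∀ {k} {f : Fin k → ℕ} → (∀ i → f i ≡ 0) → sum f ≡ 0
sum-zero {zero}  h = refl
sum-zero {suc k} h = cong₂ _+_ (h zero) (sum-zero (h ∘ suc))

sum-mono : ∀ {k} {f g : Fin k → ℕ} → (∀ i → f i ≤ g i) → sum f ≤ sum g
sum-mono {zero}  h = z≤n
sum-mono {suc k} h = +-mono-≤ (h zero) (sum-mono (h ∘ suc))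

term≤sum : ∀ {k} (f : Fin k → ℕ) i → f i ≤ sum f
term≤sum f zero    = m≤m+n _ _
term≤sum f (suc i) = ≤-trans (term≤sum (f ∘ suc) i) (m≤n+m _ _)

terms≤sum : ∀ {k} (f : Fin k → ℕ) {i j} → i ≢ j → f i + f j ≤ sum f
terms≤sum f {zero}  {zero}  i≢j = ⊥-elim (i≢j refl)
terms≤sum f {zero}  {suc j} _   = +-monoʳ-≤ (f zero) (term≤sum (f ∘ suc) j)
terms≤sum f {suc i} {zero}  _   = ≤-trans (≤-reflexive (+-comm (f (suc i)) (f zero)))
                                          (+-monoʳ-≤ (f zero) (term≤sum (f ∘ suc) i))
terms≤sum f {suc i} {suc j} i≢j =
  ≤-trans (terms≤sum (f ∘ suc) (i≢j ∘ cong suc)) (m≤n+m _ _)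

1≤sum⇒ : ∀ {k} (f : Fin k → ℕ) → 1 ≤ sum f → ∃[ i ] 1 ≤ f i
1≤sum⇒ {suc k} f h with f zero in eq
... | suc _ = zero , ≤-trans (s≤s z≤n) (≤-reflexive (sym eq))
... | zero with 1≤sum⇒ (f ∘ suc) h
...   | i , 1≤fi = suc i , 1≤fi

sum-single : ∀ {k} (a : Fin k) (h : Fin k → ℕ) → sum (λ x → 𝟙 (does (a ≟ x)) * h x) ≡ h a
sum-single zero    h = trans (cong₂ _+_ (*-identityˡ (h zero)) (sum-zero {f = λ x → 0 * h (suc x)} (λ _ → refl)))
                             (+-identityʳ (h zero))
sum-single (suc a) h = sum-single a (h ∘ suc)

does-≟-inj : ∀ {k n} {g : Fin k → Fin n} → Injective _≡_ _≡_ g →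
             ∀ i j → does (g i ≟ g j) ≡ does (j ≟ i)
does-≟-inj {g = g} g-inj i j with g i ≟ g j
... | yes p = sym (dec-true (j ≟ i) (sym (g-inj p)))
... | no ¬p = sym (dec-false (j ≟ i) (¬p ∘ cong g ∘ sym))

Enumerates : ∀ {k n} → (Fin k → Fin n) → (Fin n → Bool) → Set
Enumerates g A = Injective _≡_ _≡_ g × (∀ i → A (g i) ≡ true) × (∀ x → A x ≡ true → ∃[ i ] g i ≡ x)

indicator-enum : ∀ {k n} {g : Fin k → Fin n} {A : Fin n → Bool} → Enumerates g A →
                 ∀ x → 𝟙 (A x) ≡ sum (λ i → 𝟙 (does (g i ≟ x)))
indicator-enum {g = g} {A} (g-inj , g∈A , cover) x with A x in eq
... | false = sym (sum-zero (λ i → cong 𝟙 (dec-false (g i ≟ x)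
                (λ p → true≢false (g∈A i) (trans (cong A p) eq)))))
... | true with cover x eq
...   | j , refl = sym (begin
        sum (λ i → 𝟙 (does (g i ≟ g j)))      ≡⟨ sum-cong-≗ (λ i → trans (cong 𝟙 (does-≟-inj g-inj i j))
                                                                        (sym (*-identityʳ _))) ⟩
        sum (λ i → 𝟙 (does (j ≟ i)) * 1)      ≡⟨ sum-single j (λ _ → 1) ⟩
        1 ∎)
  where open ≡-Reasoning

-- Writing the indicator as a sum of point indicators and exchanging the sums leaves one term per
-- listed element. Degrees and edge counts of a copy of a concrete small graph thereby become
-- computable.
sum-enum : ∀ {k n} {g : Fin k → Fin n} {A : Fin n → Bool} → Enumerates g A →
           ∀ h → sum (λ x → 𝟙 (A x) * h x) ≡ sum (h ∘ g)
sum-enum {g = g} {A} enum h = begin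
  sum (λ x → 𝟙 (A x) * h x)
    ≡⟨ sum-cong-≗ (λ x → trans (cong (_* h x) (indicator-enum enum x)) (*-comm (sum (λ i → 𝟙 (does (g i ≟ x)))) (h x))) ⟩
  sum (λ x → h x * sum (λ i → 𝟙 (does (g i ≟ x))))
    ≡⟨ sum-cong-≗ (λ x → *-distribˡ-sum (h x) (λ i → 𝟙 (does (g i ≟ x)))) ⟩
  sum (λ x → sum (λ i → h x * 𝟙 (does (g i ≟ x))))
    ≡⟨ ∑-comm (λ x i → h x * 𝟙 (does (g i ≟ x))) ⟩
  sum (λ i → sum (λ x → h x * 𝟙 (does (g i ≟ x))))
    ≡⟨ sum-cong-≗ (λ i → sum-cong-≗ (λ x → *-comm (h x) (𝟙 (does (g i ≟ x))))) ⟩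
  sum (λ i → sum (λ x → 𝟙 (does (g i ≟ x)) * h x))
    ≡⟨ sum-cong-≗ (λ i → sum-single (g i) h) ⟩
  sum (h ∘ g) ∎
  where open ≡-Reasoning

≤-via : ∀ {a a′ b′ b} → a ≡ a′ → a′ ≤ b′ → b′ ≡ b → a ≤ b
≤-via p q r = ≤-trans (≤-reflexive p) (≤-trans q (≤-reflexive r))

sum-ones : ∀ k → sum {k} (λ _ → 1) ≡ k
sum-ones zero    = refl
sum-ones (suc k) = cong suc (sum-ones k)

sumᴸ-allFin : ∀ {k} (f : Fin k → ℕ) → sumᴸ (map f (allFin k)) ≡ sum f
sumᴸ-allFin {k} f = trans (cong sumᴸ (map-tabulate id f)) (go f)
  where
  go : ∀ {k} (f : Fin k → ℕ) → sumᴸ (List.tabulate f) ≡ sum f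
  go {zero}  f = refl
  go {suc k} f = cong (f zero +_) (go (f ∘ suc))

∣∣-sum : ∀ {k} (p : Subset k) → ∣ p ∣ ≡ sum (λ x → 𝟙 (lookup p x))
∣∣-sum []          = refl
∣∣-sum (true ∷ p)  = cong suc (∣∣-sum p)
∣∣-sum (false ∷ p) = ∣∣-sum p

least : ∀ {P : ℕ → Set} → (∀ k → Dec (P k)) → ∀ m → P m → ∃[ k ] (P k × (∀ j → P j → k ≤ j))
least {P} P? m pm = go m 0 (≤-reflexive (sym (+-identityʳ m))) (λ j ())
  where
  -- `d` bounds the remaining search: when it is used up, `k` has reached `m` and everything below
  -- has failed.
  go : ∀ d k → m ≤ d + k → (∀ j → j < k → ¬ P j) → ∃[ k ] (P k × (∀ j → P j → k ≤ j))
  go zero k m≤k below = m , pm , λ j pj → ≮⇒≥ (λ j<m → below j (≤-trans j<m m≤k) pj)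
  go (suc d) k m≤ below with P? k
  ... | yes pk = k , pk , λ j pj → ≮⇒≥ (λ j<k → below j j<k pj)
  ... | no ¬pk = go d (suc k) (≤-trans m≤ (≤-reflexive (sym (+-suc d k)))) λ j j<1+k →
        [ below j , (λ { refl → ¬pk }) ]′ (m≤n⇒m<n∨m≡n (≤-pred j<1+k))

edgeCount-empty : ∀ k → edgeCount k (λ _ _ → false) ≡ 0
edgeCount-empty k = trans (sumᴸ-allFin row) (sum-zero {f = row} λ x → trans (sumᴸ-allFin (entry x)) (sum-zero {f = entry x} (zero-entry x)))
  where
  entry : Fin k → Fin k → ℕ
  entry x y = if (toℕ x <ᵇ toℕ y) ∧ false then 1 else 0
  row : Fin k → ℕ
  row x = sumᴸ (map (entry x) (allFin k))
  zero-entry : ∀ x y → entry x y ≡ 0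
  zero-entry x y with toℕ x <ᵇ toℕ y
  ... | true  = refl
  ... | false = refl

module Isolation (G : Graph) where

  -- Vertex sets, partitions and edge counts

  V : Set
  V = Fin (n G)

  Sub : Set
  Sub = V → Bool

  infix 4 _~_ _∈_ _⊆_

  _~_ : V → V → Set
  x ~ y = adj G x y ≡ true

  ~-sym : ∀ {x y} → x ~ y → y ~ x
  ~-sym {x} {y} h = trans (adj-sym G y x) h

  ~-irr : ∀ {x} → ¬ (x ~ x)
  ~-irr {x} h = true≢false h (adj-irr G x)

  _∈_ : V → Sub → Set
  x ∈ A = A x ≡ true

  _⊆_ : Sub → Sub → Set
  A ⊆ B = ∀ x → x ∈ A → x ∈ B

  NonEmpty : Sub → Set
  NonEmpty A = ∃[ x ] x ∈ A

  nonEmpty? : ∀ A → NonEmpty A ⊎ ¬ NonEmpty A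
  nonEmpty? A with any? (λ x → A x Bool.≟ true)
  ... | yes p = inj₁ p
  ... | no ¬p = inj₂ ¬p

  sg : V → Sub
  sg x y = does (x ≟ y)

  x∈sg : ∀ x → x ∈ sg x
  x∈sg x = dec-true (x ≟ x) refl

  ∈sg⇒ : ∀ {x y} → y ∈ sg x → x ≡ y
  ∈sg⇒ {x} {y} = does⇒ (x ≟ y)

  sg⊆ : ∀ {x A} → x ∈ A → sg x ⊆ A
  sg⊆ {A = A} x∈A y y∈ = subst (_∈ A) (∈sg⇒ y∈) x∈A

  infixl 6 _∖_
  infixr 5 _∪_

  _∖_ : Sub → Sub → Sub
  (A ∖ B) x = A x ∧ not (B x)

  _∪_ : Sub → Sub → Sub
  (A ∪ B) x = A x ∨ B x

  ∈∖ : ∀ {x} A B → x ∈ A → ¬ (x ∈ B) → x ∈ A ∖ B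
  ∈∖ {x} A B x∈A x∉B with A x | B x
  ... | true | false = refl
  ... | true | true  = ⊥-elim (x∉B refl)

  ∖⊆ : ∀ A B → A ∖ B ⊆ A
  ∖⊆ A B x h with A x
  ... | true = refl

  ∖-∉ : ∀ {x} A B → x ∈ A ∖ B → ¬ (x ∈ B)
  ∖-∉ {x} A B h x∈B with A x | B x
  ∖-∉ A B () refl | true | true

  ∈∖sg : ∀ A {x y} → x ∈ A → y ≢ x → x ∈ A ∖ sg y
  ∈∖sg A {x} {y} x∈A y≢x = ∈∖ A (sg y) x∈A (y≢x ∘ ∈sg⇒)

  ∖sg-≢ : ∀ A y {x} → x ∈ A ∖ sg y → y ≢ x
  ∖sg-≢ A y h refl = ∖-∉ A (sg y) h (x∈sg y)

  ∈-or-∖ : ∀ {x} A B → x ∈ A → x ∈ B ⊎ x ∈ A ∖ B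
  ∈-or-∖ {x} A B x∈A with dec-Bool (B x)
  ... | inj₁ t = inj₁ t
  ... | inj₂ f = inj₂ (∈∖ A B x∈A (λ t → true≢false t f))

  ∪ˡ : ∀ {A B} → A ⊆ A ∪ B
  ∪ˡ {A} x h rewrite h = refl

  ∪ʳ : ∀ {A B} → B ⊆ A ∪ B
  ∪ʳ {A} {B} x h with A x
  ... | true  = refl
  ... | false = h

  ∪⇒ : ∀ {x} A B → x ∈ A ∪ B → x ∈ A ⊎ x ∈ B
  ∪⇒ {x} A B h with A x
  ... | true  = inj₁ refl
  ... | false = inj₂ h

  -- One numerical equation expresses both disjointness and covering, in the form in which sums
  -- decompose.
  record Split (P A B : Sub) : Set where
    constructor mkSplit
    field at : ∀ x → 𝟙 (P x) ≡ 𝟙 (A x) + 𝟙 (B x)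
  open Split

  split-sym : ∀ {P A B} → Split P A B → Split P B A
  split-sym {P} {A} {B} s .at x = trans (at s x) (+-comm (𝟙 (A x)) (𝟙 (B x)))

  split-ˡ : ∀ {P A B} → Split P A B → A ⊆ P
  split-ˡ {P} {A} {B} s x h with P x | at s x
  ... | true  | _  = refl
  ... | false | eq rewrite h = ⊥-elim (0≢1+n eq)

  split-ʳ : ∀ {P A B} → Split P A B → B ⊆ P
  split-ʳ s = split-ˡ (split-sym s)

  split-⊎ : ∀ {P A B} → Split P A B → ∀ x → x ∈ P → x ∈ A ⊎ x ∈ B
  split-⊎ {P} {A} {B} s x h with A x | at s x
  ... | true  | _  = inj₁ refl
  ... | false | eq rewrite h = inj₂ (1≤𝟙⇒true (≤-reflexive eq))

  split-disj : ∀ {P A B} → Split P A B → ∀ {x} → x ∈ A → x ∈ B → ⊥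
  split-disj {P} {A} {B} s {x} a b with at s x
  ... | eq rewrite a | b with P x
  ...   | true  = 0≢1+n (suc-injective eq)
  ...   | false = 0≢1+n eq

  split-∖ : ∀ {P A} → A ⊆ P → Split P A (P ∖ A)
  split-∖ {P} {A} A⊆P .at x with A x in eqA | P x in eqP
  ... | true  | true  = refl
  ... | true  | false = ⊥-elim (true≢false (A⊆P x eqA) eqP)
  ... | false | true  = refl
  ... | false | false = refl

  split-∪ : ∀ {A B} → (∀ x → x ∈ A → x ∈ B → ⊥) → Split (A ∪ B) A B
  split-∪ {A} {B} disj .at x with A x in eqA | B x in eqB
  ... | true  | true  = ⊥-elim (disj x eqA eqB)
  ... | true  | false = refl
  ... | false | true  = refl
  ... | false | false = refl

  𝟙-mono : ∀ {p q} → (p ≡ true → q ≡ true) → 𝟙 p ≤ 𝟙 q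
  𝟙-mono {true}  h rewrite h refl = ≤-refl
  𝟙-mono {false} h = z≤n

  𝟙-cover : ∀ {p q r} → (p ≡ true → q ≡ true ⊎ r ≡ true) → 𝟙 p ≤ 𝟙 q + 𝟙 r
  𝟙-cover {true} {q} {r} h with h refl
  ... | inj₁ refl = s≤s z≤n
  ... | inj₂ refl = m≤n+m 1 (𝟙 q)
  𝟙-cover {false} h = z≤n

  1≤𝟙*⇒ : ∀ {p k} → 1 ≤ 𝟙 p * k → p ≡ true × 1 ≤ k
  1≤𝟙*⇒ {true} {k} h = refl , ≤-trans h (≤-reflexive (*-identityˡ k))

  -- nb B x is the number of neighbours of x in B, and e A B the number of pairs (a , b) ∈ A × B with a ~ b;
  -- so e P P is twice the number of edges inside P.
  opaque
    nb : Sub → V → ℕ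
    nb B x = sum (λ y → 𝟙 (B y) * 𝟙 (adj G x y))

    e : Sub → Sub → ℕ
    e A B = sum (λ x → 𝟙 (A x) * nb B x)

    cnt : Sub → ℕ
    cnt A = sum (λ x → 𝟙 (A x))

    nb-split : ∀ {B B₁ B₂} → Split B B₁ B₂ → ∀ x → nb B x ≡ nb B₁ x + nb B₂ x
    nb-split {B} {B₁} {B₂} s x = trans
      (sum-cong-≗ (λ y → trans (cong (_* 𝟙 (adj G x y)) (at s y)) (*-distribʳ-+ (𝟙 (adj G x y)) (𝟙 (B₁ y)) (𝟙 (B₂ y)))))
      (∑-distrib-+ (λ y → 𝟙 (B₁ y) * 𝟙 (adj G x y)) (λ y → 𝟙 (B₂ y) * 𝟙 (adj G x y)))

    nb-mono : ∀ {B C} → B ⊆ C → ∀ x → nb B x ≤ nb C x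
    nb-mono B⊆C x = sum-mono (λ y → *-monoˡ-≤ (𝟙 (adj G x y)) (𝟙-mono (B⊆C y)))

    nb-cover : ∀ {B B₁ B₂} → (∀ y → y ∈ B → y ∈ B₁ ⊎ y ∈ B₂) → ∀ x → nb B x ≤ nb B₁ x + nb B₂ x
    nb-cover {B} {B₁} {B₂} h x = ≤-trans
      (sum-mono (λ y → ≤-trans (*-monoˡ-≤ (𝟙 (adj G x y)) (𝟙-cover (h y)))
                               (≤-reflexive (*-distribʳ-+ (𝟙 (adj G x y)) (𝟙 (B₁ y)) (𝟙 (B₂ y))))))
      (≤-reflexive (∑-distrib-+ (λ y → 𝟙 (B₁ y) * 𝟙 (adj G x y)) (λ y → 𝟙 (B₂ y) * 𝟙 (adj G x y))))

    e-splitʳ : ∀ A {B B₁ B₂} → Split B B₁ B₂ → e A B ≡ e A B₁ + e A B₂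
    e-splitʳ A {B} {B₁} {B₂} s = trans
      (sum-cong-≗ (λ x → trans (cong (𝟙 (A x) *_) (nb-split {B} {B₁} {B₂} s x)) (*-distribˡ-+ (𝟙 (A x)) (nb B₁ x) (nb B₂ x))))
      (∑-distrib-+ (λ x → 𝟙 (A x) * nb B₁ x) (λ x → 𝟙 (A x) * nb B₂ x))

    e-splitˡ : ∀ {A A₁ A₂} B → Split A A₁ A₂ → e A B ≡ e A₁ B + e A₂ B
    e-splitˡ {A} {A₁} {A₂} B s = trans
      (sum-cong-≗ (λ x → trans (cong (_* nb B x) (at s x)) (*-distribʳ-+ (nb B x) (𝟙 (A₁ x)) (𝟙 (A₂ x)))))
      (∑-distrib-+ (λ x → 𝟙 (A₁ x) * nb B x) (λ x → 𝟙 (A₂ x) * nb B x))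

    e-comm : ∀ A B → e A B ≡ e B A
    e-comm A B = begin
      e A B                                              ≡⟨ sum-cong-≗ (λ x → *-distribˡ-sum (𝟙 (A x)) (λ y → 𝟙 (B y) * 𝟙 (adj G x y))) ⟩
      sum (λ x → sum (λ y → 𝟙 (A x) * (𝟙 (B y) * 𝟙 (adj G x y)))) ≡⟨ ∑-comm (λ x y → 𝟙 (A x) * (𝟙 (B y) * 𝟙 (adj G x y))) ⟩
      sum (λ y → sum (λ x → 𝟙 (A x) * (𝟙 (B y) * 𝟙 (adj G x y)))) ≡⟨ sum-cong-≗ (λ y → sum-cong-≗ (λ x → swap x y)) ⟩
      sum (λ y → sum (λ x → 𝟙 (B y) * (𝟙 (A x) * 𝟙 (adj G y x)))) ≡⟨ sum-cong-≗ (λ y → *-distribˡ-sum (𝟙 (B y)) (λ x → 𝟙 (A x) * 𝟙 (adj G y x))) ⟨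
      e B A                                              ∎
      where
      open ≡-Reasoning
      exchange : ∀ a b c → a * (b * c) ≡ b * (a * c)
      exchange = solve-∀
      swap : ∀ x y → 𝟙 (A x) * (𝟙 (B y) * 𝟙 (adj G x y)) ≡ 𝟙 (B y) * (𝟙 (A x) * 𝟙 (adj G y x))
      swap x y = trans (cong (λ z → 𝟙 (A x) * (𝟙 (B y) * 𝟙 z)) (adj-sym G x y))
                       (exchange (𝟙 (A x)) (𝟙 (B y)) (𝟙 (adj G y x)))

    e-mono : ∀ {A A′ B B′} → A ⊆ A′ → B ⊆ B′ → e A B ≤ e A′ B′
    e-mono {A} {A′} {B} {B′} A⊆ B⊆ = sum-mono (λ x → *-mono-≤ (𝟙-mono (A⊆ x)) (nb-mono {B} {B′} B⊆ x))

    e-coverʳ : ∀ A {B B₁ B₂} → (∀ y → y ∈ B → y ∈ B₁ ⊎ y ∈ B₂) → e A B ≤ e A B₁ + e A B₂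
    e-coverʳ A {B} {B₁} {B₂} h = ≤-trans
      (sum-mono (λ x → ≤-trans (*-monoʳ-≤ (𝟙 (A x)) (nb-cover {B} {B₁} {B₂} h x)) (≤-reflexive (*-distribˡ-+ (𝟙 (A x)) (nb B₁ x) (nb B₂ x)))))
      (≤-reflexive (∑-distrib-+ (λ x → 𝟙 (A x) * nb B₁ x) (λ x → 𝟙 (A x) * nb B₂ x)))

    e-sg : ∀ x B → e (sg x) B ≡ nb B x
    e-sg x B = sum-single x (nb B)

    nb-sg : ∀ x y → nb (sg y) x ≡ 𝟙 (adj G x y)
    nb-sg x y = sum-single y (λ z → 𝟙 (adj G x z))

    nb-edge : ∀ {B x y} → y ∈ B → x ~ y → 1 ≤ nb B x
    nb-edge {B} {x} {y} y∈B x~y = ≤-trans (≤-reflexive (sym (cong₂ (λ p q → 𝟙 p * 𝟙 q) y∈B x~y)))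
                                          (term≤sum (λ y → 𝟙 (B y) * 𝟙 (adj G x y)) y)

    nb-two : ∀ {B x y z} → y ∈ B → x ~ y → z ∈ B → x ~ z → y ≢ z → 2 ≤ nb B x
    nb-two {B} {x} {y} {z} y∈B x~y z∈B x~z y≢z =
      ≤-trans (≤-reflexive (sym (cong₂ _+_ (cong₂ (λ p q → 𝟙 p * 𝟙 q) y∈B x~y) (cong₂ (λ p q → 𝟙 p * 𝟙 q) z∈B x~z))))
              (terms≤sum (λ y → 𝟙 (B y) * 𝟙 (adj G x y)) y≢z)

    nb⇒edge : ∀ {B x} → 1 ≤ nb B x → ∃[ y ] (y ∈ B × x ~ y)
    nb⇒edge {B} {x} h with 1≤sum⇒ (λ y → 𝟙 (B y) * 𝟙 (adj G x y)) h
    ... | y , h′ with 1≤𝟙*⇒ {B y} h′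
    ...   | y∈B , h″ = y , y∈B , 1≤𝟙⇒true h″

    nb≤e : ∀ {A x} B → x ∈ A → nb B x ≤ e A B
    nb≤e {A} {x} B x∈A = ≤-trans (≤-reflexive (sym (trans (cong (λ p → 𝟙 p * nb B x) x∈A) (*-identityˡ (nb B x)))))
                                 (term≤sum (λ x → 𝟙 (A x) * nb B x) x)

    e⇒edge : ∀ {A B} → 1 ≤ e A B → ∃[ x ] ∃[ y ] (x ∈ A × y ∈ B × x ~ y)
    e⇒edge {A} {B} h with 1≤sum⇒ (λ x → 𝟙 (A x) * nb B x) h
    ... | x , h′ with 1≤𝟙*⇒ {A x} h′
    ...   | x∈A , h″ with nb⇒edge {B} {x} h″
    ...     | y , y∈B , x~y = x , y , x∈A , y∈B , x~y

    e-empty : ∀ {A} B → ¬ NonEmpty A → e A B ≡ 0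
    e-empty {A} B A∅ = sum-zero (λ x → cong (λ p → 𝟙 p * nb B x) (¬true⇒false (λ x∈A → A∅ (x , x∈A))))

    cnt-split : ∀ {P A B} → Split P A B → cnt P ≡ cnt A + cnt B
    cnt-split {P} {A} {B} s = trans (sum-cong-≗ (at s)) (∑-distrib-+ (λ x → 𝟙 (A x)) (λ x → 𝟙 (B x)))

    cnt-mono : ∀ {A B} → A ⊆ B → cnt A ≤ cnt B
    cnt-mono A⊆B = sum-mono (λ x → 𝟙-mono (A⊆B x))

    cnt-sg : ∀ x → cnt (sg x) ≡ 1
    cnt-sg x = trans (sum-cong-≗ (λ y → sym (*-identityʳ (𝟙 (sg x y))))) (sum-single x (λ _ → 1))

    NonEmpty⇒1≤cnt : ∀ {A} → NonEmpty A → 1 ≤ cnt A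
    NonEmpty⇒1≤cnt {A} (x , x∈A) = ≤-trans (≤-reflexive (sym (cong 𝟙 x∈A))) (term≤sum (λ x → 𝟙 (A x)) x)

    1≤cnt⇒NonEmpty : ∀ {A} → 1 ≤ cnt A → NonEmpty A
    1≤cnt⇒NonEmpty {A} h with 1≤sum⇒ (λ x → 𝟙 (A x)) h
    ... | x , h′ = x , 1≤𝟙⇒true h′

    min-degree⇒≤e : ∀ {A B} k → (∀ x → x ∈ A → k ≤ nb B x) → k * cnt A ≤ e A B
    min-degree⇒≤e {A} {B} k h = ≤-trans (≤-reflexive (*-distribˡ-sum k (λ x → 𝟙 (A x)))) (sum-mono row)
      where
      row : ∀ x → k * 𝟙 (A x) ≤ 𝟙 (A x) * nb B x
      row x with A x in eq
      ... | true  = ≤-trans (≤-reflexive (*-identityʳ k)) (≤-trans (h x eq) (≤-reflexive (sym (*-identityˡ (nb B x)))))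
      ... | false = ≤-reflexive (*-zeroʳ k)

    nb-enum : ∀ {k P} {g : Fin k → V} → Enumerates g P → ∀ x → nb P x ≡ sum (λ j → 𝟙 (adj G x (g j)))
    nb-enum en x = sum-enum en (λ y → 𝟙 (adj G x y))

    cnt-enum : ∀ {k P} {g : Fin k → V} → Enumerates g P → cnt P ≡ sum {k} (λ _ → 1)
    cnt-enum {P = P} en = trans (sum-cong-≗ (λ y → sym (*-identityʳ (𝟙 (P y))))) (sum-enum en (λ _ → 1))

    nbs≤e : ∀ {A x y} B → x ∈ A → y ∈ A → x ≢ y → nb B x + nb B y ≤ e A B
    nbs≤e {A} {x} {y} B x∈A y∈A x≢y = ≤-trans
      (≤-reflexive (sym (cong₂ _+_ (trans (cong (λ p → 𝟙 p * nb B x) x∈A) (*-identityˡ (nb B x)))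
                                   (trans (cong (λ p → 𝟙 p * nb B y) y∈A) (*-identityˡ (nb B y))))))
      (terms≤sum (λ x → 𝟙 (A x) * nb B x) x≢y)

    e-enum : ∀ {k P} {g : Fin k → V} → Enumerates g P → ∀ B → e P B ≡ sum (λ i → nb B (g i))
    e-enum en B = sum-enum en (nb B)

  e-edge : ∀ {A B x y} → x ∈ A → y ∈ B → x ~ y → 1 ≤ e A B
  e-edge {B = B} x∈A y∈B x~y = ≤-trans (nb-edge y∈B x~y) (nb≤e B x∈A)

  e-two : ∀ {A B x y x′ y′} → x ∈ A → y ∈ B → x ~ y → x′ ∈ A → y′ ∈ B → x′ ~ y′ →
          (x ≡ x′ → y ≡ y′ → ⊥) → 2 ≤ e A B
  e-two {A} {B} {x} {y} {x′} {y′} x∈A y∈B x~y x′∈A y′∈B x′~y′ distinct with x ≟ x′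
  ... | yes refl = ≤-trans (nb-two y∈B x~y y′∈B x′~y′ (distinct refl)) (nb≤e B x∈A)
  ... | no x≢x′  = ≤-trans (+-mono-≤ (nb-edge y∈B x~y) (nb-edge y′∈B x′~y′)) (nbs≤e B x∈A x′∈A x≢x′)

  -- An edge inside `A` is counted in both orders.
  1≤ee⇒2≤ : ∀ {A} → 1 ≤ e A A → 2 ≤ e A A
  1≤ee⇒2≤ h with e⇒edge h
  ... | x , y , x∈ , y∈ , x~y = e-two x∈ y∈ x~y y∈ x∈ (~-sym x~y) (λ { refl _ → ~-irr x~y })

  ee-split : ∀ {P A B} → Split P A B → e P P ≡ e A A + 2 * e A B + e B B
  ee-split {P} {A} {B} s = begin
    e P P                             ≡⟨ e-splitˡ P s ⟩
    e A P + e B P                     ≡⟨ cong₂ _+_ (e-splitʳ A s) (e-splitʳ B s) ⟩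
    e A A + e A B + (e B A + e B B)   ≡⟨ cong (λ k → e A A + e A B + (k + e B B)) (e-comm B A) ⟩
    e A A + e A B + (e A B + e B B)   ≡⟨ regroup (e A A) (e A B) (e B B) ⟩
    e A A + 2 * e A B + e B B         ∎
    where
    open ≡-Reasoning
    regroup : ∀ a c b → a + c + (c + b) ≡ a + 2 * c + b
    regroup = solve-∀

  ee-sg : ∀ x → e (sg x) (sg x) ≡ 0
  ee-sg x = trans (e-sg x (sg x)) (trans (nb-sg x x) (cong 𝟙 (adj-irr G x)))

  cnt-< : ∀ {A P x} → A ⊆ P → x ∈ P → ¬ (x ∈ A) → cnt A < cnt P
  cnt-< {A} {P} {x} A⊆P x∈P x∉A = begin
    suc (cnt A)            ≤⟨ +-monoˡ-≤ (cnt A) (NonEmpty⇒1≤cnt (x , ∈∖ P A x∈P x∉A)) ⟩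
    cnt (P ∖ A) + cnt A    ≡⟨ +-comm (cnt (P ∖ A)) (cnt A) ⟩
    cnt A + cnt (P ∖ A)    ≡⟨ cnt-split (split-∖ A⊆P) ⟨
    cnt P                  ∎
    where open ≤-Reasoning

  Copy : ∀ {k} → (Fin k → Fin k → Bool) → Sub → (Fin k → V) → Set
  Copy a P g = Enumerates g P × (∀ i j → adj G (g i) (g j) ≡ a i j)

  copy-nb : ∀ {k a P g} → Copy {k} a P g → ∀ i → nb P (g i) ≡ sum (λ j → 𝟙 (a i j))
  copy-nb {g = g} (en , ad) i = trans (nb-enum en (g i)) (sum-cong-≗ (λ j → cong 𝟙 (ad i j)))

  copy-ee : ∀ {k a P g} → Copy {k} a P g → e P P ≡ sum (λ i → sum (λ j → 𝟙 (a i j)))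
  copy-ee {P = P} c@(en , _) = trans (e-enum en P) (sum-cong-≗ (copy-nb c))

  opaque
    enumerate : ∀ k {A} → cnt A ≡ k → ∃[ g ] Enumerates {k} g A
    enumerate zero {A} eq = (λ ()) , (λ { {()} }) , (λ ()) ,
      (λ x x∈A → ⊥-elim (1+n≰n (≤-trans (NonEmpty⇒1≤cnt (x , x∈A)) (≤-reflexive eq))))
    enumerate (suc k) {A} eq with 1≤cnt⇒NonEmpty {A} (≤-trans (s≤s z≤n) (≤-reflexive (sym eq)))
    ... | a , a∈A with enumerate k {A ∖ sg a} (suc-injective (trans (sym (trans (cnt-split (split-∖ (sg⊆ a∈A))) (cong (_+ cnt (A ∖ sg a)) (cnt-sg a)))) eq))
    ...   | g , g-inj , g∈ , g-cov = h , h-inj , h∈ , h-cov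
      where
      h : Fin (suc k) → V
      h zero    = a
      h (suc i) = g i
      a≢g : ∀ i → a ≢ g i
      a≢g i p = ∖-∉ A (sg a) (g∈ i) (subst (_∈ sg a) p (x∈sg a))
      h-inj : Injective _≡_ _≡_ h
      h-inj {zero}  {zero}  _ = refl
      h-inj {zero}  {suc j} p = ⊥-elim (a≢g j p)
      h-inj {suc i} {zero}  p = ⊥-elim (a≢g i (sym p))
      h-inj {suc i} {suc j} p = cong suc (g-inj p)
      h∈ : ∀ i → h i ∈ A
      h∈ zero    = a∈A
      h∈ (suc i) = ∖⊆ A (sg a) _ (g∈ i)
      h-cov : ∀ x → x ∈ A → ∃[ i ] h i ≡ x
      h-cov x x∈A with ∈-or-∖ A (sg a) x∈A
      ... | inj₁ x∈a = zero , ∈sg⇒ x∈a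
      ... | inj₂ x∈  with g-cov x x∈
      ...   | i , p = suc i , p

  -- Cuts and cycles

  -- The search runs over bit vectors. An arbitrary part `A` is compared with its tabulation through
  -- inclusions, which suffice because `e` is monotone.
  cut? : ∀ P k → (∃[ A ] ∃[ B ] (Split P A B × NonEmpty A × NonEmpty B × e A B ≤ k))
               ⊎ (∀ A B → Split P A B → NonEmpty A → NonEmpty B → k < e A B)
  cut? P k with anySubset? (λ s → any? (λ x → part s x Bool.≟ true)
                            ×-dec any? (λ x → (P ∖ part s) x Bool.≟ true)
                            ×-dec e (part s) (P ∖ part s) ≤? k)
    where
    part : Vec Bool (n G) → Sub
    part s x = P x ∧ lookup s x
  ... | yes (s , A≢∅ , B≢∅ , small) = inj₁ (A , P ∖ A , split-∖ A⊆P , A≢∅ , B≢∅ , small)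
    where
    A : Sub
    A x = P x ∧ lookup s x
    A⊆P : A ⊆ P
    A⊆P x h with P x
    ... | true = refl
  ... | no none = inj₂ λ A B s (a , a∈A) (b , b∈B) → ≰⇒> λ small →
    let A′ : Sub
        A′ x = P x ∧ lookup (tabulate A) x
        ⊆A : A′ ⊆ A
        ⊆A = from A
        A⊆ : A ⊆ A′
        A⊆ = into A (split-ˡ s)
        ⊆B : P ∖ A′ ⊆ B
        ⊆B x h = [ (λ x∈A → ⊥-elim (∖-∉ P A′ h (A⊆ x x∈A))) , id ]′ (split-⊎ s x (∖⊆ P A′ x h))
    in none ( tabulate A , (a , A⊆ a a∈A)
            , (b , ∈∖ P A′ (split-ʳ s b b∈B) (λ h → split-disj s (⊆A b h) b∈B))
            , ≤-trans (e-mono ⊆A ⊆B) small )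
    where
    from : ∀ A x → P x ∧ lookup (tabulate A) x ≡ true → x ∈ A
    from A x h with P x
    ... | true = trans (sym (lookup∘tabulate A x)) h
    into : ∀ A → A ⊆ P → ∀ x → x ∈ A → P x ∧ lookup (tabulate A) x ≡ true
    into A A⊆P x h rewrite A⊆P x h = trans (lookup∘tabulate A x) h

  CutConnected : Sub → Set
  CutConnected P = NonEmpty P × (∀ A B → Split P A B → NonEmpty A → NonEmpty B → 1 ≤ e A B)

  Bridgeless : Sub → Set
  Bridgeless P = ∀ A B → Split P A B → NonEmpty A → NonEmpty B → 2 ≤ e A B

  bridgeless-∖ : ∀ {W H} → Bridgeless W → H ⊆ W → NonEmpty H → NonEmpty (W ∖ H) → 2 ≤ e H (W ∖ H)
  bridgeless-∖ {W} {H} bl H⊆W = bl H (W ∖ H) (split-∖ H⊆W)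

  record Comp (Q H : Sub) : Set where
    field
      sub  : H ⊆ Q
      conn : CutConnected H
      sep  : e H (Q ∖ H) ≡ 0
  open Comp

  -- While an empty cut exists, keep the side containing `x`, which has fewer vertices. Separation
  -- persists because the discarded side has no edge to the kept one.
  component≤ : ∀ k Q {x} → cnt Q ≤ k → x ∈ Q → ∃[ H ] (x ∈ H × Comp Q H)
  component≤ zero Q {x} Q≤0 x∈Q = ⊥-elim (1+n≰n (≤-trans (NonEmpty⇒1≤cnt (x , x∈Q)) Q≤0))
  component≤ (suc k) Q {x} Q≤ x∈Q with cut? Q 0
  ... | inj₂ none = Q , x∈Q , record { sub = λ _ → id ; conn = (x , x∈Q) , none
      ; sep = trans (e-comm Q (Q ∖ Q)) (e-empty Q (λ (y , y∈) → ∖-∉ Q Q y∈ (∖⊆ Q Q y y∈))) }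
  ... | inj₁ (A , B , s , A≢∅ , B≢∅ , small) =
    [ inside s B≢∅ small , inside (split-sym s) A≢∅ (≤-trans (≤-reflexive (e-comm B A)) small) ]′ (split-⊎ s x x∈Q)
    where
    inside : ∀ {A B} → Split Q A B → NonEmpty B → e A B ≤ 0 → x ∈ A → ∃[ H ] (x ∈ H × Comp Q H)
    inside {A} {B} s (b , b∈B) small x∈A
      with component≤ k A (≤-pred (≤-trans (cnt-< (split-ˡ s) (split-ʳ s b b∈B) (λ b∈A → split-disj s b∈A b∈B)) Q≤)) x∈A
    ... | H , x∈H , C = H , x∈H , record { sub = λ y y∈ → split-ˡ s y (sub C y y∈) ; conn = conn C ; sep = n≤0⇒n≡0 bound }
      where
      cover : ∀ y → y ∈ Q ∖ H → y ∈ A ∖ H ⊎ y ∈ B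
      cover y y∈ = map₁ (λ y∈A → ∈∖ A H y∈A (∖-∉ Q H y∈)) (split-⊎ s y (∖⊆ Q H y y∈))
      bound : e H (Q ∖ H) ≤ 0
      bound = ≤-trans (e-coverʳ H cover) (+-mono-≤ (≤-reflexive (sep C)) (≤-trans (e-mono (sub C) (λ _ → id)) small))

  component : ∀ Q {x} → x ∈ Q → ∃[ H ] (x ∈ H × Comp Q H)
  component Q = component≤ (cnt Q) Q ≤-refl

  nxt : ∀ {j} → Fin (suc j) → Fin (suc j)
  nxt i with view i
  ... | ‵fromℕ     = zero
  ... | ‵inject₁ k = suc k

  prv : ∀ {j} → Fin (suc j) → Fin (suc j)
  prv zero    = fromℕ _
  prv (suc k) = inject₁ k

  toℕ-nxt : ∀ {j} (i : Fin (suc j)) → toℕ (nxt i) ≡ suc (toℕ i) ⊎ (toℕ i ≡ j × toℕ (nxt i) ≡ 0)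
  toℕ-nxt {j} i with view i
  ... | ‵fromℕ     = inj₂ (toℕ-fromℕ j , refl)
  ... | ‵inject₁ k = inj₁ (cong suc (sym (toℕ-inject₁ k)))

  nxt-inject₁ : ∀ {j} (k : Fin j) → nxt (inject₁ k) ≡ suc k
  nxt-inject₁ k rewrite view-inject₁ k = refl

  nxt-fromℕ : ∀ j → nxt (fromℕ j) ≡ zero
  nxt-fromℕ j rewrite view-fromℕ j = refl

  nxt-prv : ∀ {j} (i : Fin (suc j)) → nxt (prv i) ≡ i
  nxt-prv {j} zero = nxt-fromℕ j
  nxt-prv (suc k)  = nxt-inject₁ k

  -- A `Cycle` of index `j` has `suc j` vertices, so at least three here: its two neighbours of a
  -- vertex are distinct.
  nxt-nxt≢ : ∀ {j} → 2 ≤ j → (i : Fin (suc j)) → nxt (nxt i) ≢ i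
  nxt-nxt≢ {j} 2≤j i eq with toℕ-nxt i | toℕ-nxt (nxt i)
  ... | inj₁ p | inj₁ q = m≢1+m+n (toℕ i) {1} (trans (cong toℕ (sym eq)) (trans q (cong suc (trans p (+-comm 1 (toℕ i))))))
  ... | inj₁ p | inj₂ (q , r) = 1+n≰n (≤-trans 2≤j (≤-reflexive (trans (sym q) (trans p (cong suc (trans (cong toℕ (sym eq)) r))))))
  ... | inj₂ (p , r) | inj₁ q = 1+n≰n (≤-trans 2≤j (≤-reflexive (trans (sym p) (trans (cong toℕ (sym eq)) (trans q (cong suc r))))))
  ... | inj₂ (p , r) | inj₂ (q , _) = n≮0 (≤-trans 2≤j (≤-reflexive (trans (sym q) r)))

  -- Follow `nxt` to the last index, wrap around to `zero`, and climb from there to `k`.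
  nxt-closed : ∀ {j} {P : Fin (suc j) → Set} → (∀ i → P i → P (nxt i)) → ∀ {i} → P i → ∀ k → P k
  nxt-closed {j} {P} closed {i} pi k = up (toℕ k) k refl
    where
    last : ∀ d i → toℕ i + d ≡ j → P i → P (fromℕ j)
    last zero    i eq p = subst P (toℕ-injective (trans (sym (+-identityʳ _)) (trans eq (sym (toℕ-fromℕ j))))) p
    last (suc d) i eq p with toℕ-nxt i
    ... | inj₁ q = last d (nxt i) (trans (cong (_+ d) q) (trans (sym (+-suc (toℕ i) d)) eq)) (closed i p)
    ... | inj₂ (q , _) = subst P (toℕ-injective (trans q (sym (toℕ-fromℕ j)))) p
    first : P zero
    first = subst P (nxt-fromℕ j) (closed (fromℕ j) (last (j ∸ toℕ i) i (m+[n∸m]≡n (≤-pred (toℕ<n i))) pi))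
    up : ∀ m k → toℕ k ≡ m → P k
    up _       zero    _  = first
    up (suc m) (suc k) eq = subst P (nxt-inject₁ k)
      (closed (inject₁ k) (up m (inject₁ k) (trans (toℕ-inject₁ k) (suc-injective eq))))

  cycle-nxt : ∀ {j} (C : Cycle (adj G) j) i → c C i ~ c C (nxt i)
  cycle-nxt C i with view i
  ... | ‵fromℕ     = close C
  ... | ‵inject₁ k = step C k

  -- A cycle that leaves `A` and also enters it crosses the cut twice. The two crossings are
  -- different edges, since otherwise `nxt` would return after two steps. A side that is never left,
  -- or never entered, contains all or nothing of the cycle.
  cycle-side : ∀ {j} → 2 ≤ j → (C : Cycle (adj G) j) → ∀ {A B} → e A B ≤ 1 →
               (∀ i → c C i ∈ A ⊎ c C i ∈ B) → (∀ i → c C i ∈ A) ⊎ (∀ i → c C i ∈ B)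
  cycle-side {j} 2≤j C {A} {B} small inAB
    with any? (λ i → A (c C i) Bool.≟ true ×-dec ¬? (A (c C (nxt i)) Bool.≟ true))
       | any? (λ i → ¬? (A (c C i) Bool.≟ true) ×-dec A (c C (nxt i)) Bool.≟ true)
  ... | yes (i , i∈ , i⁺∉) | yes (k , k∉ , k⁺∈) = ⊥-elim (1+n≰n (≤-trans
          (e-two i∈ (notA i⁺∉) (cycle-nxt C i) k⁺∈ (notA k∉) (~-sym (cycle-nxt C k))
            (λ p q → nxt-nxt≢ 2≤j k (trans (cong nxt (inj C (sym p))) (inj C q)))) small))
    where
    notA : ∀ {i} → ¬ (c C i ∈ A) → c C i ∈ B
    notA {i} i∉ = [ (λ i∈ → ⊥-elim (i∉ i∈)) , id ]′ (inAB i)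
  ... | no none | _ with A (c C zero) Bool.≟ true
  ...   | yes 0∈ = inj₁ (nxt-closed (λ i i∈ → decidable-stable (_ Bool.≟ _) (λ i⁺∉ → none (i , i∈ , i⁺∉))) 0∈)
  ...   | no 0∉ with any? (λ i → A (c C i) Bool.≟ true)
  ...     | yes (k , k∈) = ⊥-elim (0∉ (nxt-closed (λ i i∈ → decidable-stable (_ Bool.≟ _) (λ i⁺∉ → none (i , i∈ , i⁺∉))) k∈ zero))
  ...     | no none′ = inj₂ (λ i → [ (λ i∈ → ⊥-elim (none′ (i , i∈))) , id ]′ (inAB i))
  cycle-side {j} 2≤j C {A} {B} small inAB | yes _ | no none with any? (λ i → ¬? (A (c C i) Bool.≟ true))
  ... | no all = inj₁ (λ i → decidable-stable (_ Bool.≟ _) (λ i∉ → all (i , i∉)))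
  ... | yes (k , k∉) = inj₂ (λ i → [ (λ i∈ → ⊥-elim (nxt-closed (λ i i∉ i⁺∈ → none (i , i∉ , i⁺∈)) k∉ i i∈)) , id ]′ (inAB i))

  cycle-degree : ∀ {j} → 2 ≤ j → (C : Cycle (adj G) j) → ∀ {L} → (∀ i → c C i ∈ L) → ∀ i → 2 ≤ nb L (c C i)
  cycle-degree 2≤j C C⊆L i = nb-two (C⊆L (nxt i)) (cycle-nxt C i)
    (C⊆L (prv i)) (~-sym (subst (λ k → c C (prv i) ~ c C k) (nxt-prv i) (cycle-nxt C (prv i))))
    (λ p → nxt-nxt≢ 2≤j (prv i) (trans (cong nxt (nxt-prv i)) (inj C p)))

  -- Domination and isolating sets

  Dom : List V → V → Set
  Dom D x = Any (λ u → u ≡ x ⊎ u ~ x) D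

  infix 4 _≼_

  _≼_ : List V → List V → Set
  D ≼ D′ = ∀ x → Dom D x → Dom D′ x

  -- `D` is a list, so that lengths add under `++`; a repetition only overstates the size. Its
  -- members may lie outside `P`, which allows domination across a bridge.
  record Iso (P : Sub) (D : List V) : Set where
    constructor mkIso
    field hits : ∀ j → 3 ≤ j → (C : Cycle (adj G) j) → (∀ i → c C i ∈ P) → (∀ i → ¬ Dom D (c C i)) → ⊥
  open Iso

  iso-mono : ∀ {P P′ D D′} → Iso P D → D ≼ D′ → (∀ x → x ∈ P′ → Dom D′ x ⊎ x ∈ P) → Iso P′ D′
  iso-mono I D≼ cover .hits j 3≤j C C⊆P′ free =
    hits I j 3≤j C (λ i → [ (λ d → ⊥-elim (free i d)) , id ]′ (cover _ (C⊆P′ i))) (λ i d → free i (D≼ _ d))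

  iso-⊆ : ∀ {P P′ D D′} → Iso P D → D ≼ D′ → P′ ⊆ P → Iso P′ D′
  iso-⊆ I D≼ P′⊆P = iso-mono I D≼ (λ x → inj₂ ∘ P′⊆P x)

  -- With at most one edge between the parts, `cycle-side` puts every undominated cycle inside one
  -- of them.
  iso-join : ∀ {P P₁ P₂ D D₁ D₂} → Iso P₁ D₁ → Iso P₂ D₂ → e P₁ P₂ ≤ 1 → D₁ ≼ D → D₂ ≼ D →
             (∀ x → x ∈ P → Dom D x ⊎ (x ∈ P₁ ⊎ x ∈ P₂)) → Iso P D
  iso-join I₁ I₂ small D₁≼ D₂≼ cover .hits j 3≤j C C⊆P free
    with cycle-side (≤-trans (s≤s (s≤s z≤n)) 3≤j) C small (λ i → [ (λ d → ⊥-elim (free i d)) , id ]′ (cover _ (C⊆P i)))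
  ... | inj₁ C⊆ = hits I₁ j 3≤j C C⊆ (λ i d → free i (D₁≼ _ d))
  ... | inj₂ C⊆ = hits I₂ j 3≤j C C⊆ (λ i d → free i (D₂≼ _ d))

  -- Index `3 ≤ j` means at least four vertices, which do not fit injectively into three places.
  iso-small : ∀ {P D} (l : Fin 3 → V) → (∀ x → x ∈ P → Dom D x ⊎ (∃[ t ] l t ≡ x)) → Iso P D
  iso-small l cover .hits j 3≤j C C⊆P free = 1+n≰n (≤-trans (s≤s 3≤j) (injective⇒≤ {f = proj₁ ∘ pos} pos-inj))
    where
    pos : ∀ i → ∃[ t ] l t ≡ c C i
    pos i = [ (λ d → ⊥-elim (free i d)) , id ]′ (cover _ (C⊆P i))
    pos-inj : Injective _≡_ _≡_ (proj₁ ∘ pos)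
    pos-inj {i} {k} eq = inj C (trans (sym (proj₂ (pos i))) (trans (cong l eq) (proj₂ (pos k))))

  -- A vertex on a cycle inside `L` has two neighbours in `L`, so leaves of `L` may be discarded.
  iso-leaves : ∀ {P L D} → Iso P D → (∀ x → x ∈ L → x ∈ P ⊎ nb L x ≤ 1) → Iso L D
  iso-leaves I leaf .hits j 3≤j C C⊆L free = hits I j 3≤j C
    (λ i → [ id , (λ small → ⊥-elim (1+n≰n (≤-trans (cycle-degree (≤-trans (s≤s (s≤s z≤n)) 3≤j) C C⊆L i) small))) ]′ (leaf _ (C⊆L i)))
    free

  iso-empty : ∀ {P D} → ¬ NonEmpty P → Iso P D
  iso-empty P∅ .hits j _ C C⊆P _ = P∅ (c C zero , C⊆P zero)

  ≼-++ˡ : ∀ {D D′} → D ≼ D ++ D′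
  ≼-++ˡ x = ++⁺ˡ

  ≼-++ʳ : ∀ D {D′} → D′ ≼ D ++ D′
  ≼-++ʳ D x = ++⁺ʳ D

  ≼-∷ : ∀ {v D} → D ≼ v ∷ D
  ≼-∷ x = there

  ≼-refl : ∀ {D} → D ≼ D
  ≼-refl x = id

  []≼ : ∀ {D} → [] ≼ D
  []≼ x ()

  ∈ˡ⇒Dom : ∀ {D u x} → u ∈ˡ D → u ≡ x ⊎ u ~ x → Dom D x
  ∈ˡ⇒Dom u∈D near = Any.map (λ { refl → near }) u∈D

  -- Extremal graphs

  -- The factor 12 is 6 doubled, because `e P P` counts every edge twice.
  Good : Sub → Set
  Good P = ∃[ D ] (Iso P D × 12 * length D ≤ e P P)

  IsC₄ : Sub → Set
  IsC₄ P = ∃[ g ] Copy C₄-adj P g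

  -- The banner: a 4-cycle on 1, 2, 3, 4 with the pendant vertex 0 attached to 1.
  banner : Fin 5 → Fin 5 → Bool
  banner zero          zero          = false
  banner zero          (suc zero)    = true
  banner zero          (suc (suc _)) = false
  banner (suc zero)    zero          = true
  banner (suc (suc _)) zero          = false
  banner (suc i)       (suc j)       = C₄-adj i j

  IsolatedThrough : Sub → ℕ → V → Set
  IsolatedThrough P k x = ∃[ D ] (x ∈ˡ D × length D ≡ k × Iso P D)

  -- Once x is dominated from outside P, one vertex fewer suffices for P.
  Saves : Sub → ℕ → V → Set
  Saves P k x = ∃[ D ] (suc (length D) ≤ k × Iso (P ∖ sg x) D)

  -- Inside a bridgeless graph, F-cut forces an edge from F to the outside of P; its end in F then saves a vertex.
  record Core (P : Sub) : Set where
    field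
      k       : ℕ
      size    : 12 * k ≡ e P P + 2
      through : ∀ x → x ∈ P → IsolatedThrough P k x
      F       : Sub
      F⊆      : F ⊆ P
      F≢∅     : NonEmpty F
      F-cut   : e F (P ∖ F) ≤ 1
      F-saves : ∀ x → x ∈ F → Saves P k x
  open Core

  -- The pure special structure on P, its k constituents being the banners g i, joined by a tree on the vertices g i 0.
  record Pure (P : Sub) (k : ℕ) : Set₁ where
    field
      I       : Set
      index   : I ↔ Fin k
      g       : I → Fin 5 → V
      g-inj   : ∀ {i j i′ j′} → g i j ≡ g i′ j′ → i ≡ i′ × j ≡ j′
      g∈      : ∀ i j → g i j ∈ P
      cover   : ∀ x → x ∈ P → ∃[ i ] ∃[ j ] g i j ≡ x
      inner   : ∀ i j j′ → adj G (g i j) (g i j′) ≡ banner j j′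
      cross   : ∀ i j i′ j′ → g i j ~ g i′ j′ → i ≡ i′ ⊎ (j ≡ zero × j′ ≡ zero)
      acyclic : ∀ j → 2 ≤ j → (C : Cycle (adj G) j) → (∀ t → ∃[ i ] g i zero ≡ c C t) → ⊥
  open Pure

  data Ext (P : Sub) : Set₁ where
    pure     : (K : Core P) (S : Pure P (k K)) → (∀ x → x ∈ P → Saves P (k K) x ⊎ (∃[ i ] g S i zero ≡ x)) → Ext P
    sporadic : (K : Core P) → (∃[ g ] Copy Diamond-adj P g) ⊎ (∃[ g ] Copy C₅-adj P g) →
               (∀ x → x ∈ P → Saves P (k K) x) → Ext P

  core : ∀ {P} → Ext P → Core P
  core (pure K _ _)     = K
  core (sporadic K _ _) = K

  NonC₄Outcome : Sub → Set₁
  NonC₄Outcome P = Good P ⊎ Ext P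

  Outcome : Sub → Set₁
  Outcome P = NonC₄Outcome P ⊎ IsC₄ P

  -- The common weakening of extremal graphs and 4-cycles that `tight-2-cut` and `theta` need. The
  -- term 4 is what two edges leaving `P` pay, and it is attained by the 4-cycle: 12 = 8 + 4.
  record Tight (P : Sub) : Set where
    field
      F       : Sub
      F⊆      : F ⊆ P
      F≢∅     : NonEmpty F
      F-cut   : e F (P ∖ F) ≤ 1
      F-saves : ∀ x → x ∈ F → ∃[ D ] (12 * suc (length D) ≤ e P P + 4 × Iso (P ∖ sg x) D)

  ext⇒tight : ∀ {P} → Ext P → Tight P
  ext⇒tight {P} E = record { F = F K ; F⊆ = F⊆ K ; F≢∅ = F≢∅ K ; F-cut = F-cut K ; F-saves = saves }
    where
    K = core E
    saves : ∀ x → x ∈ F K → ∃[ D ] (12 * suc (length D) ≤ e P P + 4 × Iso (P ∖ sg x) D)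
    saves x x∈F with F-saves K x x∈F
    ... | D , short , I = D , ≤-trans (*-monoʳ-≤ 12 short) (≤-trans (≤-reflexive (size K)) (+-monoʳ-≤ (e P P) (s≤s (s≤s z≤n)))) , I

  -- The excess 2 is one edge, hence covered by any single edge leaving `P`.
  weak : ∀ {P} → NonC₄Outcome P → ∃[ D ] (Iso P D × 12 * length D ≤ e P P + 2)
  weak (inj₁ (D , I , short)) = D , I , ≤-trans short (m≤m+n _ 2)
  weak (inj₂ E) with F≢∅ (core E)
  ... | x , x∈F with through (core E) x (F⊆ (core E) x x∈F)
  ...   | D , _ , len , I = D , I , ≤-reflexive (trans (cong (12 *_) len) (size (core E)))

  iso-3 : ∀ {P D} (a b c : V) → (∀ x → x ∈ P → Dom D x ⊎ (a ≡ x ⊎ b ≡ x ⊎ c ≡ x)) → Iso P D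
  iso-3 a b c cov = iso-small l (λ x x∈ → map₂ [ (0F ,_) , [ (1F ,_) , (2F ,_) ]′ ]′ (cov x x∈))
    where
    l : Fin 3 → V
    l 0F = a
    l 1F = b
    l 2F = c

  copy-cover : ∀ {k a P g} → Copy {k} a P g → ∀ x → x ∈ P → ∃[ i ] g i ≡ x
  copy-cover ((_ , _ , cov) , _) = cov

  -- All but three vertices are dominated by `g j`, too few for a long cycle. The combinatorial
  -- premise is checked by evaluation on the small graph.
  copy-iso : ∀ {k a P g} → Copy {k} a P g → ∀ j → (∃[ p ] ∃[ q ] ∃[ r ] ∀ i → (j ≡ i ⊎ a j i ≡ true) ⊎ (p ≡ i ⊎ q ≡ i ⊎ r ≡ i)) →
             Iso P (g j ∷ [])
  copy-iso {a = a} {P} {g} (en@(_ , _ , cov) , ad) j (p , q , r , h) = iso-3 (g p) (g q) (g r) covers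
    where
    covers : ∀ x → x ∈ P → Dom (g j ∷ []) x ⊎ (g p ≡ x ⊎ g q ≡ x ⊎ g r ≡ x)
    covers x x∈P with cov x x∈P
    ... | i , refl with h i
    ...   | inj₁ (inj₁ refl)        = inj₁ (here (inj₁ refl))
    ...   | inj₁ (inj₂ j~i)         = inj₁ (here (inj₂ (trans (ad j i) j~i)))
    ...   | inj₂ (inj₁ refl)        = inj₂ (inj₁ refl)
    ...   | inj₂ (inj₂ (inj₁ refl)) = inj₂ (inj₂ (inj₁ refl))
    ...   | inj₂ (inj₂ (inj₂ refl)) = inj₂ (inj₂ (inj₂ refl))

  -- After the removal of `g j` the vertex `g t` is a leaf; discarding it leaves three vertices.
  copy-iso-∖ : ∀ {k a P g} → Copy {k} a P g → ∀ j t → (∃[ p ] ∃[ q ] ∃[ r ] ∀ i → (j ≡ i ⊎ t ≡ i) ⊎ (p ≡ i ⊎ q ≡ i ⊎ r ≡ i)) →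
               nb (P ∖ sg (g j)) (g t) ≤ 1 → Iso (P ∖ sg (g j)) []
  copy-iso-∖ {P = P} {g} (en@(_ , _ , cov) , ad) j t (p , q , r , h) leaf = iso-leaves (iso-3 (g p) (g q) (g r) covers) split
    where
    L = P ∖ sg (g j)
    covers : ∀ x → x ∈ L ∖ sg (g t) → Dom [] x ⊎ (g p ≡ x ⊎ g q ≡ x ⊎ g r ≡ x)
    covers x x∈ with cov x (∖⊆ P (sg (g j)) x (∖⊆ L (sg (g t)) x x∈))
    ... | i , refl with h i
    ...   | inj₁ (inj₁ refl)        = ⊥-elim (∖sg-≢ P (g j) (∖⊆ L (sg (g t)) x x∈) refl)
    ...   | inj₁ (inj₂ refl)        = ⊥-elim (∖sg-≢ L (g t) x∈ refl)
    ...   | inj₂ (inj₁ refl)        = inj₂ (inj₁ refl)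
    ...   | inj₂ (inj₂ (inj₁ refl)) = inj₂ (inj₂ (inj₁ refl))
    ...   | inj₂ (inj₂ (inj₂ refl)) = inj₂ (inj₂ (inj₂ refl))
    split : ∀ x → x ∈ L → x ∈ L ∖ sg (g t) ⊎ nb L x ≤ 1
    split x x∈L with ∈-or-∖ L (sg (g t)) x∈L
    ... | inj₁ x∈t = inj₂ (subst (λ z → nb L z ≤ 1) (∈sg⇒ x∈t) leaf)
    ... | inj₂ x∈  = inj₁ x∈

  4-copy-iso-∖ : ∀ {a P g} → Copy {4} a P g → ∀ j → Iso (P ∖ sg (g j)) []
  4-copy-iso-∖ {P = P} {g} (en@(_ , _ , cov) , ad) j = iso-small (g ∘ punchIn j) covers
    where
    covers : ∀ x → x ∈ P ∖ sg (g j) → Dom [] x ⊎ (∃[ t ] g (punchIn j t) ≡ x)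
    covers x x∈ with cov x (∖⊆ P (sg (g j)) x x∈)
    ... | i , refl = inj₂ (punchOut j≢i , cong g (punchIn-punchOut j≢i))
      where
      j≢i : j ≢ i
      j≢i refl = ∖sg-≢ P (g j) x∈ refl

  triple? : ∀ {k} (Q : Fin k → Fin k → Fin k → Set) → (∀ p q r → Dec (Q p q r)) → Dec (∃[ p ] ∃[ q ] ∃[ r ] Q p q r)
  triple? Q Q? = any? (λ p → any? (λ q → any? (Q? p q)))

  nearby? : ∀ {k} (a : Fin k → Fin k → Bool) →
            Dec (∀ j → ∃[ p ] ∃[ q ] ∃[ r ] ∀ i → (j ≡ i ⊎ a j i ≡ true) ⊎ (p ≡ i ⊎ q ≡ i ⊎ r ≡ i))
  nearby? a = all? (λ j → triple? _ (λ p q r → all? (λ i →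
    (j ≟ i ⊎-dec a j i Bool.≟ true) ⊎-dec (p ≟ i ⊎-dec q ≟ i ⊎-dec r ≟ i))))

  others : ∀ (j t : Fin 5) → j ≡ t ⊎ (∃[ p ] ∃[ q ] ∃[ r ] ∀ i → (j ≡ i ⊎ t ≡ i) ⊎ (p ≡ i ⊎ q ≡ i ⊎ r ≡ i))
  others = from-yes (all? {5} (λ j → all? (λ t → (j ≟ t) ⊎-dec triple? {5} _ (λ p q r → all? {5} (λ i →
    (j ≟ i ⊎-dec t ≟ i) ⊎-dec (p ≟ i ⊎-dec q ≟ i ⊎-dec r ≟ i))))))

  ∖-self : ∀ P → ¬ NonEmpty (P ∖ P)
  ∖-self P (y , y∈) = ∖-∉ P P y∈ (∖⊆ P P y y∈)

  e-∖-self : ∀ P → e P (P ∖ P) ≤ 1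
  e-∖-self P = ≤-trans (≤-reflexive (trans (e-comm P (P ∖ P)) (e-empty P (∖-self P)))) z≤n

  copy-∈ : ∀ {k a P g} → Copy {k} a P g → ∀ i → g i ∈ P
  copy-∈ ((_ , g∈ , _) , _) = g∈

  c₄⇒tight : ∀ {P} → IsC₄ P → Tight P
  c₄⇒tight {P} (g , C) = record
    { F = P ; F⊆ = λ _ → id ; F≢∅ = g 0F , copy-∈ C 0F ; F-cut = e-∖-self P ; F-saves = saves }
    where
    saves : ∀ x → x ∈ P → ∃[ D ] (12 * suc (length D) ≤ e P P + 4 × Iso (P ∖ sg x) D)
    saves x x∈P with copy-cover C x x∈P
    ... | i , refl = [] , ≤-reflexive (sym (cong (_+ 4) (copy-ee C))) , 4-copy-iso-∖ C i

  diamond-ext : ∀ {P g} → Copy Diamond-adj P g → Ext P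
  diamond-ext {P} {g} C = sporadic K (inj₁ (g , C)) saves
    where
    saves : ∀ x → x ∈ P → Saves P 1 x
    saves x x∈P with copy-cover C x x∈P
    ... | i , refl = [] , ≤-refl , 4-copy-iso-∖ C i
    through′ : ∀ x → x ∈ P → IsolatedThrough P 1 x
    through′ x x∈P with copy-cover C x x∈P
    ... | i , refl = g i ∷ [] , here refl , refl , copy-iso C i (from-yes (nearby? Diamond-adj) i)
    K : Core P
    K = record { k = 1 ; size = sym (cong (_+ 2) (copy-ee C)) ; through = through′ ; F = P ; F⊆ = λ _ → id
               ; F≢∅ = g 0F , copy-∈ C 0F ; F-cut = e-∖-self P ; F-saves = saves }

  C₅-degree : ∀ j → ∃[ t ] (C₅-adj j t ≡ true × j ≢ t × sum (λ i → 𝟙 (C₅-adj t i)) ≡ 2)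
  C₅-degree = from-yes (all? (λ j → any? (λ t → C₅-adj j t Bool.≟ true ×-dec ¬? (j ≟ t)
                                                ×-dec sum (λ i → 𝟙 (C₅-adj t i)) ℕ.≟ 2)))

  c₅-ext : ∀ {P g} → Copy C₅-adj P g → Ext P
  c₅-ext {P} {g} C@(_ , ad) = sporadic K (inj₂ (g , C)) saves
    where
    saves : ∀ x → x ∈ P → Saves P 1 x
    saves x x∈P with copy-cover C x x∈P
    ... | j , refl with C₅-degree j
    -- The 5-cycle minus a vertex is a path, and the neighbour `t` of the removed vertex is one of
    -- its ends.
    ...   | t , j~t , j≢t , deg = [] , ≤-refl ,
            copy-iso-∖ C j t ([ (λ j≡t → ⊥-elim (j≢t j≡t)) , id ]′ (others j t)) leaf
      where
      leaf : nb (P ∖ sg (g j)) (g t) ≤ 1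
      leaf = +-cancelˡ-≤ 1 _ _ (≤-reflexive (begin
        1 + nb (P ∖ sg (g j)) (g t)
          ≡⟨ cong (_+ nb (P ∖ sg (g j)) (g t)) (trans (nb-sg (g t) (g j)) (cong 𝟙 (~-sym (trans (ad j t) j~t)))) ⟨
        nb (sg (g j)) (g t) + nb (P ∖ sg (g j)) (g t)
          ≡⟨ nb-split (split-∖ (sg⊆ x∈P)) (g t) ⟨
        nb P (g t)
          ≡⟨ copy-nb C t ⟩
        sum (λ i → 𝟙 (C₅-adj t i))
          ≡⟨ deg ⟩
        2 ∎))
        where open ≡-Reasoning
    through′ : ∀ x → x ∈ P → IsolatedThrough P 1 x
    through′ x x∈P with copy-cover C x x∈P
    ... | i , refl = g i ∷ [] , here refl , refl , copy-iso C i (from-yes (nearby? C₅-adj) i)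
    K : Core P
    K = record { k = 1 ; size = sym (cong (_+ 2) (copy-ee C)) ; through = through′ ; F = P ; F⊆ = λ _ → id
               ; F≢∅ = g 0F , copy-∈ C 0F ; F-cut = e-∖-self P ; F-saves = saves }

  -- Removing a vertex of the 4-cycle leaves the vertex `h zero` with degree at most 1 and three
  -- others. No saving is claimed at `h zero`, whose removal leaves the whole 4-cycle. `F` is that
  -- 4-cycle, cut off by the pendant edge.
  banner-ext : ∀ {P h} → Copy banner P h → Ext P
  banner-ext {P} {h} C@((h-inj , h∈ , cov) , ad) = pure K S spine
    where
    saves : ∀ i → Saves P 1 (h (suc i))
    saves i = [] , ≤-refl , copy-iso-∖ C (suc i) zero ([ (λ ()) , id ]′ (others (suc i) zero))
                (≤-trans (nb-mono (∖⊆ P (sg (h (suc i)))) (h zero)) (≤-reflexive (copy-nb C zero)))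
    spine : ∀ x → x ∈ P → Saves P 1 x ⊎ (Σ (Fin 1) λ _ → h zero ≡ x)
    spine x x∈P with cov x x∈P
    ... | zero  , eq   = inj₂ (0F , eq)
    ... | suc i , refl = inj₁ (saves i)
    through′ : ∀ x → x ∈ P → IsolatedThrough P 1 x
    through′ x x∈P with cov x x∈P
    ... | i , refl = h i ∷ [] , here refl , refl , copy-iso C i (from-yes (nearby? banner) i)
    F′ : Sub
    F′ = P ∖ sg (h zero)
    F-saves′ : ∀ x → x ∈ F′ → Saves P 1 x
    F-saves′ x x∈F with cov x (∖⊆ P (sg (h zero)) x x∈F)
    ... | zero  , refl = ⊥-elim (∖sg-≢ P (h zero) x∈F refl)
    ... | suc i , refl = saves i
    outside : P ∖ F′ ⊆ sg (h zero)
    outside x x∈ with ∈-or-∖ P (sg (h zero)) (∖⊆ P F′ x x∈)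
    ... | inj₁ t = t
    ... | inj₂ t = ⊥-elim (∖-∉ P F′ x∈ t)
    F-cut′ : e F′ (P ∖ F′) ≤ 1
    F-cut′ = begin
      e F′ (P ∖ F′)       ≤⟨ e-mono (∖⊆ P (sg (h zero))) outside ⟩
      e P (sg (h zero))   ≡⟨ e-comm P (sg (h zero)) ⟩
      e (sg (h zero)) P   ≡⟨ e-sg (h zero) P ⟩
      nb P (h zero)       ≡⟨ copy-nb C zero ⟩
      1 ∎
      where open ≤-Reasoning
    K : Core P
    K = record { k = 1 ; size = sym (cong (_+ 2) (copy-ee C)) ; through = through′ ; F = F′ ; F⊆ = ∖⊆ P (sg (h zero))
               ; F≢∅ = h 1F , ∈∖sg P (h∈ 1F) (λ eq → case h-inj eq of λ ())
               ; F-cut = F-cut′ ; F-saves = F-saves′ }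
    S : Pure P 1
    S = record { I = Fin 1 ; index = ↔-id _ ; g = λ _ → h
               ; g-inj = λ { {zero} {_} {zero} eq → refl , h-inj eq }
               ; g∈ = λ _ → h∈ ; cover = λ x x∈ → 0F , cov x x∈ ; inner = λ _ → ad
               ; cross = λ { zero _ zero _ _ → inj₁ refl }
               ; acyclic = λ { (suc j) _ C spine → case inj C {0F} {1F} (trans (sym (proj₂ (spine 0F))) (proj₂ (spine 1F))) of λ () } }

  -- Partial solutions

  -- A partial solution on H next to a removed set S, with v already chosen.  The surplus g is what remains of (twice)
  -- the edges meeting H after paying (twice) 6 for each vertex of D.
  record Res (v : V) (S : Sub) (g : ℕ) (H : Sub) : Set where
    constructor mkRes
    field
      D       : List V
      isolate : Iso H (v ∷ D)
      surplus : 12 * length D + g ≤ e H H + 2 * e H S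

  res-weaken : ∀ {v S g g′ H} → g′ ≤ g → Res v S g H → Res v S g′ H
  res-weaken g′≤g (mkRes D I b) = mkRes D I (≤-trans (+-monoʳ-≤ (12 * length D) g′≤g) b)

  res-join : ∀ {v S g g′ Q H R} → Split Q H R → e H R ≡ 0 → Res v S g H → Res v S g′ R → Res v S (g + g′) Q
  res-join {v} {S} {g} {g′} {Q} {H} {R} s sep (mkRes D I b) (mkRes D′ I′ b′) = mkRes (D ++ D′)
    (iso-join I I′ (≤-trans (≤-reflexive sep) z≤n)
        (λ { x (here p) → here p ; x (there d) → there (++⁺ˡ d) })
        (λ { x (here p) → here p ; x (there d) → there (++⁺ʳ D d) })
        (λ x → inj₂ ∘ split-⊎ s x))
    (≤-via (trans (cong (λ l → 12 * l + (g + g′)) (length-++ D)) (left (length D) (length D′) g g′))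
            (+-mono-≤ b b′)
            (trans (right (e H H) (e R R) (e H S) (e R S))
                   (sym (cong₂ (λ p q → p + 2 * q) (trans (ee-split s) (cong (λ z → e H H + 2 * z + e R R) sep)) (e-splitˡ S s)))))
    where
    left : ∀ d d′ g g′ → 12 * (d + d′) + (g + g′) ≡ 12 * d + g + (12 * d′ + g′)
    left = solve-∀
    right : ∀ h r s t → h + 2 * s + (r + 2 * t) ≡ h + 2 * 0 + r + 2 * (s + t)
    right = solve-∀

  res-empty : ∀ {v S Q} → ¬ NonEmpty Q → Res v S 0 Q
  res-empty Q∅ = mkRes [] (iso-empty Q∅) z≤n

  comp-∖ : ∀ {Q H K} → Comp Q H → Comp (Q ∖ H) K → Comp Q K
  comp-∖ {Q} {H} {K} C C′ = record { sub = λ x x∈ → ∖⊆ Q H x (sub C′ x x∈) ; conn = conn C′ ; sep = n≤0⇒n≡0 bound }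
    where
    cover′ : ∀ y → y ∈ Q ∖ K → y ∈ H ⊎ y ∈ (Q ∖ H) ∖ K
    cover′ y y∈ = map₂ (λ y∈R → ∈∖ (Q ∖ H) K y∈R (∖-∉ Q K y∈)) (∈-or-∖ Q H (∖⊆ Q K y y∈))
    bound : e K (Q ∖ K) ≤ 0
    bound = ≤-trans (e-coverʳ K cover′) (+-mono-≤
      (≤-trans (e-mono (sub C′) (λ _ → id)) (≤-reflexive (trans (e-comm (Q ∖ H) H) (sep C)))) (≤-reflexive (sep C′)))

  res-comp : ∀ {v S g g′ Q H} → Comp Q H → Res v S g H → Res v S g′ (Q ∖ H) → Res v S (g + g′) Q
  res-comp C = res-join (split-∖ (sub C)) (sep C)

  -- Components are solved one at a time. `X` is an early exit: in the bridgeless case a single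
  -- component may already yield a solution of the whole graph.
  res-comps≤ : ∀ {X : Set} {v S} k Q → cnt Q ≤ k → (∀ H → Comp Q H → X ⊎ Res v S 0 H) → X ⊎ Res v S 0 Q
  res-comps≤ k Q Q≤k each with nonEmpty? Q
  ... | inj₂ Q∅ = inj₂ (res-empty Q∅)
  res-comps≤ zero    Q Q≤0 each | inj₁ Q≢∅ = ⊥-elim (1+n≰n (≤-trans (NonEmpty⇒1≤cnt Q≢∅) Q≤0))
  res-comps≤ (suc k) Q Q≤k each | inj₁ (x , x∈Q) with component Q x∈Q
  ... | H , x∈H , C with each H C
  ...   | inj₁ done = inj₁ done
  ...   | inj₂ r    = map₂ (res-comp C r) (res-comps≤ k (Q ∖ H)
                        (≤-pred (≤-trans (cnt-< (∖⊆ Q H) x∈Q (λ h → ∖-∉ Q H h x∈H)) Q≤k))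
                        (λ K C′ → each K (comp-∖ C C′)))

  res-comps : ∀ {X : Set} {v S} Q → (∀ H → Comp Q H → X ⊎ Res v S 0 H) → X ⊎ Res v S 0 Q
  res-comps Q = res-comps≤ (cnt Q) Q ≤-refl

  res-comps-with : ∀ {X : Set} {v S g Q H} → Comp Q H → Res v S g H →
                   (∀ K → Comp Q K → X ⊎ Res v S 0 K) → X ⊎ Res v S g Q
  res-comps-with {Q = Q} {H} C r each =
    map₂ (λ r′ → res-weaken (m≤m+n _ 0) (res-comp C r r′)) (res-comps (Q ∖ H) (λ K C′ → each K (comp-∖ C C′)))

  res-finish : ∀ {v S Q W g} → Split W S Q → (∀ x → x ∈ S → v ≡ x ⊎ v ~ x) → Res v S g Q → 12 ≤ e S S + g → Good W
  res-finish {v} {S} {Q} {W} {g} s near (mkRes D I b) enough = v ∷ D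
    , iso-mono I ≼-refl (λ x x∈ → map₁ (here ∘ near x) (split-⊎ s x x∈))
    , subst (12 * suc (length D) ≤_) (sym (trans (ee-split s) (cong (λ z → e S S + 2 * z + e Q Q) (e-comm S Q))))
        (≤-by 0 (+-mono-≤ b enough) (identity (length D) (e S S) (e Q S) (e Q Q) g))
    where
    identity : ∀ d s c q g → s + 2 * c + q + (12 * d + g + 12) ≡ 12 * suc d + (q + 2 * c + (s + g)) + 0
    identity = solve-∀

  -- Once `a` dominates a vertex of the 4-cycle, only three vertices remain and nothing more is
  -- chosen. The surplus 10 is the doubled count of its four edges and one edge to `a`.
  linked-res-C₄ : ∀ {a K} → IsC₄ K → 1 ≤ e K (sg a) → Res a (sg a) 10 K
  linked-res-C₄ {a} {K} (g , C) linked with e⇒edge linked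
  ... | x , y , x∈K , y∈a , x~y with copy-cover C x x∈K | ∈sg⇒ {a} {y} y∈a
  ...   | i , refl | refl = mkRes [] (iso-mono (4-copy-iso-∖ C i) []≼ covered)
    (≤-trans (+-monoʳ-≤ 8 (*-monoʳ-≤ 2 linked)) (≤-reflexive (cong (_+ 2 * e K (sg a)) (sym (copy-ee C)))))
    where
    covered : ∀ z → z ∈ K → Dom (a ∷ []) z ⊎ z ∈ K ∖ sg (g i)
    covered z z∈K = map₁ (λ z∈ → here (inj₂ (subst (a ~_) (∈sg⇒ z∈) (~-sym x~y)))) (∈-or-∖ K (sg (g i)) z∈K)

  linked-res : ∀ {a K g} → NonC₄Outcome K → g + 2 ≤ 2 * e K (sg a) → Res a (sg a) g K
  linked-res {a} {K} {g} o linked with weak o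
  ... | D , I , short = mkRes D (iso-⊆ I ≼-∷ (λ _ → id)) (≤-by 0 (+-mono-≤ short linked) (identity (length D) g (e K K) (e K (sg a))))
    where
    identity : ∀ d g q c → q + 2 * c + (12 * d + (g + 2)) ≡ 12 * d + g + (q + 2 + 2 * c) + 0
    identity = solve-∀

  linked-res₀ : ∀ {a K} → Outcome K → 1 ≤ e K (sg a) → Res a (sg a) 0 K
  linked-res₀ (inj₁ o) linked = linked-res o (*-monoʳ-≤ 2 linked)
  linked-res₀ (inj₂ C) linked = res-weaken z≤n (linked-res-C₄ C linked)

  -- If `A` fell apart into two pieces without edges between them, the single edge to `B` would miss
  -- one piece, which would then be separated from the rest of `P`.
  cut-side-connected : ∀ {P A B} → CutConnected P → Split P A B → e A B ≤ 1 → NonEmpty A → CutConnected A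
  cut-side-connected {P} {A} {B} (_ , cuts) s small A≢∅ = A≢∅ , λ A₁ A₂ s′ ne₁ ne₂ → ≰⇒> (λ none →
    case either (subst (_≤ 1) (e-splitˡ B s′) small) of λ
      { (inj₁ z) → separated s′ ne₁ ne₂ none z
      ; (inj₂ z) → separated (split-sym s′) ne₂ ne₁ (≤-trans (≤-reflexive (e-comm A₂ A₁)) none) z })
    where
    either : ∀ {p q} → p + q ≤ 1 → p ≤ 0 ⊎ q ≤ 0
    either {zero}  _ = inj₁ z≤n
    either {suc p} {q} h = inj₂ (≤-trans (m≤n+m q p) (≤-pred h))
    separated : ∀ {A₁ A₂} → Split A A₁ A₂ → NonEmpty A₁ → NonEmpty A₂ → e A₁ A₂ ≤ 0 → e A₁ B ≤ 0 → ⊥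
    separated {A₁} {A₂} s′ ne₁ (y , y∈) z z′ = n≮0 (≤-trans (cuts A₁ (P ∖ A₁) (split-∖ A₁⊆P) ne₁
        (y , ∈∖ P A₁ (split-ˡ s y (split-ʳ s′ y y∈)) (λ h → split-disj s′ h y∈)))
      (≤-trans (e-coverʳ A₁ cover′) (+-mono-≤ z z′)))
      where
      A₁⊆P : A₁ ⊆ P
      A₁⊆P x x∈ = split-ˡ s x (split-ˡ s′ x x∈)
      cover′ : ∀ x → x ∈ P ∖ A₁ → x ∈ A₂ ⊎ x ∈ B
      cover′ x x∈ with split-⊎ s x (∖⊆ P A₁ x x∈)
      ... | inj₂ x∈B = inj₂ x∈B
      ... | inj₁ x∈A with split-⊎ s′ x x∈A
      ...   | inj₁ x∈A₁ = ⊥-elim (∖-∉ P A₁ x∈ x∈A₁)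
      ...   | inj₂ x∈A₂ = inj₁ x∈A₂

  -- Joining two outcomes along a bridge

  -- The bridge adds 2 to the doubled count, exactly the excess allowed by `weak` on the other side.
  bridge-good : ∀ {P P₁ P₂} → Split P P₁ P₂ → e P₁ P₂ ≡ 1 → Good P₁ → NonC₄Outcome P₂ → Good P
  bridge-good {P} {P₁} {P₂} s one (D , I , b) o with weak o
  ... | D′ , I′ , b′ = D ++ D′
    , iso-join I I′ (≤-reflexive one) ≼-++ˡ (≼-++ʳ D) (λ x → inj₂ ∘ split-⊎ s x)
    , ≤-via (trans (cong (12 *_) (length-++ D)) (*-distribˡ-+ 12 (length D) (length D′))) (+-mono-≤ b b′)
            (trans (right (e P₁ P₁) (e P₂ P₂)) (sym (trans (ee-split s) (cong (λ z → e P₁ P₁ + 2 * z + e P₂ P₂) one))))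
    where
    right : ∀ p q → p + (q + 2) ≡ p + 2 * 1 + q
    right = solve-∀

  -- A solution of `P₂` through `b` dominates `a`, so the smaller solution of `P₁` without `a`
  -- suffices.
  bridge-saves : ∀ {P P₁ P₂ a b} → Split P P₁ P₂ → e P₁ P₂ ≡ 1 → (K₁ : Core P₁) (K₂ : Core P₂) →
                 b ∈ P₂ → a ~ b → Saves P₁ (k K₁) a → Good P
  bridge-saves {P} {P₁} {P₂} {a} {b} s one K₁ K₂ b∈P₂ a~b (D , short , I) with through K₂ b b∈P₂
  ... | D′ , b∈D′ , len , I′ = D ++ D′
    , iso-join I I′ (≤-trans (e-mono (∖⊆ P₁ (sg a)) (λ _ → id)) (≤-reflexive one)) ≼-++ˡ (≼-++ʳ D) covered
    , ≤-via (trans (cong (12 *_) (length-++ D)) (*-distribˡ-+ 12 (length D) (length D′)))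
            -- Two extremal sides and the bridge leave an excess of 2; the saved vertex is worth 12,
            -- whence the slack 10.
            (≤-by 10 (+-mono-≤ (≤-trans (*-monoʳ-≤ 12 short) (≤-reflexive (size K₁)))
                              (≤-reflexive (trans (cong (12 *_) len) (size K₂))))
                    (identity (length D) (length D′) (e P₁ P₁) (e P₂ P₂)))
            (sym (trans (ee-split s) (cong (λ z → e P₁ P₁ + 2 * z + e P₂ P₂) one)))
    where
    identity : ∀ d d′ p q → p + 2 * 1 + q + (12 * suc d + 12 * d′) ≡ 12 * d + 12 * d′ + (p + 2 + (q + 2)) + 10
    identity = solve-∀
    covered : ∀ x → x ∈ P → Dom (D ++ D′) x ⊎ (x ∈ P₁ ∖ sg a ⊎ x ∈ P₂)
    covered x x∈P with split-⊎ s x x∈P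
    ... | inj₂ x∈P₂ = inj₂ (inj₂ x∈P₂)
    ... | inj₁ x∈P₁ with ∈-or-∖ P₁ (sg a) x∈P₁
    ...   | inj₁ x∈a = inj₁ (++⁺ʳ D (∈ˡ⇒Dom b∈D′ (inj₂ (subst (b ~_) (∈sg⇒ x∈a) (~-sym a~b)))))
    ...   | inj₂ x∈  = inj₂ (inj₁ x∈)

  -- `F` is inherited from `P₁`. Its cut does not grow: the only edge to `P₂` starts at `a`, outside
  -- `F`. Each smaller solution of one side is completed by a full-size solution of the other.
  bridge-core : ∀ {P P₁ P₂ a b} → Split P P₁ P₂ → e P₁ P₂ ≡ 1 → (K₁ : Core P₁) (K₂ : Core P₂) →
                a ∈ P₁ → b ∈ P₂ → a ~ b → ¬ (a ∈ F K₁) → Σ (Core P) λ K → k K ≡ k K₁ + k K₂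
                × (∀ x → Saves P₁ (k K₁) x → Saves P (k K) x) × (∀ x → Saves P₂ (k K₂) x → Saves P (k K) x)
  bridge-core {P} {P₁} {P₂} {a} {b} s one K₁ K₂ a∈ b∈ a~b a∉F = K , refl , saves₁ , saves₂
    where
    ≤one : e P₁ P₂ ≤ 1
    ≤one = ≤-reflexive one
    any₁ = through K₁ a a∈
    any₂ = through K₂ b b∈
    saves₁ : ∀ x → Saves P₁ (k K₁) x → Saves P (k K₁ + k K₂) x
    saves₁ x (D , short , I) with any₂
    ... | D′ , _ , len , I′ = D ++ D′ , ≤-trans (≤-reflexive (cong suc (length-++ D))) (+-mono-≤ short (≤-reflexive len))
      , iso-join I I′ (≤-trans (e-mono (∖⊆ P₁ (sg x)) (λ _ → id)) ≤one) ≼-++ˡ (≼-++ʳ D)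
          (λ y y∈ → inj₂ (map₁ (λ y∈₁ → ∈∖ P₁ (sg x) y∈₁ (∖-∉ P (sg x) y∈)) (split-⊎ s y (∖⊆ P (sg x) y y∈))))
    saves₂ : ∀ x → Saves P₂ (k K₂) x → Saves P (k K₁ + k K₂) x
    saves₂ x (D , short , I) with any₁
    ... | D′ , _ , len , I′ = D′ ++ D
      , ≤-trans (≤-reflexive (trans (cong suc (length-++ D′)) (sym (+-suc (length D′) (length D))))) (+-mono-≤ (≤-reflexive len) short)
      , iso-join I′ I (≤-trans (e-mono (λ _ → id) (∖⊆ P₂ (sg x))) ≤one) ≼-++ˡ (≼-++ʳ D′)
          (λ y y∈ → inj₂ (map₂ (λ y∈₂ → ∈∖ P₂ (sg x) y∈₂ (∖-∉ P (sg x) y∈)) (split-⊎ s y (∖⊆ P (sg x) y y∈))))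
    through′ : ∀ x → x ∈ P → IsolatedThrough P (k K₁ + k K₂) x
    through′ x x∈ with split-⊎ s x x∈ | any₁ | any₂
    ... | inj₁ x∈₁ | _ | D′ , _ , len′ , I′ with through K₁ x x∈₁
    ...   | D , x∈D , len , I = D ++ D′ , ++⁺ˡ x∈D , trans (length-++ D) (cong₂ _+_ len len′)
            , iso-join I I′ ≤one ≼-++ˡ (≼-++ʳ D) (λ y → inj₂ ∘ split-⊎ s y)
    through′ x x∈ | inj₂ x∈₂ | D′ , _ , len′ , I′ | _ with through K₂ x x∈₂
    ...   | D , x∈D , len , I = D′ ++ D , ++⁺ʳ D′ x∈D , trans (length-++ D′) (cong₂ _+_ len′ len)
            , iso-join I′ I ≤one ≼-++ˡ (≼-++ʳ D′) (λ y → inj₂ ∘ split-⊎ s y)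
    F-P₂ : e (F K₁) P₂ ≤ 0
    F-P₂ = ≤-by 0 (+-mono-≤ (e-edge (∈∖ P₁ (F K₁) a∈ a∉F) b∈ a~b)
                           (≤-trans (≤-reflexive (sym (e-splitˡ P₂ (split-∖ (F⊆ K₁))))) ≤one))
                 (identity (e (F K₁) P₂) (e (P₁ ∖ F K₁) P₂))
      where
      identity : ∀ p q → 0 + (1 + (p + q)) ≡ p + (q + 1) + 0
      identity = solve-∀
    F-cut′ : e (F K₁) (P ∖ F K₁) ≤ 1
    F-cut′ = ≤-trans (e-coverʳ (F K₁) {B₁ = P₁ ∖ F K₁} {B₂ = P₂}
               (λ y y∈ → map₁ (λ y∈₁ → ∈∖ P₁ (F K₁) y∈₁ (∖-∉ P (F K₁) y∈)) (split-⊎ s y (∖⊆ P (F K₁) y y∈))))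
               (+-mono-≤ (F-cut K₁) F-P₂)
    K : Core P
    K = record
      { k = k K₁ + k K₂
      ; size = trans (*-distribˡ-+ 12 (k K₁) (k K₂)) (trans (cong₂ _+_ (size K₁) (size K₂))
          (trans (right (e P₁ P₁) (e P₂ P₂)) (cong (_+ 2) (sym (trans (ee-split s) (cong (λ z → e P₁ P₁ + 2 * z + e P₂ P₂) one))))))
      ; through = through′ ; F = F K₁ ; F⊆ = λ x x∈ → split-ˡ s x (F⊆ K₁ x x∈) ; F≢∅ = F≢∅ K₁
      ; F-cut = F-cut′ ; F-saves = λ x x∈ → saves₁ x (F-saves K₁ x x∈) }
      where
      right : ∀ p q → p + 2 + (q + 2) ≡ p + 2 * 1 + q + 2
      right = solve-∀

  bridge-pure : ∀ {P P₁ P₂ k₁ k₂} → Split P P₁ P₂ → e P₁ P₂ ≡ 1 → (S₁ : Pure P₁ k₁) (S₂ : Pure P₂ k₂) →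
                (i₁ : I S₁) (i₂ : I S₂) → g S₁ i₁ zero ~ g S₂ i₂ zero →
                Σ (Pure P (k₁ + k₂)) λ S → (∀ i → ∃[ i′ ] g S i′ zero ≡ g S₁ i zero) × (∀ i → ∃[ i′ ] g S i′ zero ≡ g S₂ i zero)
  bridge-pure {P} {P₁} {P₂} {k₁} {k₂} s one S₁ S₂ i₁ i₂ edge = S , (λ i → inj₁ i , refl) , (λ i → inj₂ i , refl)
    where
    J : Set
    -- Arbitrary index types let the constituents of both sides be combined by a disjoint sum,
    -- without renumbering.
    J = I S₁ ⊎ I S₂
    h : J → Fin 5 → V
    h = [ g S₁ , g S₂ ]′
    h∈ : ∀ i j → h i j ∈ P
    h∈ (inj₁ i) j = split-ˡ s _ (g∈ S₁ i j)
    h∈ (inj₂ i) j = split-ʳ s _ (g∈ S₂ i j)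
    apart : ∀ {i j i′ j′} → g S₁ i j ≢ g S₂ i′ j′
    apart {i} {j} {i′} {j′} eq = split-disj s (g∈ S₁ i j) (subst (_∈ P₂) (sym eq) (g∈ S₂ i′ j′))
    h-inj : ∀ {i j i′ j′} → h i j ≡ h i′ j′ → i ≡ i′ × j ≡ j′
    h-inj {inj₁ i} {_} {inj₁ i′} eq with g-inj S₁ eq
    ... | refl , p = refl , p
    h-inj {inj₂ i} {_} {inj₂ i′} eq with g-inj S₂ eq
    ... | refl , p = refl , p
    h-inj {inj₁ i} {_} {inj₂ i′} eq = ⊥-elim (apart eq)
    h-inj {inj₂ i} {_} {inj₁ i′} eq = ⊥-elim (apart (sym eq))
    h-cov : ∀ x → x ∈ P → ∃[ i ] ∃[ j ] h i j ≡ x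
    h-cov x x∈ with split-⊎ s x x∈
    ... | inj₁ x∈₁ = let i , j , eq = cover S₁ x x∈₁ in inj₁ i , j , eq
    ... | inj₂ x∈₂ = let i , j , eq = cover S₂ x x∈₂ in inj₂ i , j , eq
    h-inner : ∀ i j j′ → adj G (h i j) (h i j′) ≡ banner j j′
    h-inner (inj₁ i) = inner S₁ i
    h-inner (inj₂ i) = inner S₂ i
    -- The bridge is the one edge between the sides and joins two spine vertices, so every crossing
    -- edge does.
    only : ∀ {i j i′ j′} → g S₁ i j ~ g S₂ i′ j′ → j ≡ zero × j′ ≡ zero
    only {i} {j} {i′} {j′} h with g S₁ i j ≟ g S₁ i₁ zero | g S₂ i′ j′ ≟ g S₂ i₂ zero
    ... | yes p | yes q = proj₂ (g-inj S₁ p) , proj₂ (g-inj S₂ q)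
    ... | no ¬p | _     = ⊥-elim (1+n≰n (≤-trans (e-two (g∈ S₁ _ _) (g∈ S₂ _ _) h (g∈ S₁ _ _) (g∈ S₂ _ _) edge (λ p _ → ¬p p)) (≤-reflexive one)))
    ... | _     | no ¬q = ⊥-elim (1+n≰n (≤-trans (e-two (g∈ S₁ _ _) (g∈ S₂ _ _) h (g∈ S₁ _ _) (g∈ S₂ _ _) edge (λ _ q → ¬q q)) (≤-reflexive one)))
    h-cross : ∀ i j i′ j′ → h i j ~ h i′ j′ → i ≡ i′ ⊎ (j ≡ zero × j′ ≡ zero)
    h-cross (inj₁ i) j (inj₁ i′) j′ e₁ = map₁ (cong inj₁) (cross S₁ i j i′ j′ e₁)
    h-cross (inj₂ i) j (inj₂ i′) j′ e₁ = map₁ (cong inj₂) (cross S₂ i j i′ j′ e₁)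
    h-cross (inj₁ i) j (inj₂ i′) j′ e₁ = inj₂ (only e₁)
    h-cross (inj₂ i) j (inj₁ i′) j′ e₁ = let p , q = only (~-sym e₁) in inj₂ (q , p)
    h-acyclic : ∀ j → 2 ≤ j → (C : Cycle (adj G) j) → (∀ t → ∃[ i ] h i zero ≡ c C t) → ⊥
    h-acyclic j 2≤j C spine with cycle-side 2≤j C (≤-reflexive one)
      (λ t → split-⊎ s _ (subst (_∈ P) (proj₂ (spine t)) (h∈ (proj₁ (spine t)) zero)))
    ... | inj₁ C⊆ = acyclic S₁ j 2≤j C λ t → case spine t of λ
          { (inj₁ i , eq) → i , eq
          ; (inj₂ i , eq) → ⊥-elim (split-disj s (C⊆ t) (subst (_∈ P₂) eq (g∈ S₂ i zero))) }
    ... | inj₂ C⊆ = acyclic S₂ j 2≤j C λ t → case spine t of λ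
          { (inj₂ i , eq) → i , eq
          ; (inj₁ i , eq) → ⊥-elim (split-disj s (subst (_∈ P₁) eq (g∈ S₁ i zero)) (C⊆ t)) }
    S : Pure P (k₁ + k₂)
    S = record { I = J ; index = ↔-sym +↔⊎ ↔-∘ (index S₁ ⊎-↔ index S₂) ; g = h ; g-inj = λ {i} {j} {i′} {j′} → h-inj {i} {j} {i′} {j′} ; g∈ = h∈ ; cover = h-cov
               ; inner = h-inner ; cross = h-cross ; acyclic = h-acyclic }

  -- The alternative at an end of a bridge: a saving makes the union good, while a spine end outside
  -- `F` is what `bridge-core` and `bridge-pure` require.
  SavesAtOrSpine : ∀ {P} → Ext P → V → Set
  SavesAtOrSpine {P} (pure K S _) x     = Saves P (k K) x ⊎ (¬ (x ∈ F K) × (∃[ i ] g S i zero ≡ x))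
  SavesAtOrSpine {P} (sporadic K _ _) x = Saves P (k K) x

  saves-or-spine : ∀ {P} (E : Ext P) x → x ∈ P → SavesAtOrSpine E x
  saves-or-spine (sporadic K _ saves) x x∈P = saves x x∈P
  saves-or-spine (pure K S spine) x x∈P with dec-Bool (F K x)
  ... | inj₁ x∈F = inj₁ (F-saves K x x∈F)
  ... | inj₂ x∉F = map₂ ((λ x∈F → true≢false x∈F x∉F) ,_) (spine x x∈P)

  bridge-ext : ∀ {P P₁ P₂} → Split P P₁ P₂ → e P₁ P₂ ≡ 1 → Ext P₁ → Ext P₂ → NonC₄Outcome P
  bridge-ext {P} {P₁} {P₂} s one E₁ E₂ with e⇒edge (≤-reflexive (sym one))
  ... | a , b , a∈ , b∈ , a~b = go E₁ E₂ (saves-or-spine E₁ a a∈) (saves-or-spine E₂ b b∈)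
    where
    left : (K₁ : Core P₁) (K₂ : Core P₂) → Saves P₁ (k K₁) a → NonC₄Outcome P
    left K₁ K₂ sv = inj₁ (bridge-saves s one K₁ K₂ b∈ a~b sv)
    right : (K₁ : Core P₁) (K₂ : Core P₂) → Saves P₂ (k K₂) b → NonC₄Outcome P
    right K₁ K₂ sv = inj₁ (bridge-saves (split-sym s) (trans (e-comm P₂ P₁) one) K₂ K₁ a∈ (~-sym a~b) sv)
    go : (E₁ : Ext P₁) (E₂ : Ext P₂) → SavesAtOrSpine E₁ a → SavesAtOrSpine E₂ b → NonC₄Outcome P
    go E₁@(sporadic K₁ _ _) E₂ sv _ = left K₁ (core E₂) sv
    go E₁@(pure K₁ _ _) E₂ (inj₁ sv) _ = left K₁ (core E₂) sv
    go E₁@(pure K₁ _ _) E₂@(sporadic K₂ _ _) _ sv = right K₁ K₂ sv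
    go E₁@(pure K₁ _ _) E₂@(pure K₂ _ _) (inj₂ _) (inj₁ sv) = right K₁ K₂ sv
    go E₁@(pure K₁ S₁ spine₁) E₂@(pure K₂ S₂ spine₂) (inj₂ (a∉F , i₁ , refl)) (inj₂ (_ , i₂ , refl))
      with bridge-core s one K₁ K₂ a∈ b∈ a~b a∉F | bridge-pure s one S₁ S₂ i₁ i₂ a~b
    ... | K , refl , saves₁ , saves₂ | S , into₁ , into₂ = inj₂ (pure K S spine)
      where
      spine : ∀ x → x ∈ P → Saves P (k K) x ⊎ (∃[ i ] g S i zero ≡ x)
      spine x x∈ with split-⊎ s x x∈
      ... | inj₁ x∈₁ with spine₁ x x∈₁
      ...   | inj₁ sv = inj₁ (saves₁ x sv)
      ...   | inj₂ (i , refl) = inj₂ (into₁ i)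
      spine x x∈ | inj₂ x∈₂ with spine₂ x x∈₂
      ...   | inj₁ sv = inj₁ (saves₂ x sv)
      ...   | inj₂ (i , refl) = inj₂ (into₂ i)

  bridge-join : ∀ {P P₁ P₂} → Split P P₁ P₂ → e P₁ P₂ ≡ 1 → NonC₄Outcome P₁ → NonC₄Outcome P₂ → NonC₄Outcome P
  bridge-join s one (inj₁ gd) o = inj₁ (bridge-good s one gd o)
  bridge-join {P} {P₁} {P₂} s one (inj₂ E) (inj₁ gd) = inj₁ (bridge-good (split-sym s) (trans (e-comm P₂ P₁) one) gd (inj₂ E))
  bridge-join s one (inj₂ E₁) (inj₂ E₂) = bridge-ext s one E₁ E₂

  -- Induction steps

  InductionHypothesis : Sub → Set₁
  InductionHypothesis W = ∀ P → cnt P < cnt W → CutConnected P → Outcome P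

  copy-relabel : ∀ {k a a′ P g} → Copy {k} a P g → (π : Fin k → Fin k) → (∀ i j → a (π i) (π j) ≡ a′ i j) →
                 (∀ i j → π i ≡ π j → i ≡ j) → (∀ i → ∃[ j ] π j ≡ i) → Copy a′ P (g ∘ π)
  copy-relabel {P = P} {g} ((g-inj , g∈ , cov) , ad) π same π-inj π-sur =
    ((λ p → π-inj _ _ (g-inj p)) , g∈ ∘ π , cov′) , λ i j → trans (ad (π i) (π j)) (same i j)
    where
    cov′ : ∀ x → x ∈ P → ∃[ i ] g (π i) ≡ x
    cov′ x x∈ with cov x x∈
    ... | i , refl with π-sur i
    ...   | j , refl = j , refl

  rotate : Fin 4 → Fin 4 → Fin 4
  rotate 0F j = j
  rotate 1F j = next4 j
  rotate 2F j = next4 (next4 j)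
  rotate 3F j = next4 (next4 (next4 j))

  opaque
    rotate-adj : ∀ k i j → C₄-adj (rotate k i) (rotate k j) ≡ C₄-adj i j
    rotate-adj = from-yes (all? (λ k → all? (λ i → all? (λ j → C₄-adj (rotate k i) (rotate k j) Bool.≟ C₄-adj i j))))

    rotate-inj : ∀ k i j → rotate k i ≡ rotate k j → i ≡ j
    rotate-inj = from-yes (all? (λ k → all? (λ i → all? (λ j → (rotate k i ≟ rotate k j) →-dec (i ≟ j)))))

    rotate-sur : ∀ k i → ∃[ j ] rotate k j ≡ i
    rotate-sur = from-yes (all? (λ k → all? (λ i → any? (λ j → rotate k j ≟ i))))

    rotate-zero : ∀ k → rotate k 0F ≡ k
    rotate-zero = from-yes (all? (λ k → rotate k 0F ≟ k))

    -- Rotating the labels puts the attachment vertex at index 0, where `banner` expects it.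
    c₄-from : ∀ {H a} → IsC₄ H → a ∈ H → ∃[ f ] (Copy C₄-adj H f × f 0F ≡ a)
    c₄-from (f , C) a∈H with copy-cover C _ a∈H
    ... | i , refl = f ∘ rotate i , copy-relabel C (rotate i) (rotate-adj i) (rotate-inj i) (rotate-sur i) , cong f (rotate-zero i)

  pendant-C₄ : ∀ {W H B y f} → Split W H B → (∀ x → x ∈ B → y ≡ x) → y ∈ B → nb H y ≤ 1 →
               Copy C₄-adj H f → y ~ f 0F → ∃[ h ] Copy banner W h
  pendant-C₄ {W} {H} {B} {y} {f} s only y∈B deg ((f-inj , f∈ , f-cov) , f-ad) y~a = h , (h-inj , h∈ , h-cov) , h-ad
    where
    h : Fin 5 → V
    h zero    = y
    h (suc i) = f i
    y≢f : ∀ {i} → y ≢ f i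
    y≢f {i} eq = split-disj s (f∈ i) (subst (_∈ B) eq y∈B)
    h-inj : Injective _≡_ _≡_ h
    h-inj {zero}  {zero}  _  = refl
    h-inj {zero}  {suc j} eq = ⊥-elim (y≢f eq)
    h-inj {suc i} {zero}  eq = ⊥-elim (y≢f (sym eq))
    h-inj {suc i} {suc j} eq = cong suc (f-inj eq)
    h∈ : ∀ i → h i ∈ W
    h∈ zero    = split-ʳ s y y∈B
    h∈ (suc i) = split-ˡ s (f i) (f∈ i)
    h-cov : ∀ x → x ∈ W → ∃[ i ] h i ≡ x
    h-cov x x∈ with split-⊎ s x x∈
    ... | inj₂ x∈B = zero , only x x∈B
    ... | inj₁ x∈H = let i , eq = f-cov x x∈H in suc i , eq
    y≁f : ∀ i → adj G y (f (suc i)) ≡ false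
    y≁f i = ¬true⇒false (λ y~ → 1+n≰n (≤-trans (nb-two (f∈ 0F) y~a (f∈ (suc i)) y~ (λ eq → case f-inj eq of λ ())) deg))
    h-ad : ∀ i j → adj G (h i) (h j) ≡ banner i j
    h-ad zero          zero          = adj-irr G y
    h-ad zero          (suc zero)    = y~a
    h-ad zero          (suc (suc i)) = y≁f i
    h-ad (suc zero)    zero          = ~-sym y~a
    h-ad (suc (suc i)) zero          = trans (adj-sym G (f (suc i)) y) (y≁f i)
    h-ad (suc zero)    (suc j)       = f-ad zero j
    h-ad (suc (suc i)) (suc j)       = f-ad (suc i) j

  split-rotate : ∀ {W H B S R} → Split W H B → Split B S R → Split W S (H ∪ R) × Split (H ∪ R) H R
  split-rotate {W} {H} {B} {S} {R} s t = mkSplit outer , t′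
    where
    t′ : Split (H ∪ R) H R
    t′ = split-∪ (λ x x∈H x∈R → split-disj s x∈H (split-ʳ t x x∈R))
    exchange : ∀ a b c → a + (b + c) ≡ b + (a + c)
    exchange = solve-∀
    outer : ∀ x → 𝟙 (W x) ≡ 𝟙 (S x) + 𝟙 ((H ∪ R) x)
    outer x = trans (at s x) (trans (cong (𝟙 (H x) +_) (at t x))
      (trans (exchange (𝟙 (H x)) (𝟙 (S x)) (𝟙 (R x))) (cong (𝟙 (S x) +_) (sym (at t′ x)))))

  c₄-cnt : ∀ {H} → IsC₄ H → cnt H ≡ 4
  c₄-cnt (_ , en , _) = cnt-enum en

  -- Choosing `y` isolates `H` for free with surplus 10, so one component of `B ∖ sg y` with surplus
  -- 2 completes the price 12 of `y`. A component that cannot supply it is no 4-cycle and hangs on a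
  -- single edge; cutting there instead gives a bridge with no 4-cycle on either side. If `y` is
  -- alone in `B`, the graph is the banner.
  bridge-C₄ : ∀ {W H B} → InductionHypothesis W → CutConnected W → Split W H B → e H B ≡ 1 → IsC₄ H → NonC₄Outcome W
  bridge-C₄ {W} {H} {B} ih W-conn@(_ , cuts) s one H-C₄ with e⇒edge (≤-reflexive (sym one))
  ... | a , y , a∈H , y∈B , a~y with nonEmpty? (B ∖ sg y)
  ...   | inj₂ R∅ with c₄-from H-C₄ a∈H
  ...     | f , C , refl with pendant-C₄ s only y∈B deg C (~-sym a~y)
    where
    only : ∀ x → x ∈ B → y ≡ x
    only x x∈ with ∈-or-∖ B (sg y) x∈
    ... | inj₁ x∈y = ∈sg⇒ x∈y
    ... | inj₂ x∈R = ⊥-elim (R∅ (x , x∈R))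
    deg : nb H y ≤ 1
    deg = ≤-trans (nb≤e H y∈B) (≤-reflexive (trans (e-comm B H) one))
  ...       | h , C′ = inj₂ (banner-ext C′)
  bridge-C₄ {W} {H} {B} ih W-conn@(_ , cuts) s one H-C₄ | a , y , a∈H , y∈B , a~y | inj₁ (z , z∈R) = conclude (component R z∈R)
    where
    R : Sub
    R = B ∖ sg y
    y∈W : y ∈ W
    y∈W = split-ʳ s y y∈B
    B-split : Split B (sg y) R
    B-split = split-∖ (sg⊆ y∈B)
    y∉R : ¬ (y ∈ R)
    y∉R y∈ = ∖sg-≢ B y y∈ refl
    H-y : 1 ≤ e H (sg y)
    H-y = e-edge a∈H (x∈sg y) a~y
    H-R : e H R ≡ 0
    H-R = n≤0⇒n≡0 (≤-by 0 (+-mono-≤ H-y (≤-reflexive (trans (sym (e-splitʳ H B-split)) one))) (identity (e H (sg y)) (e H R)))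
      where
      identity : ∀ p q → 0 + (1 + (p + q)) ≡ q + (p + 1) + 0
      identity = solve-∀
    smaller : ∀ {K} → Comp R K → cnt K < cnt W
    smaller C = cnt-< (λ x x∈ → split-ʳ s x (∖⊆ B (sg y) x (sub C x x∈))) y∈W (y∉R ∘ sub C y)
    toward : ∀ {K} → Comp R K → e K (W ∖ K) ≤ e K (sg y)
    toward {K} C = ≤-trans (e-coverʳ K cover₁) (≤-trans (+-monoʳ-≤ (e K (sg y)) (≤-trans (e-coverʳ K (λ x → ∪⇒ H (R ∖ K)))
        (+-mono-≤ (≤-trans (e-mono (sub C) (λ _ → id)) (≤-reflexive (trans (e-comm R H) H-R))) (≤-reflexive (sep C)))))
        (≤-reflexive (+-identityʳ _)))
      where
      cover₁ : ∀ x → x ∈ W ∖ K → x ∈ sg y ⊎ x ∈ H ∪ (R ∖ K)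
      cover₁ x x∈ with split-⊎ s x (∖⊆ W K x x∈)
      ... | inj₁ x∈H = inj₂ (∪ˡ {H} {R ∖ K} x x∈H)
      ... | inj₂ x∈B = map₂ (λ x∈R → ∪ʳ {H} {R ∖ K} x (∈∖ R K x∈R (∖-∉ W K x∈))) (split-⊎ B-split x x∈B)
    K⊆W : ∀ {K} → Comp R K → K ⊆ W
    K⊆W C x x∈ = split-ʳ s x (∖⊆ B (sg y) x (sub C x x∈))
    leaves : ∀ {K} → Comp R K → 1 ≤ e K (W ∖ K)
    leaves {K} C = cuts K (W ∖ K) (split-∖ (K⊆W C)) (proj₁ (conn C)) (y , ∈∖ W K y∈W (y∉R ∘ sub C y))
    linked : ∀ {K} → Comp R K → 1 ≤ e K (sg y)
    linked C = ≤-trans (leaves C) (toward C)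
    finish : ∀ {K} → Comp R K → Res y (sg y) 2 K → NonC₄Outcome W
    finish C r = [ (λ ()) , (λ rR → inj₁ (res-finish (proj₁ (split-rotate s B-split)) (λ x x∈ → inj₁ (∈sg⇒ x∈))
                      (res-join (proj₂ (split-rotate s B-split)) H-R (linked-res-C₄ H-C₄ H-y) rR)
                      (m≤n+m 12 (e (sg y) (sg y))))) ]′
      (res-comps-with {X = ⊥} C r (λ K C′ → inj₂ (linked-res₀ (ih K (smaller C′) (conn C′)) (linked C′))))
    conclude : ∃[ K ] (z ∈ K × Comp R K) → NonC₄Outcome W
    conclude (K , z∈K , C) = [ (λ o → [ (λ two → finish C (linked-res o (*-monoʳ-≤ 2 two))) , other-bridge o ]′ (≤-<-connex 2 (e K (sg y))))
                             , (λ K-C₄ → finish C (res-weaken (s≤s (s≤s z≤n)) (linked-res-C₄ K-C₄ (linked C)))) ]′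
                             (ih K (smaller C) (conn C))
      where
      y∈rest : y ∈ W ∖ K
      y∈rest = ∈∖ W K y∈W (y∉R ∘ sub C y)
      -- The remainder contains the four vertices of `H` and also `y`.
      too-big : IsC₄ (W ∖ K) → ⊥
      too-big C₄′ = <-irrefl (trans (c₄-cnt H-C₄) (sym (c₄-cnt C₄′))) (cnt-<
        (λ x x∈ → ∈∖ W K (split-ˡ s x x∈) (λ x∈K → split-disj s x∈ (∖⊆ B (sg y) x (sub C x x∈K))))
        y∈rest (λ y∈H → split-disj s y∈H y∈B))
      other-bridge : NonC₄Outcome K → e K (sg y) < 2 → NonC₄Outcome W
      other-bridge o few = bridge-join (split-∖ (K⊆W C)) one′ o
        ([ id , (λ C₄′ → ⊥-elim (too-big C₄′)) ]′ (ih (W ∖ K) (cnt-< (∖⊆ W K) (K⊆W C z z∈K) (λ h → ∖-∉ W K h z∈K)) rest-conn))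
        where
        one′ : e K (W ∖ K) ≡ 1
        one′ = ≤-antisym (≤-trans (toward C) (≤-pred few)) (leaves C)
        rest-conn : CutConnected (W ∖ K)
        rest-conn = cut-side-connected W-conn (split-sym (split-∖ (K⊆W C)))
          (≤-reflexive (trans (e-comm (W ∖ K) K) one′)) (y , y∈rest)

  -- A tight piece H hanging on two edges: dominating from an end a ∉ H of one of them both saves a vertex inside H
  -- and leaves the other edge as a bridge.
  tight-2-cut : ∀ {W H} → InductionHypothesis W → Bridgeless W → H ⊆ W → NonEmpty (W ∖ H) → e H (W ∖ H) ≤ 2 → Tight H → Good W
  tight-2-cut {W} {H} ih bl H⊆W (u , u∈) small T with e⇒edge {Tight.F T} {W ∖ H} F-out
    where
    open Tight T using () renaming (F to F′; F⊆ to F′⊆; F≢∅ to F′≢∅; F-cut to F′-cut)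
    -- At least two edges leave `F′` in the bridgeless `W`, and at most one of them stays in `H`.
    F-out : 1 ≤ e F′ (W ∖ H)
    F-out = +-cancelˡ-≤ 1 _ _ (≤-trans
      (bridgeless-∖ bl (λ x x∈ → H⊆W x (F′⊆ x x∈)) F′≢∅ (u , ∈∖ W F′ (∖⊆ W H u u∈) (∖-∉ W H u∈ ∘ F′⊆ u)))
      (≤-trans (e-coverʳ F′ {B₁ = H ∖ F′} {B₂ = W ∖ H} (λ x x∈ →
                 map₁ (λ x∈H → ∈∖ H F′ x∈H (∖-∉ W F′ x∈)) (∈-or-∖ W H (∖⊆ W F′ x x∈))))
               (+-monoˡ-≤ (e F′ (W ∖ H)) F′-cut)))
  ... | x , a , x∈F , a∈U , x~a = conclude (Tight.F-saves T x x∈F)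
                                    (res-comps {X = ⊥} Q (λ K C → inj₂ (linked-res₀ (ih K (smaller C) (conn C)) (linked C))))
    where
    U Q : Sub
    U = W ∖ H
    Q = U ∖ sg a
    W-split : Split W H U
    W-split = split-∖ H⊆W
    U-split : Split U (sg a) Q
    U-split = split-∖ (sg⊆ a∈U)
    x∈H : x ∈ H
    x∈H = Tight.F⊆ T x x∈F
    two : e H U ≡ 2
    two = ≤-antisym small (bridgeless-∖ bl H⊆W (x , x∈H) (u , u∈))
    H-Q : e H Q ≤ 1
    H-Q = ≤-by 0 (+-mono-≤ (e-edge x∈H (x∈sg a) x~a) (≤-reflexive (trans (sym (e-splitʳ H U-split)) two)))
               (identity (e H (sg a)) (e H Q))
      where
      identity : ∀ p q → 1 + (1 + (p + q)) ≡ q + (p + 2) + 0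
      identity = solve-∀
    a∉Q : ¬ (a ∈ Q)
    a∉Q a∈ = ∖sg-≢ U a a∈ refl
    Q⊆W : Q ⊆ W
    Q⊆W z z∈ = ∖⊆ W H z (∖⊆ U (sg a) z z∈)
    a∈W : a ∈ W
    a∈W = ∖⊆ W H a a∈U
    smaller : ∀ {K} → Comp Q K → cnt K < cnt W
    smaller C = cnt-< (λ z z∈ → Q⊆W z (sub C z z∈)) a∈W (a∉Q ∘ sub C a)
    -- Of the at least two edges leaving `K`, at most one goes to `H`, and none goes to other parts
    -- of `Q`; so one reaches `a`.
    linked : ∀ {K} → Comp Q K → 1 ≤ e K (sg a)
    linked {K} C = +-cancelʳ-≤ 1 _ _ (≤-trans
      (bridgeless-∖ bl (λ z z∈ → Q⊆W z (sub C z z∈)) (proj₁ (conn C)) (a , ∈∖ W K a∈W (a∉Q ∘ sub C a)))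
      (≤-trans (e-coverʳ K cover₁) (+-monoʳ-≤ (e K (sg a)) (≤-trans (e-coverʳ K (λ z → ∪⇒ H (Q ∖ K)))
        (+-mono-≤ (≤-trans (e-mono (sub C) (λ _ → id)) (≤-trans (≤-reflexive (e-comm Q H)) H-Q)) (≤-reflexive (sep C)))))))
      where
      cover₁ : ∀ z → z ∈ W ∖ K → z ∈ sg a ⊎ z ∈ H ∪ (Q ∖ K)
      cover₁ z z∈ with split-⊎ W-split z (∖⊆ W K z z∈)
      ... | inj₁ z∈H = inj₂ (∪ˡ {H} {Q ∖ K} z z∈H)
      ... | inj₂ z∈U = map₂ (λ z∈Q → ∪ʳ {H} {Q ∖ K} z (∈∖ Q K z∈Q (∖-∉ W K z∈))) (split-⊎ U-split z z∈U)
    conclude : ∃[ D ] (12 * suc (length D) ≤ e H H + 4 × Iso (H ∖ sg x) D) → ⊥ ⊎ Res a (sg a) 0 Q → Good W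
    conclude (D , short , I) (inj₂ (mkRes D′ I′ short′)) = a ∷ D′ ++ D
      , iso-join I I′ (≤-trans (e-mono (∖⊆ H (sg x)) (λ _ → id)) H-Q) (≼-++ʳ (a ∷ D′)) ≼-++ˡ covered
      -- The two edges leaving `H` contribute 4 to the doubled count, exactly the excess allowed by
      -- `Tight`.
      , ≤-via (cong (λ l → 12 * suc l) (length-++ D′))
          (≤-by 0 (+-mono-≤ short short′) (identity (length D) (length D′) (e H H) (e Q Q) (e Q (sg a))))
          (sym (trans (ee-split W-split) (cong₂ (λ p q → e H H + 2 * p + q) two
            (trans (ee-split U-split) (cong₂ (λ p q → p + 2 * q + e Q Q) (ee-sg a) (e-comm (sg a) Q))))))
      where
      identity : ∀ d d′ h q c → h + 2 * 2 + (0 + 2 * c + q) + (12 * suc d + (12 * d′ + 0)) ≡ 12 * suc (d′ + d) + (h + 4 + (q + 2 * c)) + 0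
      identity = solve-∀
      covered : ∀ z → z ∈ W → Dom (a ∷ D′ ++ D) z ⊎ (z ∈ H ∖ sg x ⊎ z ∈ Q)
      covered z z∈ with split-⊎ W-split z z∈
      ... | inj₁ z∈H with ∈-or-∖ H (sg x) z∈H
      ...   | inj₁ z∈x = inj₁ (here (inj₂ (subst (a ~_) (∈sg⇒ z∈x) (~-sym x~a))))
      ...   | inj₂ z∈  = inj₂ (inj₁ z∈)
      covered z z∈ | inj₂ z∈U with split-⊎ U-split z z∈U
      ...   | inj₁ z∈a = inj₁ (here (inj₁ (∈sg⇒ z∈a)))
      ...   | inj₂ z∈Q = inj₂ (inj₂ z∈Q)

  -- Bridgeless graphs: deleting a closed neighbourhood

  ∧⇒ : ∀ {p q} → p ∧ q ≡ true → p ≡ true × q ≡ true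
  ∧⇒ {true} {true} _ = refl , refl

  star : Sub → V → Sub
  star W v x = W x ∧ (sg v x ∨ adj G v x)

  nbhd : Sub → V → Sub
  nbhd W v x = W x ∧ adj G v x

  far : Sub → V → Sub
  far W v = W ∖ star W v

  star⊆ : ∀ W v → star W v ⊆ W
  star⊆ W v x h = proj₁ (∧⇒ {W x} h)

  star-near : ∀ W v x → x ∈ star W v → v ≡ x ⊎ v ~ x
  star-near W v x h = map₁ ∈sg⇒ (∪⇒ (sg v) (adj G v) (proj₂ (∧⇒ {W x} h)))

  near-star : ∀ W v {x} → x ∈ W → v ~ x → x ∈ star W v
  near-star W v {x} x∈W v~x = cong₂ _∧_ x∈W (∪ʳ {sg v} {adj G v} x v~x)

  star-split : ∀ {W v} → v ∈ W → Split (star W v) (sg v) (nbhd W v)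
  star-split {W} {v} v∈W .at x with v ≟ x
  ... | yes refl rewrite v∈W | adj-irr G v = refl
  ... | no _ = refl

  W-split : ∀ W v → Split W (star W v) (far W v)
  W-split W v = split-∖ (star⊆ W v)

  opaque
    unfolding nb cnt
    cnt-nbhd : ∀ W v → cnt (nbhd W v) ≡ nb W v
    cnt-nbhd W v = sum-cong-≗ (λ x → 𝟙-∧ (W x) (adj G v x))
      where
      𝟙-∧ : ∀ p q → 𝟙 (p ∧ q) ≡ 𝟙 p * 𝟙 q
      𝟙-∧ true  q = sym (*-identityˡ (𝟙 q))
      𝟙-∧ false q = refl

    nb-nbhd : ∀ W v → nb (nbhd W v) v ≡ nb W v
    nb-nbhd W v = sum-cong-≗ (λ x → absorb (W x) (adj G v x))
      where
      absorb : ∀ p q → 𝟙 (p ∧ q) * 𝟙 q ≡ 𝟙 p * 𝟙 q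
      absorb true  true  = refl
      absorb true  false = refl
      absorb false q     = refl

  ee-star : ∀ {W v} → v ∈ W → e (star W v) (star W v) ≡ 2 * nb W v + e (nbhd W v) (nbhd W v)
  ee-star {W} {v} v∈W = trans (ee-split (star-split v∈W))
    (cong₂ (λ p q → p + 2 * q + e (nbhd W v) (nbhd W v)) (ee-sg v) (trans (e-sg v (nbhd W v)) (nb-nbhd W v)))

  star-finish : ∀ {W v g} → v ∈ W → Res v (star W v) g (far W v) →
                12 ≤ 2 * nb W v + e (nbhd W v) (nbhd W v) + g → Good W
  star-finish {W} {v} {g} v∈W r enough =
    res-finish (W-split W v) (star-near W v) r (subst (λ z → 12 ≤ z + g) (sym (ee-star v∈W)) enough)

  bridgeless-nb : ∀ {W a b} → Bridgeless W → a ∈ W → b ∈ W → a ≢ b → 2 ≤ nb W a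
  bridgeless-nb {W} {a} {b} bl a∈W b∈W a≢b =
    ≤-trans (bridgeless-∖ bl (sg⊆ a∈W) (a , x∈sg a) (b , ∈∖sg W b∈W a≢b))
            (≤-trans (≤-reflexive (e-sg a (W ∖ sg a))) (nb-mono (∖⊆ W (sg a)) a))

  nbhd-covers : ∀ {W v} → v ∈ W → ∀ x → x ∈ W ∖ sg v → x ∈ nbhd W v ⊎ x ∈ far W v
  nbhd-covers {W} {v} v∈W x x∈ with ∈-or-∖ W (star W v) (∖⊆ W (sg v) x x∈)
  ... | inj₂ x∈far = inj₂ x∈far
  ... | inj₁ x∈S with split-⊎ (star-split v∈W) x x∈S
  ...   | inj₁ x∈v = ⊥-elim (∖-∉ W (sg v) x∈ x∈v)
  ...   | inj₂ x∈Y = inj₁ x∈Y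

  nbhd-nb : ∀ {W v a} → Bridgeless W → v ∈ W → a ∈ nbhd W v → 1 ≤ nb (W ∖ sg v) a
  nbhd-nb {W} {v} {a} bl v∈W a∈Y = +-cancelˡ-≤ 1 _ _ (≤-trans (bridgeless-nb bl a∈W v∈W (λ eq → ~-irr (subst (v ~_) eq v~a)))
    (≤-trans (≤-reflexive (nb-split (split-∖ (sg⊆ v∈W)) a))
             (+-monoˡ-≤ (nb (W ∖ sg v) a) (≤-trans (≤-reflexive (nb-sg a v)) (𝟙≤1 _)))))
    where
    a∈W = proj₁ (∧⇒ {W a} a∈Y)
    v~a = proj₂ (∧⇒ {W a} a∈Y)

  -- Every neighbour of v has a further neighbour.
  degree-bound : ∀ {W v} → Bridgeless W → v ∈ W → nb W v ≤ e (nbhd W v) (nbhd W v) + e (nbhd W v) (far W v)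
  degree-bound {W} {v} bl v∈W = begin
    nb W v                                        ≡⟨ cnt-nbhd W v ⟨
    cnt Y                                         ≡⟨ *-identityˡ (cnt Y) ⟨
    1 * cnt Y                                     ≤⟨ min-degree⇒≤e 1 (λ a a∈ → nbhd-nb bl v∈W a∈) ⟩
    e Y (W ∖ sg v)                                ≤⟨ e-coverʳ Y (nbhd-covers v∈W) ⟩
    e Y Y + e Y (far W v)                         ∎
    where
    open ≤-Reasoning
    Y = nbhd W v

  module _ {W : Sub} {v : V} (ih : InductionHypothesis W) (bl : Bridgeless W) (v∈W : v ∈ W) where
    private
      S Q Y : Sub
      S = star W v
      Q = far W v
      Y = nbhd W v

    v∈star : v ∈ S
    v∈star = split-ˡ (star-split {W} {v} v∈W) v (x∈sg v)

    comp-⊆ : ∀ {H} → Comp Q H → H ⊆ W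
    comp-⊆ C x x∈ = ∖⊆ W S x (sub C x x∈)

    v∈rest : ∀ {H} → Comp Q H → v ∈ W ∖ H
    v∈rest {H} C = ∈∖ W H v∈W (λ v∈H → ∖-∉ W S (sub C v v∈H) v∈star)

    comp-smaller : ∀ {H} → Comp Q H → cnt H < cnt W
    comp-smaller {H} C = cnt-< (comp-⊆ C) v∈W (∖-∉ W H (v∈rest C))

    comp-toward : ∀ {H} → Comp Q H → e H (W ∖ H) ≤ e H S
    comp-toward {H} C = ≤-trans (e-coverʳ H {B₁ = S} {B₂ = Q ∖ H}
        (λ x x∈ → map₂ (λ x∈Q → ∈∖ Q H x∈Q (∖-∉ W H x∈)) (∈-or-∖ W S (∖⊆ W H x x∈))))
      (≤-trans (+-monoʳ-≤ (e H S) (≤-reflexive (sep C))) (≤-reflexive (+-identityʳ (e H S))))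

    comp-linked : ∀ {H} → Comp Q H → 2 ≤ e H (W ∖ H)
    comp-linked C = bridgeless-∖ bl (comp-⊆ C) (proj₁ (conn C)) (v , v∈rest C)

    comp-out : ∀ {H} → Comp Q H → Outcome H
    comp-out C = ih _ (comp-smaller C) (conn C)

    -- A tight component on only two edges solves all of `W` by `tight-2-cut`; from here on it may
    -- be assumed to send three edges to the star.
    2-cut-or-3 : ∀ {H} → Comp Q H → Tight H → Good W ⊎ 3 ≤ e H S
    2-cut-or-3 {H} C T = [ inj₂ , (λ few → inj₁ (tight-2-cut ih bl (comp-⊆ C) (v , v∈rest C)
        (≤-trans (comp-toward C) (≤-pred few)) T)) ]′ (≤-<-connex 3 (e H S))

    weak-res : ∀ {H g} → NonC₄Outcome H → g + 2 ≤ 2 * e H S → Res v S g H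
    weak-res {H} {g} o linked with weak o
    ... | D , I , short = mkRes D (iso-⊆ I ≼-∷ (λ _ → id))
            (≤-by 0 (+-mono-≤ short linked) (identity (length D) g (e H H) (e H S)))
      where
      identity : ∀ d g q c → q + 2 * c + (12 * d + (g + 2)) ≡ 12 * d + g + (q + 2 + 2 * c) + 0
      identity = solve-∀

    good-res : ∀ {H g} → Good H → g ≤ 2 * e H S → Res v S g H
    good-res {H} (D , I , short) linked = mkRes D (iso-⊆ I ≼-∷ (λ _ → id)) (+-mono-≤ short linked)

    -- One vertex of the 4-cycle is chosen for 12, of which its own edges pay 8; the 4 is the
    -- remainder.
    c₄-res : ∀ {H g} → IsC₄ H → g + 4 ≤ 2 * e H S → Res v S g H
    c₄-res {H} {g} (f , C) linked = mkRes (f 0F ∷ [])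
      (iso-mono (4-copy-iso-∖ C 0F) []≼ (λ x x∈ → map₁ (λ x∈f → there (here (inj₁ (∈sg⇒ x∈f)))) (∈-or-∖ H (sg (f 0F)) x∈)))
      (≤-by 0 linked (trans (cong (λ z → z + 2 * e H S + (g + 4)) (copy-ee C)) (identity g (e H S))))
      where
      identity : ∀ g c → 8 + 2 * c + (g + 4) ≡ 12 * 1 + g + 2 * c + 0
      identity = solve-∀

    c₄-comp : ∀ {H} → Comp Q H → IsC₄ H → Good W ⊎ Res v S 2 H
    c₄-comp C H-C₄ = map₂ (λ three → c₄-res H-C₄ (*-monoʳ-≤ 2 three)) (2-cut-or-3 C (c₄⇒tight H-C₄))

    nonC₄-comp : ∀ {H} → Comp Q H → NonC₄Outcome H → Good W ⊎ Res v S 4 H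
    nonC₄-comp C (inj₁ gd) = inj₂ (good-res gd (*-monoʳ-≤ 2 (≤-trans (comp-linked C) (comp-toward C))))
    nonC₄-comp C (inj₂ E)  = map₂ (λ three → weak-res (inj₂ E) (*-monoʳ-≤ 2 three)) (2-cut-or-3 C (ext⇒tight E))

    any-comp : ∀ {H} → Comp Q H → Good W ⊎ Res v S 2 H
    any-comp C = [ (λ o → map₂ (res-weaken (s≤s (s≤s z≤n))) (nonC₄-comp C o)) , c₄-comp C ]′ (comp-out C)

    any-comp₀ : ∀ H → Comp Q H → Good W ⊎ Res v S 0 H
    any-comp₀ H C = map₂ (res-weaken z≤n) (any-comp C)

    _>>=ᴳ_ : ∀ {A : Set} → Good W ⊎ A → (A → Good W) → Good W
    inj₁ gd >>=ᴳ k = gd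
    inj₂ a  >>=ᴳ k = k a

    with-comp : ∀ {H g} → Comp Q H → Res v S g H → 12 ≤ 2 * nb W v + e Y Y + g → Good W
    with-comp C r enough = res-comps-with C r any-comp₀ >>=ᴳ λ r′ → star-finish v∈W r′ enough

    with-comps : ∀ {H g z} → Comp Q H → Res v S g H → z ∈ Q ∖ H → 12 ≤ 2 * nb W v + e Y Y + (g + 2) → Good W
    with-comps {H} C r z∈ enough = let K , _ , C′ = component (Q ∖ H) z∈ in
      any-comp (comp-∖ C C′) >>=ᴳ λ r₂ →
      res-comps-with C′ r₂ (λ L C″ → any-comp₀ L (comp-∖ C C″)) >>=ᴳ λ r₃ →
      star-finish v∈W (res-comp C r r₃) enough

    only-comp : ∀ {H} → ¬ NonEmpty (Q ∖ H) → Q ⊆ H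
    only-comp {H} none x x∈ = [ id , (λ x∈R → ⊥-elim (none (x , x∈R))) ]′ (∈-or-∖ Q H x∈)

    only-comp-degree : ∀ {H} → Q ⊆ H → nb W v ≤ e Y Y + e H S
    only-comp-degree {H} Q⊆H = ≤-trans (degree-bound bl v∈W) (+-monoʳ-≤ (e Y Y)
      (≤-trans (e-mono (split-ʳ (star-split v∈W)) Q⊆H) (≤-reflexive (e-comm S H))))

    no-comp : ¬ NonEmpty Q → 12 ≤ 2 * nb W v + e Y Y → Good W
    no-comp Q∅ enough = star-finish v∈W (res-empty Q∅) (≤-trans enough (m≤m+n _ 0))

    no-comp-degree : ¬ NonEmpty Q → nb W v ≤ e Y Y
    no-comp-degree Q∅ = ≤-trans (degree-bound bl v∈W) (≤-reflexive (trans
      (cong (e Y Y +_) (trans (e-comm Y Q) (e-empty Y Q∅))) (+-identityʳ (e Y Y))))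

    pad : ∀ {d y g} k l m → k ≤ d → l ≤ y → m ≤ g → 2 * k + l + m ≤ 2 * d + y + g
    pad k l m k≤ l≤ m≤ = +-mono-≤ (+-mono-≤ (*-monoʳ-≤ 2 k≤) l≤) m≤

    -- The edges at `v` pay 8 of 12, so 4 is missing. It comes from a component other than a
    -- 4-cycle, or from a 4-cycle together with a second component or an edge inside `Y`. Failing
    -- these, each of the at least four neighbours sends an edge to the lone 4-cycle, raising its
    -- surplus to 4. With no component at all, `no-comp-degree` supplies it.
    high-degree : 4 ≤ nb W v → Good W
    high-degree four = [ (λ (z , z∈) → let H , _ , C = component Q z∈ in [ nonC₄ C , isC₄ C ]′ (comp-out C)) , empty ]′ (nonEmpty? Q)
      where
      empty : ¬ NonEmpty Q → Good W
      empty Q∅ = no-comp Q∅ (+-mono-≤ (*-monoʳ-≤ 2 four) (≤-trans four (no-comp-degree Q∅)))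
      nonC₄ : ∀ {H} → Comp Q H → NonC₄Outcome H → Good W
      nonC₄ C o = nonC₄-comp C o >>=ᴳ λ r → with-comp C r (pad 4 0 4 four z≤n ≤-refl)
      isC₄ : ∀ {H} → Comp Q H → IsC₄ H → Good W
      isC₄ {H} C H-C₄ = c₄-comp C H-C₄ >>=ᴳ λ r →
        [ (λ (z , z∈) → with-comps C r z∈ (pad 4 0 4 four z≤n ≤-refl))
        , (λ none → [ (λ edge → with-comp C r (pad 4 2 2 four (1≤ee⇒2≤ edge) ≤-refl))
                    , (λ no-edge → with-comp C (c₄-res H-C₄ (*-monoʳ-≤ 2 (≤-trans four
                        (≤-trans (only-comp-degree (only-comp none)) (+-monoˡ-≤ (e H S) (≤-pred no-edge))))))
                        (pad 4 0 4 four z≤n ≤-refl))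
                    ]′ (≤-<-connex 1 (e Y Y)))
        ]′ (nonEmpty? (Q ∖ H))

    -- A single component H, joined to v by three paths of length 2 with otherwise isolated middle vertices.
    theta : ∀ {H} → nb W v ≡ 3 → e Y Y ≤ 0 → Comp Q H → Q ⊆ H → e H S ≤ 3 → Tight H → Good W
    theta {H} deg no-edge C Q⊆H three T =
      let x , a , x∈F , a∈S , x~a = e⇒edge {A = Tight.F T} {B = S} F-out
          D , short , I = Tight.F-saves T x x∈F
      in conclude (Tight.F⊆ T x x∈F) a∈S x~a D short I
      where
      F-out : 1 ≤ e (Tight.F T) S
      F-out = +-cancelˡ-≤ 1 _ _ (≤-trans
        (bridgeless-∖ bl (λ x x∈ → comp-⊆ C x (Tight.F⊆ T x x∈)) (Tight.F≢∅ T)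
          (v , ∈∖ W (Tight.F T) v∈W (∖-∉ W H (v∈rest C) ∘ Tight.F⊆ T v)))
        (≤-trans (e-coverʳ (Tight.F T) {B₁ = H ∖ Tight.F T} {B₂ = S} (λ z z∈ →
                    [ inj₂ , (λ z∈Q → inj₁ (∈∖ H (Tight.F T) (Q⊆H z z∈Q) (∖-∉ W (Tight.F T) z∈))) ]′
                    (∈-or-∖ W S (∖⊆ W (Tight.F T) z z∈))))
                 (+-monoˡ-≤ (e (Tight.F T) S) (Tight.F-cut T))))
      nb-Y : ∀ {z} → z ∈ Y → nb Y z ≤ 0
      nb-Y z∈ = ≤-trans (nb≤e Y z∈) no-edge
      nb-H≥1 : ∀ z → z ∈ Y → 1 ≤ nb H z
      nb-H≥1 z z∈ = ≤-trans (nbhd-nb bl v∈W z∈) (≤-trans (nb-cover (nbhd-covers v∈W) z)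
        (+-mono-≤ (nb-Y z∈) (nb-mono Q⊆H z)))
      -- Each of the three neighbours of `v` sends at least one edge to `H` and together they send
      -- at most three.
      nb-H≤1 : ∀ z → z ∈ Y → nb H z ≤ 1
      nb-H≤1 z z∈ = +-cancelʳ-≤ 2 _ _ (begin
        nb H z + 2                 ≡⟨ cong (nb H z +_) others-cnt ⟨
        nb H z + 1 * cnt (Y ∖ sg z) ≤⟨ +-monoʳ-≤ (nb H z) (min-degree⇒≤e 1 (λ u u∈ → nb-H≥1 u (∖⊆ Y (sg z) u u∈))) ⟩
        nb H z + e (Y ∖ sg z) H    ≡⟨ cong (_+ e (Y ∖ sg z) H) (e-sg z H) ⟨
        e (sg z) H + e (Y ∖ sg z) H ≡⟨ e-splitˡ H (split-∖ (sg⊆ z∈)) ⟨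
        e Y H                      ≤⟨ e-mono (split-ʳ (star-split v∈W)) (λ _ → id) ⟩
        e S H                      ≡⟨ e-comm S H ⟩
        e H S                      ≤⟨ three ⟩
        3                          ∎)
        where
        open ≤-Reasoning
        others-cnt : 1 * cnt (Y ∖ sg z) ≡ 2
        others-cnt = trans (*-identityˡ _) (suc-injective (trans (cong (_+ cnt (Y ∖ sg z)) (sym (cnt-sg z)))
          (trans (sym (cnt-split (split-∖ (sg⊆ z∈)))) (trans (cnt-nbhd W v) deg))))
      -- Here `a` replaces `v` as the chosen vertex: it dominates `x` and `v`, and the other two
      -- neighbours of `v` become leaves, so the saving solution of `H` is enough.
      conclude : ∀ {x a} → x ∈ H → a ∈ S → x ~ a → ∀ D → 12 * suc (length D) ≤ e H H + 4 → Iso (H ∖ sg x) D → Good W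
      conclude {x} {a} x∈H a∈S x~a D short I = a ∷ D
        , iso-mono (iso-leaves I leaf) ≼-∷ covered
        , (begin
            12 * suc (length D)                  ≤⟨ short ⟩
            e H H + 2 * 2                        ≤⟨ +-monoʳ-≤ (e H H) (*-monoʳ-≤ 2 (comp-linked C)) ⟩
            e H H + 2 * e H (W ∖ H)              ≤⟨ m≤m+n _ _ ⟩
            e H H + 2 * e H (W ∖ H) + e (W ∖ H) (W ∖ H) ≡⟨ ee-split (split-∖ (comp-⊆ C)) ⟨
            e W W                                ∎)
        where
        open ≤-Reasoning
        L : Sub
        L = (H ∖ sg x) ∪ (Y ∖ sg a)
        v≁x : ¬ (v ~ x)
        v≁x v~x = ∖-∉ W S (sub C x x∈H) (near-star W v (comp-⊆ C x x∈H) v~x)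
        a~v : a ~ v
        a~v = [ (λ { refl → ⊥-elim (v≁x (~-sym x~a)) }) , ~-sym ]′ (star-near W v a a∈S)
        leaf : ∀ z → z ∈ L → z ∈ H ∖ sg x ⊎ nb L z ≤ 1
        leaf z z∈ = map₂ (λ z∈Y′ → let z∈Y = ∖⊆ Y (sg a) z z∈Y′ in
            ≤-trans (nb-cover (λ u → ∪⇒ (H ∖ sg x) (Y ∖ sg a)) z)
              (+-mono-≤ (≤-trans (nb-mono (∖⊆ H (sg x)) z) (nb-H≤1 z z∈Y)) (≤-trans (nb-mono (∖⊆ Y (sg a)) z) (nb-Y z∈Y))))
          (∪⇒ (H ∖ sg x) (Y ∖ sg a) z∈)
        covered : ∀ z → z ∈ W → Dom (a ∷ D) z ⊎ z ∈ L
        covered z z∈ with ∈-or-∖ W S z∈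
        ... | inj₂ z∈Q = [ (λ z∈x → inj₁ (here (inj₂ (subst (a ~_) (∈sg⇒ z∈x) (~-sym x~a)))))
                         , (λ z∈′ → inj₂ (∪ˡ {H ∖ sg x} {Y ∖ sg a} z z∈′)) ]′ (∈-or-∖ H (sg x) (Q⊆H z z∈Q))
        ... | inj₁ z∈S with split-⊎ (star-split v∈W) z z∈S
        ...   | inj₁ z∈v = inj₁ (here (inj₂ (subst (a ~_) (∈sg⇒ z∈v) a~v)))
        ...   | inj₂ z∈Y = [ (λ z∈a → inj₁ (here (inj₁ (∈sg⇒ z∈a))))
                           , (λ z∈′ → inj₂ (∪ʳ {H ∖ sg x} {Y ∖ sg a} z z∈′)) ]′ (∈-or-∖ Y (sg a) z∈Y)

    -- The edges at `v` pay 6 and the component usually 4, so 2 is missing: a second component or an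
    -- edge inside `Y` gives it. Otherwise `H` receives at least three edges, enough if it is good;
    -- if it is extremal, four are enough and exactly three is the case of `theta`.
    degree-3-nonC₄ : ∀ {H} → nb W v ≡ 3 → Comp Q H → NonC₄Outcome H → Good W
    degree-3-nonC₄ {H} deg C o = nonC₄-comp C o >>=ᴳ λ r →
      [ (λ (z , z∈) → with-comps C r z∈ (pad 3 0 6 three z≤n ≤-refl))
      , (λ none → [ (λ edge → with-comp C r (pad 3 2 4 three (1≤ee⇒2≤ edge) ≤-refl)) , single none o ]′ (≤-<-connex 1 (e Y Y)))
      ]′ (nonEmpty? (Q ∖ H))
      where
      three : 3 ≤ nb W v
      three = ≤-reflexive (sym deg)
      single : ¬ NonEmpty (Q ∖ H) → NonC₄Outcome H → e Y Y < 1 → Good W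
      single none o no-edge = [ (λ gd → with-comp C (good-res gd (*-monoʳ-≤ 2 3≤x)) (pad 3 0 6 three z≤n ≤-refl))
        , (λ E → [ (λ four → with-comp C (weak-res (inj₂ E) (*-monoʳ-≤ 2 four)) (pad 3 0 6 three z≤n ≤-refl))
                 , (λ few → theta deg (≤-pred no-edge) C (only-comp none) (≤-pred few) (ext⇒tight E))
                 ]′ (≤-<-connex 4 (e H S)))
        ]′ o
        where
        3≤x : 3 ≤ e H S
        3≤x = ≤-trans three (≤-trans (only-comp-degree (only-comp none)) (+-monoˡ-≤ (e H S) (≤-pred no-edge)))

  -- Bridgeless graphs of maximum degree at most 3

  adj₃ : Bool → Bool → Bool → Fin 3 → Fin 3 → Bool
  adj₃ p q r 0F 0F = false
  adj₃ p q r 0F 1F = p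
  adj₃ p q r 0F 2F = q
  adj₃ p q r 1F 0F = p
  adj₃ p q r 1F 1F = false
  adj₃ p q r 1F 2F = r
  adj₃ p q r 2F 0F = q
  adj₃ p q r 2F 1F = r
  adj₃ p q r 2F 2F = false

  cone : ∀ {k} → (Fin k → Fin k → Bool) → Fin (suc k) → Fin (suc k) → Bool
  cone a zero    zero    = false
  cone a zero    (suc j) = true
  cone a (suc i) zero    = true
  cone a (suc i) (suc j) = a i j

  cone-copy : ∀ {k a W v g} → v ∈ W → ¬ NonEmpty (far W v) → Copy {k} a (nbhd W v) g → ∃[ h ] Copy (cone a) W h
  cone-copy {k} {a} {W} {v} {g} v∈W Q∅ ((g-inj , g∈ , cov) , ad) = h , (h-inj , h∈ , h-cov) , h-ad
    where
    h : Fin (suc k) → V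
    h zero    = v
    h (suc i) = g i
    v~g : ∀ i → v ~ g i
    v~g i = proj₂ (∧⇒ {W (g i)} (g∈ i))
    v≢g : ∀ i → v ≢ g i
    v≢g i eq = ~-irr (subst (v ~_) (sym eq) (v~g i))
    h-inj : Injective _≡_ _≡_ h
    h-inj {zero}  {zero}  _  = refl
    h-inj {zero}  {suc j} eq = ⊥-elim (v≢g j eq)
    h-inj {suc i} {zero}  eq = ⊥-elim (v≢g i (sym eq))
    h-inj {suc i} {suc j} eq = cong suc (g-inj eq)
    h∈ : ∀ i → h i ∈ W
    h∈ zero    = v∈W
    h∈ (suc i) = proj₁ (∧⇒ {W (g i)} (g∈ i))
    h-cov : ∀ x → x ∈ W → ∃[ i ] h i ≡ x
    h-cov x x∈ with split-⊎ (W-split W v) x x∈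
    ... | inj₂ x∈Q = ⊥-elim (Q∅ (x , x∈Q))
    ... | inj₁ x∈S with split-⊎ (star-split {W} {v} v∈W) x x∈S
    ...   | inj₁ x∈v = zero , ∈sg⇒ x∈v
    ...   | inj₂ x∈Y = let i , eq = cov x x∈Y in suc i , eq
    h-ad : ∀ i j → adj G (h i) (h j) ≡ cone a i j
    h-ad zero    zero    = adj-irr G v
    h-ad zero    (suc j) = v~g j
    h-ad (suc i) zero    = ~-sym (v~g i)
    h-ad (suc i) (suc j) = ad i j

  -- `e Y Y` is twice the number of edges among the three neighbours, so at least 3 means two or
  -- three edges: a cone over a path is the diamond, and three edges give the required 6.
  diamond-or-dense : ∀ {W Y g h} p q r → Copy (adj₃ p q r) Y g → Copy (cone (adj₃ p q r)) W h → 3 ≤ e Y Y →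
                     6 ≤ e Y Y ⊎ Ext W
  diamond-or-dense true  true  true  C C′ h = inj₁ (≤-reflexive (sym (copy-ee C)))
  diamond-or-dense true  true  false C C′ h = inj₂ (diamond-ext (copy-relabel C′ π
      (from-yes (all? (λ i → all? (λ j → cone (adj₃ true true false) (π i) (π j) Bool.≟ Diamond-adj i j))))
      (from-yes (all? (λ i → all? (λ j → (π i ≟ π j) →-dec (i ≟ j)))))
      (from-yes (all? (λ i → any? (λ j → π j ≟ i))))))
    where
    π : Fin 4 → Fin 4
    π 0F = 0F
    π 1F = 2F
    π 2F = 1F
    π 3F = 3F
  diamond-or-dense true  false true  C C′ h = inj₂ (diamond-ext (copy-relabel C′ id
      (from-yes (all? (λ i → all? (λ j → cone (adj₃ true false true) i j Bool.≟ Diamond-adj i j))))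
      (λ _ _ → id) (λ i → i , refl)))
  diamond-or-dense false true  true  C C′ h = inj₂ (diamond-ext (copy-relabel C′ π
      (from-yes (all? (λ i → all? (λ j → cone (adj₃ false true true) (π i) (π j) Bool.≟ Diamond-adj i j))))
      (from-yes (all? (λ i → all? (λ j → (π i ≟ π j) →-dec (i ≟ j)))))
      (from-yes (all? (λ i → any? (λ j → π j ≟ i))))))
    where
    π : Fin 4 → Fin 4
    π 0F = 0F
    π 1F = 1F
    π 2F = 3F
    π 3F = 2F
  diamond-or-dense true  false false C C′ h = ⊥-elim (1+n≰n (≤-trans h (≤-reflexive (copy-ee C))))
  diamond-or-dense false true  false C C′ h = ⊥-elim (1+n≰n (≤-trans h (≤-reflexive (copy-ee C))))
  diamond-or-dense false false true  C C′ h = ⊥-elim (1+n≰n (≤-trans h (≤-reflexive (copy-ee C))))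
  diamond-or-dense false false false C C′ h = ⊥-elim (n≮0 (≤-trans h (≤-reflexive (copy-ee C))))

  opaque
    opposite : ∀ i → ∃[ o ] ∃[ p ] ∃[ q ] (i ≢ o × C₄-adj i o ≡ false × p ≢ q
               × C₄-adj i p ≡ true × C₄-adj i q ≡ true × C₄-adj o p ≡ true × C₄-adj o q ≡ true)
    opposite = from-yes (all? (λ i → any? (λ o → any? (λ p → any? (λ q → ¬? (i ≟ o) ×-dec C₄-adj i o Bool.≟ false ×-dec ¬? (p ≟ q)
      ×-dec C₄-adj i p Bool.≟ true ×-dec C₄-adj i q Bool.≟ true ×-dec C₄-adj o p Bool.≟ true ×-dec C₄-adj o q Bool.≟ true)))))

    C₄-regular : ∀ i → sum (λ j → 𝟙 (C₄-adj i j)) ≡ 2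
    C₄-regular = from-yes (all? (λ i → sum (λ j → 𝟙 (C₄-adj i j)) ℕ.≟ 2))

  c₄-nb : ∀ {H x} → IsC₄ H → x ∈ H → nb H x ≡ 2
  c₄-nb (f , C) x∈ with copy-cover C _ x∈
  ... | i , refl = trans (copy-nb C i) (C₄-regular i)

  degree-3-no-comp : ∀ {W v} → InductionHypothesis W → Bridgeless W → v ∈ W → nb W v ≡ 3 → ¬ NonEmpty (far W v) → NonC₄Outcome W
  degree-3-no-comp {W} {v} ih bl v∈W deg Q∅ =
    let g , en = enumerate 3 {nbhd W v} (trans (cnt-nbhd W v) deg) in finish g en
    where
    finish : (g : Fin 3 → V) → Enumerates g (nbhd W v) → NonC₄Outcome W
    finish g en = conclude (cone-copy v∈W Q∅ (en , ad))
      where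
      ad : ∀ i j → adj G (g i) (g j) ≡ adj₃ (adj G (g 0F) (g 1F)) (adj G (g 0F) (g 2F)) (adj G (g 1F) (g 2F)) i j
      ad 0F 0F = adj-irr G (g 0F)
      ad 0F 1F = refl
      ad 0F 2F = refl
      ad 1F 0F = adj-sym G (g 1F) (g 0F)
      ad 1F 1F = adj-irr G (g 1F)
      ad 1F 2F = refl
      ad 2F 0F = adj-sym G (g 2F) (g 0F)
      ad 2F 1F = adj-sym G (g 2F) (g 1F)
      ad 2F 2F = adj-irr G (g 2F)
      p = adj G (g 0F) (g 1F)
      q = adj G (g 0F) (g 2F)
      r = adj G (g 1F) (g 2F)
      three : 3 ≤ nb W v
      three = ≤-reflexive (sym deg)
      conclude : ∃[ h ] Copy (cone (adj₃ p q r)) W h → NonC₄Outcome W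
      conclude (h , C′) = map₁ (λ six → no-comp ih bl v∈W Q∅ (+-mono-≤ (*-monoʳ-≤ 2 three) six))
        (diamond-or-dense p q r (en , ad) C′ (≤-trans three (no-comp-degree ih bl v∈W Q∅)))

  -- If a component of W minus the star of v is a 4-cycle, restart from one of its vertices h₁ of degree 3: the
  -- vertex opposite h₁ has degree at most 1 in its component of W minus the star of h₁, which is therefore no 4-cycle.
  degree-3-C₄ : ∀ {W v H} → InductionHypothesis W → Bridgeless W → (∀ x → x ∈ W → nb W x ≤ 3) → v ∈ W →
                Comp (far W v) H → IsC₄ H → Good W
  degree-3-C₄ {W} {v} {H} ih bl Δ≤3 v∈W C H-C₄@(f , copy@(_ , ad)) =
    let x , u , x∈H , u∈ , x~u = e⇒edge (≤-trans (s≤s z≤n) (comp-linked ih bl v∈W C))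
        i , eq = copy-cover copy x x∈H
    in restart i (∖⊆ W H u u∈) (∖-∉ W H u∈) (subst (_~ u) (sym eq) x~u)
    where
    H⊆W : H ⊆ W
    H⊆W = comp-⊆ ih bl v∈W C
    restart : ∀ i {u} → u ∈ W → ¬ (u ∈ H) → f i ~ u → Good W
    restart i {u} u∈W u∉H h₁~u with opposite i
    ... | o , p , q , i≢o , i≁o , p≢q , i~p , i~q , o~p , o~q = conclude (component (far W h₁) h₃∈Q)
      where
      h₁ h₃ : V
      h₁ = f i
      h₃ = f o
      f∈W : ∀ j → f j ∈ W
      f∈W j = H⊆W (f j) (copy-∈ copy j)
      f-inj : ∀ {j j′} → f j ≡ f j′ → j ≡ j′
      f-inj = proj₁ (proj₁ copy)
      deg : nb W h₁ ≡ 3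
      deg = ≤-antisym (Δ≤3 h₁ (f∈W i)) (≤-trans (+-mono-≤ (≤-reflexive (sym (c₄-nb H-C₄ (copy-∈ copy i)))) (nb-edge (∈∖ W H u∈W u∉H) h₁~u))
                                                (≤-reflexive (sym (nb-split (split-∖ H⊆W) h₁))))
      h₃∈Q : h₃ ∈ far W h₁
      h₃∈Q = ∈∖ W (star W h₁) (f∈W o) (λ h → [ i≢o ∘ f-inj , (λ h₁~h₃ → true≢false h₁~h₃ (trans (ad i o) i≁o)) ]′ (star-near W h₁ h₃ h))
      conclude : ∃[ K ] (h₃ ∈ K × Comp (far W h₁) K) → Good W
      conclude (K , h₃∈K , C′) = [ degree-3-nonC₄ ih bl (f∈W i) deg C′ , (λ K-C₄ → ⊥-elim (impossible K-C₄)) ]′ (comp-out ih bl (f∈W i) C′)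
        where
        impossible : IsC₄ K → ⊥
        impossible K-C₄ = 1+n≰n (≤-trans (+-mono-≤
            (nb-two (near-star W h₁ (f∈W p) (trans (ad i p) i~p)) (trans (ad o p) o~p)
                    (near-star W h₁ (f∈W q) (trans (ad i q) i~q)) (trans (ad o q) o~q) (p≢q ∘ f-inj))
            (≤-trans (≤-reflexive (sym (c₄-nb K-C₄ h₃∈K))) (nb-mono (sub C′) h₃)))
          (≤-trans (≤-reflexive (sym (nb-split (W-split W h₁) h₃))) (Δ≤3 h₃ (f∈W o))))

  degree-3 : ∀ {W v} → InductionHypothesis W → Bridgeless W → (∀ x → x ∈ W → nb W x ≤ 3) → v ∈ W → nb W v ≡ 3 → NonC₄Outcome W
  degree-3 {W} {v} ih bl Δ≤3 v∈W deg =
    [ (λ (z , z∈) → let H , _ , C = component (far W v) z∈ in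
        inj₁ ([ degree-3-nonC₄ ih bl v∈W deg C , degree-3-C₄ ih bl Δ≤3 v∈W C ]′ (comp-out ih bl v∈W C)))
    , degree-3-no-comp ih bl v∈W deg ]′ (nonEmpty? (far W v))

  -- Deciding long cycles, and maximum degree at most 2

  vec-any? : ∀ {A : Set} → (∀ {P : A → Set} → (∀ x → Dec (P x)) → Dec (∃ P)) →
             ∀ m {P : Vec A m → Set} → (∀ xs → Dec (P xs)) → Dec (∃ P)
  vec-any? any zero    P? = map′ ([] ,_) (λ { ([] , p) → p }) (P? [])
  vec-any? any (suc m) P? = map′ (λ { (x , xs , p) → x ∷ xs , p }) (λ { (x ∷ xs , p) → x , xs , p })
                                 (any (λ x → vec-any? any m (λ xs → P? (x ∷ xs))))

  CycleIn : Sub → ℕ → Set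
  CycleIn Z j = Σ (Cycle (adj G) j) λ C → ∀ i → c C i ∈ Z

  cycleIn? : ∀ Z j → Dec (CycleIn Z j)
  cycleIn? Z j = map′ to from (vec-any? any? (suc j) (λ xs →
      all? (λ i → all? (λ i′ → (lookup xs i ≟ lookup xs i′) →-dec (i ≟ i′)))
      ×-dec all? (λ i → adj G (lookup xs (inject₁ i)) (lookup xs (suc i)) Bool.≟ true)
      ×-dec (adj G (lookup xs (fromℕ j)) (lookup xs zero) Bool.≟ true)
      ×-dec all? (λ i → Z (lookup xs i) Bool.≟ true)))
    where
    OK : Vec V (suc j) → Set
    OK xs = (∀ i i′ → lookup xs i ≡ lookup xs i′ → i ≡ i′)
          × (∀ i → lookup xs (inject₁ i) ~ lookup xs (suc i))
          × lookup xs (fromℕ j) ~ lookup xs zero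
          × (∀ i → lookup xs i ∈ Z)
    to : ∃ OK → CycleIn Z j
    to (xs , i , s , cl , z) = record { c = lookup xs ; inj = i _ _ ; step = s ; close = cl } , z
    from : CycleIn Z j → ∃ OK
    from (C , z) = tabulate (c C) , (λ i i′ eq → inj C (trans (sym (l i)) (trans eq (l i′))))
      , (λ i → subst₂ _~_ (sym (l (inject₁ i))) (sym (l (suc i))) (step C i))
      , subst₂ _~_ (sym (l (fromℕ j))) (sym (l zero)) (close C) , (λ i → subst (_∈ Z) (sym (l i)) (z i))
      where
      l = lookup∘tabulate (c C)

  -- Injectivity gives `suc j ≤ n G`, so lengths indexed by `Fin (n G)` exhaust all cycles.
  long-cycle? : ∀ Z → Dec (∃[ j ] (3 ≤ j × CycleIn Z j))
  long-cycle? Z = map′ (λ { (j , 3≤j , C) → toℕ j , 3≤j , C }) from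
                       (any? (λ (j : Fin (n G)) → (3 ≤? toℕ j) ×-dec cycleIn? Z (toℕ j)))
    where
    from : ∃[ j ] (3 ≤ j × CycleIn Z j) → ∃[ j ] (3 ≤ toℕ {n G} j × CycleIn Z (toℕ j))
    from (j , 3≤j , C , z) = fromℕ< j<n , subst (3 ≤_) (sym eq) 3≤j , subst (CycleIn Z) (sym eq) (C , z)
      where
      j<n : j < n G
      j<n = injective⇒≤ (inj C)
      eq = toℕ-fromℕ< j<n

  -- By connectedness some edge would leave the cycle, giving one of its vertices a third neighbour.
  cycle-covers : ∀ {W j} → CutConnected W → (∀ x → x ∈ W → nb W x ≤ 2) → 2 ≤ j → (C : Cycle (adj G) j) →
                 (∀ i → c C i ∈ W) → ∀ x → x ∈ W → ∃[ i ] c C i ≡ x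
  cycle-covers {W} (_ , cuts) Δ≤2 2≤j C C⊆W x x∈W with any? (λ i → c C i ≟ x)
  ... | yes p = p
  ... | no ¬p = ⊥-elim (impossible (e⇒edge (cuts A (W ∖ A) (split-∖ A⊆W) (c C zero , C⊆A zero) (x , ∈∖ W A x∈W (¬p ∘ A⇒ x)))))
    where
    A : Sub
    A y = does (any? (λ i → c C i ≟ y))
    A⇒ : ∀ y → y ∈ A → ∃[ i ] c C i ≡ y
    A⇒ y = does⇒ (any? (λ i → c C i ≟ y))
    C⊆A : ∀ i → c C i ∈ A
    C⊆A i = dec-true (any? (λ k → c C k ≟ c C i)) (i , refl)
    A⊆W : A ⊆ W
    A⊆W y y∈ = let i , eq = A⇒ y y∈ in subst (_∈ W) eq (C⊆W i)
    impossible : ∃[ y ] ∃[ z ] (y ∈ A × z ∈ W ∖ A × y ~ z) → ⊥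
    impossible (y , z , y∈A , z∈ , y~z) with A⇒ y y∈A
    ... | i , refl = 1+n≰n (≤-trans (+-mono-≤ (cycle-degree 2≤j C C⊆A i) (nb-edge z∈ y~z))
                       (≤-trans (≤-reflexive (sym (nb-split (split-∖ A⊆W) (c C i)))) (Δ≤2 (c C i) (C⊆W i))))

  -- A chord would likewise give degree 3, so the cycle is induced and its adjacency is determined
  -- by its length.
  cycle-adj : ∀ {W j} → (∀ x → x ∈ W → nb W x ≤ 2) → 2 ≤ j → (C : Cycle (adj G) j) → (∀ i → c C i ∈ W) →
              ∀ i k → adj G (c C i) (c C k) ≡ does (nxt i ≟ k) ∨ does (nxt k ≟ i)
  cycle-adj {W} Δ≤2 2≤j C C⊆W i k with nxt i ≟ k | nxt k ≟ i
  ... | yes refl | _ = cycle-nxt C i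
  ... | no _ | yes refl = ~-sym (cycle-nxt C k)
  ... | no i⁺≢k | no k⁺≢i = ¬true⇒false λ i~k → 1+n≰n (≤-trans (+-mono-≤
        (nb-edge (x∈sg (c C k)) i~k)
        (nb-two (∈∖sg W (C⊆W (nxt i)) (i⁺≢k ∘ sym ∘ inj C)) (cycle-nxt C i)
                (∈∖sg W (C⊆W (prv i)) (λ eq → k⁺≢i (trans (cong nxt (inj C eq)) (nxt-prv i))))
                (~-sym (subst (λ t → c C (prv i) ~ c C t) (nxt-prv i) (cycle-nxt C (prv i))))
                (λ eq → nxt-nxt≢ 2≤j (prv i) (trans (cong nxt (nxt-prv i)) (inj C eq)))))
      (≤-trans (≤-reflexive (sym (nb-split (split-∖ (sg⊆ (C⊆W k))) (c C i)))) (Δ≤2 (c C i) (C⊆W i))))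

  low-degree : ∀ {W} → CutConnected W → (∀ x → x ∈ W → nb W x ≤ 2) → Outcome W
  low-degree {W} conn Δ≤2 with long-cycle? W
  ... | no none = inj₁ (inj₁ ([] , mkIso (λ j 3≤j C C⊆W _ → none (j , 3≤j , C , C⊆W)) , z≤n))
  ... | yes (j , 3≤j , C , C⊆W) = by-length j 3≤j C C⊆W
    where
    enum : ∀ {j} → 3 ≤ j → (C : Cycle (adj G) j) → (∀ i → c C i ∈ W) → Enumerates (c C) W
    enum 3≤j C C⊆W = inj C , C⊆W , cycle-covers conn Δ≤2 (≤-trans (s≤s (s≤s z≤n)) 3≤j) C C⊆W
    by-length : ∀ j → 3 ≤ j → (C : Cycle (adj G) j) → (∀ i → c C i ∈ W) → Outcome W
    by-length 3 3≤j C C⊆W = inj₂ (c C , enum 3≤j C C⊆W , λ i k → trans (cycle-adj Δ≤2 (s≤s (s≤s z≤n)) C C⊆W i k)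
      (from-yes (all? (λ i → all? (λ k → does (nxt {3} i ≟ k) ∨ does (nxt k ≟ i) Bool.≟ C₄-adj i k))) i k))
    by-length 4 3≤j C C⊆W = inj₁ (inj₂ (c₅-ext {g = c C} (enum 3≤j C C⊆W , λ i k → trans (cycle-adj Δ≤2 (s≤s (s≤s z≤n)) C C⊆W i k)
      (from-yes (all? (λ i → all? (λ k → does (nxt {4} i ≟ k) ∨ does (nxt k ≟ i) Bool.≟ C₅-adj i k))) i k))))
    -- At least six vertices of degree 2 pay the 12 for one vertex, and any long cycle passes
    -- through it since it covers `W`.
    by-length (suc (suc (suc (suc (suc j))))) 3≤j C C⊆W = inj₁ (inj₁ (c C zero ∷ [] , mkIso hit , long))
      where
      hit : ∀ j → 3 ≤ j → (C′ : Cycle (adj G) j) → (∀ i → c C′ i ∈ W) → (∀ i → ¬ Dom (c C zero ∷ []) (c C′ i)) → ⊥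
      hit j 3≤j C′ C′⊆W free = let i , eq = proj₂ (proj₂ (enum 3≤j C′ C′⊆W)) (c C zero) (C⊆W zero) in free i (here (inj₁ (sym eq)))
      2≤nb : ∀ x → x ∈ W → 2 ≤ nb W x
      2≤nb x x∈ = let i , eq = proj₂ (proj₂ (enum 3≤j C C⊆W)) x x∈ in
        subst (λ z → 2 ≤ nb W z) eq (cycle-degree (s≤s (s≤s z≤n)) C C⊆W i)
      long : 12 ≤ e W W
      long = ≤-trans (*-monoʳ-≤ 2 (≤-trans (m≤m+n 6 (sum {j} (λ _ → 1))) (≤-reflexive (sym (cnt-enum (enum 3≤j C C⊆W))))))
                     (min-degree⇒≤e 2 2≤nb)
    by-length 0 () _ _
    by-length 1 (s≤s ()) _ _
    by-length 2 (s≤s (s≤s ())) _ _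

  -- The main induction

  bridgeless-outcome : ∀ {W} → InductionHypothesis W → CutConnected W → Bridgeless W → Outcome W
  bridgeless-outcome {W} ih conn bl with any? (λ x → W x Bool.≟ true ×-dec 4 ≤? nb W x)
  ... | yes (v , v∈W , four) = inj₁ (inj₁ (high-degree ih bl v∈W four))
  ... | no none₄ with any? (λ x → W x Bool.≟ true ×-dec 3 ≤? nb W x)
  ...   | yes (v , v∈W , three) = inj₁ (degree-3 ih bl Δ≤3 v∈W (≤-antisym (Δ≤3 v v∈W) three))
    where
    Δ≤3 : ∀ x → x ∈ W → nb W x ≤ 3
    Δ≤3 x x∈ = ≤-pred (≰⇒> (λ four → none₄ (x , x∈ , four)))
  ...   | no none₃ = low-degree conn (λ x x∈ → ≤-pred (≰⇒> (λ three → none₃ (x , x∈ , three))))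

  bridge-outcome : ∀ {W A B} → InductionHypothesis W → CutConnected W → Split W A B → NonEmpty A → NonEmpty B → e A B ≤ 1 → NonC₄Outcome W
  bridge-outcome {W} {A} {B} ih conn@(_ , cuts) s A≢∅@(a , a∈) B≢∅@(b , b∈) small =
    join (ih A (cnt-< (split-ˡ s) (split-ʳ s b b∈) (λ b∈A → split-disj s b∈A b∈)) (cut-side-connected conn s small A≢∅))
         (ih B (cnt-< (split-ʳ s) (split-ˡ s a a∈) (λ a∈B → split-disj s a∈ a∈B))
               (cut-side-connected conn (split-sym s) (≤-trans (≤-reflexive (e-comm B A)) small) B≢∅))
    where
    one : e A B ≡ 1
    one = ≤-antisym small (cuts A B s A≢∅ B≢∅)
    join : Outcome A → Outcome B → NonC₄Outcome W
    join (inj₁ o) (inj₁ o′) = bridge-join s one o o′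
    join (inj₂ C) _         = bridge-C₄ ih conn s one C
    join (inj₁ _) (inj₂ C)  = bridge-C₄ ih conn (split-sym s) (trans (e-comm B A) one) C

  outcome≤ : ∀ k P → cnt P ≤ k → CutConnected P → Outcome P
  outcome≤ zero P P≤0 (ne , _) = ⊥-elim (1+n≰n (≤-trans (NonEmpty⇒1≤cnt ne) P≤0))
  outcome≤ (suc k) P P≤ conn =
    [ (λ (A , B , s , A≢∅ , B≢∅ , small) → inj₁ (bridge-outcome ih conn s A≢∅ B≢∅ small))
    , bridgeless-outcome ih conn ]′ (cut? P 1)
    where
    ih : InductionHypothesis P
    ih Q Q<P = outcome≤ k Q (≤-pred (≤-trans Q<P P≤))

  outcome : ∀ P → CutConnected P → Outcome P
  outcome P = outcome≤ (cnt P) P ≤-refl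

  -- Special graphs

  full : Sub
  full _ = true

  walk-crosses : ∀ {A B x y} → Split full A B → Walk (λ a b → adj G a b ≡ true) x y → x ∈ A → y ∈ B → 1 ≤ e A B
  walk-crosses s []       x∈A y∈B = ⊥-elim (split-disj s x∈A y∈B)
  walk-crosses s (_∷_ {y = z} x~z zy) x∈A y∈B =
    [ (λ z∈A → walk-crosses s zy z∈A y∈B) , (λ z∈B → e-edge x∈A z∈B x~z) ]′ (split-⊎ s z refl)

  connected⇒cut : Connected G → CutConnected full
  connected⇒cut (ne , walks) = ne , λ A B s (a , a∈) (b , b∈) → walk-crosses s (walks a b refl refl) a∈ b∈

  opaque
    unfolding e nb
    -- `edgeCount` counts each edge with its smaller end first; exchanging the summation variables
    -- provides the opposite order.
    handshake : e full full ≡ 2 * ∥ G ∥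
    handshake = sym (begin
      2 * ∥ G ∥                                              ≡⟨ cong (2 *_) ∥G∥≡ ⟩
      2 * up                                                 ≡⟨ cong (up +_) (+-identityʳ up) ⟩
      up + up                                                ≡⟨ cong (up +_) (∑-comm (λ x y → 𝟙 (lt x y ∧ adj G x y))) ⟩
      up + sum (λ x → sum (λ y → 𝟙 (lt y x ∧ adj G y x)))    ≡⟨ ∑-distrib-+ (λ x → sum (λ y → 𝟙 (lt x y ∧ adj G x y))) (λ x → sum (λ y → 𝟙 (lt y x ∧ adj G y x))) ⟨
      sum (λ x → sum (λ y → 𝟙 (lt x y ∧ adj G x y)) + sum (λ y → 𝟙 (lt y x ∧ adj G y x)))
                                                             ≡⟨ sum-cong-≗ (λ x → ∑-distrib-+ (λ y → 𝟙 (lt x y ∧ adj G x y)) _) ⟨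
      sum (λ x → sum (λ y → 𝟙 (lt x y ∧ adj G x y) + 𝟙 (lt y x ∧ adj G y x)))
                                                             ≡⟨ sum-cong-≗ (λ x → trans (sum-cong-≗ (λ y → orient x y)) (sym (*-identityˡ _))) ⟩
      e full full                                            ∎)
      where
      open ≡-Reasoning
      lt : V → V → Bool
      lt x y = toℕ x <ᵇ toℕ y
      up : ℕ
      up = sum (λ x → sum (λ y → 𝟙 (lt x y ∧ adj G x y)))
      if-𝟙 : ∀ p → (if p then 1 else 0) ≡ 𝟙 p
      if-𝟙 true  = refl
      if-𝟙 false = refl
      ∥G∥≡ : ∥ G ∥ ≡ up
      ∥G∥≡ = trans (sumᴸ-allFin (λ x → sumᴸ (map (λ y → if lt x y ∧ adj G x y then 1 else 0) (allFin (n G)))))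
        (sum-cong-≗ (λ x → trans (sumᴸ-allFin (λ y → if lt x y ∧ adj G x y then 1 else 0)) (sum-cong-≗ (λ y → if-𝟙 (lt x y ∧ adj G x y)))))
      <ᵇ-true : ∀ {a b} → a < b → (a <ᵇ b) ≡ true
      <ᵇ-true {zero}  {suc b} _       = refl
      <ᵇ-true {suc a} {suc b} (s≤s h) = <ᵇ-true h
      <ᵇ-false : ∀ {a b} → b ≤ a → (a <ᵇ b) ≡ false
      <ᵇ-false {a}     {zero}  _       = refl
      <ᵇ-false {suc a} {suc b} (s≤s h) = <ᵇ-false h
      orient : ∀ x y → 𝟙 (lt x y ∧ adj G x y) + 𝟙 (lt y x ∧ adj G y x) ≡ 1 * 𝟙 (adj G x y)
      orient x y with <-cmp (toℕ x) (toℕ y)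
      ... | tri< x<y _ _ rewrite <ᵇ-true x<y | <ᵇ-false (<⇒≤ x<y) = refl
      ... | tri> _ _ y<x rewrite <ᵇ-true y<x | <ᵇ-false (<⇒≤ y<x) | adj-sym G y x = sym (+-identityʳ _)
      ... | tri≈ _ x≡y _ rewrite toℕ-injective x≡y | <ᵇ-false (≤-refl {toℕ y}) | adj-irr G y = refl

  copy⇒≅ : ∀ {H : Graph} {h} → Copy (adj H) full h → G ≅ H
  copy⇒≅ {H} {h} ((h-inj , _ , cov) , ad) = mk↔ₛ′ to h (λ i → h-inj (proj₂ (cov (h i) refl))) (λ x → proj₂ (cov x refl))
    , λ x y → trans (sym (cong₂ (adj G) (proj₂ (cov x refl)) (proj₂ (cov y refl)))) (ad (to x) (to y))
    where
    to : V → Fin (n H)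
    to x = proj₁ (cov x refl)

  ≅⇒copy : ∀ {H : Graph} → G ≅ H → ∃[ h ] Copy (adj H) full h
  ≅⇒copy {H} (φ , ad) = from , (from-inj , (λ _ → refl) , λ x _ → to x , strictlyInverseʳ x)
    , λ i j → trans (ad (from i) (from j)) (cong₂ (adj H) (strictlyInverseˡ i) (strictlyInverseˡ j))
    where
    open Inverse φ
    from-inj : Injective _≡_ _≡_ from
    from-inj {i} {j} eq = trans (sym (strictlyInverseˡ i)) (trans (cong to eq) (strictlyInverseˡ j))

  InN? : ∀ (D : Subset (n G)) x → Dec (InN G D x)
  InN? D x = map′ (λ { (u , u∈D , near) → u , lookup⇒[]= u D u∈D , near }) (λ { (u , u∈D , near) → u , []=⇒lookup u∈D , near })
    (any? (λ u → (lookup D u Bool.≟ true) ×-dec ((u ≟ x) ⊎-dec (adj G u x Bool.≟ true))))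

  -- Decidability is what makes the minimum defining the isolation number available to `least`.
  isolating? : ∀ D → Dec (CIsolating G D)
  isolating? D = map′ to from (¬? (long-cycle? Z))
    where
    Z : Sub
    Z x = not (does (InN? D x))
    Z⇒ : ∀ {x} → x ∈ Z → ¬ InN G D x
    Z⇒ {x} x∈Z p = true≢false x∈Z (cong not (dec-true (InN? D x) p))
    ⇒Z : ∀ {x} → ¬ InN G D x → x ∈ Z
    ⇒Z {x} ¬p = cong not (dec-false (InN? D x) ¬p)
    to : ¬ (∃[ j ] (3 ≤ j × CycleIn Z j)) → CIsolating G D
    to none j 3≤j C free = none (j , 3≤j , C , λ i → ⇒Z (free i))
    from : CIsolating G D → ¬ (∃[ j ] (3 ≤ j × CycleIn Z j))
    from iso (j , 3≤j , C , C⊆Z) = iso j 3≤j C (λ i → Z⇒ (C⊆Z i))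

  opaque
    unfolding cnt
    cnt-cover : ∀ {A B C} → (∀ x → x ∈ A → x ∈ B ⊎ x ∈ C) → cnt A ≤ cnt B + cnt C
    cnt-cover {A} {B} {C} h = ≤-trans (sum-mono (λ x → 𝟙-cover (h x))) (≤-reflexive (∑-distrib-+ (λ x → 𝟙 (B x)) (λ x → 𝟙 (C x))))

    ∣∣-cnt : ∀ (D : Subset (n G)) → ∣ D ∣ ≡ cnt (lookup D)
    ∣∣-cnt D = ∣∣-sum D

    ∣∣-tabulate : ∀ A → ∣ tabulate A ∣ ≡ cnt A
    ∣∣-tabulate A = trans (∣∣-sum (tabulate A)) (sum-cong-≗ (λ x → cong 𝟙 (lookup∘tabulate A x)))

  mem : List V → Sub
  mem []      = λ _ → false
  mem (x ∷ D) = sg x ∪ mem D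

  cnt-mem : ∀ D → cnt (mem D) ≤ length D
  cnt-mem []      = ≮⇒≥ (λ pos → case proj₂ (1≤cnt⇒NonEmpty {mem []} pos) of λ ())
  cnt-mem (x ∷ D) = ≤-trans (cnt-cover (λ y → ∪⇒ (sg x) (mem D))) (+-mono-≤ (≤-reflexive (cnt-sg x)) (cnt-mem D))

  Dom⇒mem : ∀ {D x} → Dom D x → ∃[ u ] (u ∈ mem D × (u ≡ x ⊎ u ~ x))
  Dom⇒mem {y ∷ D} (here near) = y , ∪ˡ {sg y} {mem D} y (x∈sg y) , near
  Dom⇒mem {y ∷ D} (there d)   = let u , u∈ , near = Dom⇒mem d in u , ∪ʳ {sg y} {mem D} u u∈ , near

  iso⇒isolating : ∀ {D} → Iso full D → CIsolating G (tabulate (mem D))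
  iso⇒isolating {D} I j 3≤j C free = hits I j 3≤j C (λ _ → refl) λ i d →
    let u , u∈ , near = Dom⇒mem d in
    free i (u , lookup⇒[]= u (tabulate (mem D)) (trans (lookup∘tabulate (mem D) u) u∈) , near)

  injective⇒≤cnt : ∀ {k A} (h : Fin k → V) → Injective _≡_ _≡_ h → (∀ i → h i ∈ A) → k ≤ cnt A
  injective⇒≤cnt {k} {A} h h-inj h∈ = ≤-trans (≤-reflexive (trans (sym (sum-ones k)) (sym (cnt-enum en)))) (cnt-mono B⊆A)
    where
    B : Sub
    B x = does (any? (λ i → h i ≟ x))
    en : Enumerates h B
    en = h-inj , (λ i → dec-true (any? (λ j → h j ≟ h i)) (i , refl)) , λ x → does⇒ (any? (λ i → h i ≟ x))
    B⊆A : B ⊆ A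
    B⊆A x x∈ = let i , eq = does⇒ (any? (λ i → h i ≟ x)) x∈ in subst (_∈ A) eq (h∈ i)

  -- The closed neighbourhoods of the 4-cycles of a special graph lie in its (disjoint) constituents.
  module _ {q r : ℕ} (S : SpecialStr G q r) where
    private
      module S = SpecialStr S

    f-cycle : ∀ i → Cycle (adj G) 3
    f-cycle i = record
      { c = S.f i
      ; inj = λ {j} {j′} eq → suc-inj (proj₂ (S.g-inj i (suc j) i (suc j′) eq))
      ; step = λ { 0F → edge 0F ; 1F → edge 1F ; 2F → edge 2F }
      ; close = edge 3F }
      where
      suc-inj : ∀ {k} {j j′ : Fin k} → Fin.suc j ≡ suc j′ → j ≡ j′
      suc-inj refl = refl
      edge : ∀ j → S.f i j ~ S.f i (next4 j)
      edge j = Equivalence.from (S.edges _ _) (inj₂ (inj₂ (i , inj₂ (j , inj₁ (refl , refl)))))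

    f-neighbour : ∀ {u} i j → u ~ S.f i j → ∃[ j′ ] joint S.v S.f i j′ ≡ u
    f-neighbour {u} i j u~f with Equivalence.to (S.edges u (S.f i j)) u~f
    ... | inj₁ (_ , k , _ , _ , vk≡f) = case proj₂ (S.g-inj k zero i (suc j) vk≡f) of λ ()
    -- An edge of the remainder would put a vertex of the 4-cycle into `R`, but `R` meets the
    -- constituents only in a vertex `v i`.
    ... | inj₂ (inj₁ tp) =
          case proj₂ (Equivalence.to (S.R-meet i (suc j)) (S.tp-R (S.f i j) u (trans (S.tp-sym (S.f i j) u) tp))) of λ ()
    ... | inj₂ (inj₂ (k , inj₁ (inj₁ (v≡u , f≡f)))) with S.g-inj k (suc (S.w k)) i (suc j) f≡f
    ...   | refl , _ = zero , v≡u
    f-neighbour {u} i j u~f | inj₂ (inj₂ (k , inj₁ (inj₂ (v≡f , _)))) = case proj₂ (S.g-inj k zero i (suc j) v≡f) of λ ()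
    f-neighbour {u} i j u~f | inj₂ (inj₂ (k , inj₂ (l , inj₁ (f≡u , f≡f)))) with S.g-inj k (suc (next4 l)) i (suc j) f≡f
    ...   | refl , _ = suc l , f≡u
    f-neighbour {u} i j u~f | inj₂ (inj₂ (k , inj₂ (l , inj₂ (f≡f , f≡u)))) with S.g-inj k (suc l) i (suc j) f≡f
    ...   | refl , _ = suc (next4 l) , f≡u

    constituent-hit : ∀ D → CIsolating G D → ∀ i → ∃[ j ] lookup D (joint S.v S.f i j) ≡ true
    constituent-hit D iso i with any? (λ t → InN? D (S.f i t))
    ... | no none = ⊥-elim (iso 3 ≤-refl (f-cycle i) (λ t near → none (t , near)))
    ... | yes (t , u , u∈D , inj₁ refl) = suc t , []=⇒lookup u∈D
    ... | yes (t , u , u∈D , inj₂ u~f) with f-neighbour i t u~f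
    ...   | j , refl = j , []=⇒lookup u∈D

    constituents≤ : ∀ D → CIsolating G D → suc q ≤ ∣ D ∣
    constituents≤ D iso = ≤-trans (injective⇒≤cnt (λ i → joint S.v S.f i (proj₁ (hit i)))
        (λ {i} {i′} eq → proj₁ (S.g-inj i (proj₁ (hit i)) i′ (proj₁ (hit i′)) eq)) (λ i → proj₂ (hit i)))
      (≤-reflexive (sym (∣∣-cnt D)))
      where
      hit = constituent-hit D iso

  C₄-adj⇒next4 : ∀ i j → C₄-adj i j ≡ true → next4 i ≡ j ⊎ next4 j ≡ i
  C₄-adj⇒next4 = from-yes (all? (λ i → all? (λ j → (C₄-adj i j Bool.≟ true) →-dec (next4 i ≟ j ⊎-dec next4 j ≟ i))))

  next4-adj : ∀ i → C₄-adj i (next4 i) ≡ true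
  next4-adj = from-yes (all? (λ i → C₄-adj i (next4 i) Bool.≟ true))

  -- `Pure` records no connectedness of the spine; it is recovered from that of `G` by projecting
  -- each vertex to the index of its banner.
  pure⇒special : ∀ {q} → Connected G → Pure full (suc q) → Σ (SpecialStr G q 0) λ S → edgeCount (n G) (SpecialStr.tp S) ≡ 0
  pure⇒special {q} (_ , walks) S = record
    { v = v ; f = f ; w = λ _ → zero ; g-inj = joint-inj
    ; t = t ; t-sym = λ i k → adj-sym G (v i) (v k) ; t-irr = λ i → adj-irr G (v i)
    ; t-con = (zero , refl) , λ i k _ _ → subst₂ (Walk _) (π-v i) (π-v k) (project (walks (v i) (v k) refl refl))
    ; t-acy = λ j 2≤j C → acyclic S j 2≤j
        (record { c = v ∘ c C ; inj = λ eq → inj C (proj₁ (joint-inj _ zero _ zero eq)) ; step = step C ; close = close C })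
        (λ s → from (c C s) , refl)
    -- A pure graph has as remainder the single vertex `v last`, without edges.
    ; R = sg (v last) ; tp = λ _ _ → false ; tp-sym = λ _ _ → refl ; tp-irr = λ _ → refl ; tp-R = λ _ _ ()
    ; tp-con = (v last , x∈sg (v last)) , λ x y x∈ y∈ → subst (Walk _ x) (trans (sym (∈sg⇒ {v last} x∈)) (∈sg⇒ y∈)) []
    ; tp-r = edgeCount-empty (n G)
    ; R-meet = λ i j → mk⇔ (λ h → let p , r = joint-inj last zero i j (∈sg⇒ h) in sym p , sym r)
                           (λ { (refl , refl) → x∈sg (v last) })
    ; cover = λ x → let i , j , eq = cover S x refl in
        inj₂ (to i , j , trans (joint≡g (to i) j) (trans (cong (λ i → g S i j) (strictlyInverseʳ i)) eq))
    ; edges = λ x y → mk⇔ (edges⇒ x y) (⇒edges x y)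
    } , edgeCount-empty (n G)
    where
    open Inverse (index S)
    v : Fin (suc q) → V
    v i = g S (from i) zero
    f : Fin (suc q) → Fin 4 → V
    f i j = g S (from i) (suc j)
    t : Fin (suc q) → Fin (suc q) → Bool
    t i k = adj G (v i) (v k)
    last : Fin (suc q)
    last = fromℕ q
    joint≡g : ∀ i j → joint v f i j ≡ g S (from i) j
    joint≡g i zero    = refl
    joint≡g i (suc j) = refl
    joint-inj : ∀ i j i′ j′ → joint v f i j ≡ joint v f i′ j′ → i ≡ i′ × j ≡ j′
    joint-inj i j i′ j′ eq =
      let p , r = g-inj S (trans (sym (joint≡g i j)) (trans eq (joint≡g i′ j′))) in
      trans (sym (strictlyInverseˡ i)) (trans (cong to p) (strictlyInverseˡ i′)) , r
    π : V → Fin (suc q)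
    π x = to (proj₁ (cover S x refl))
    π-v : ∀ i → π (v i) ≡ i
    π-v i = let k , j , eq = cover S (v i) refl in trans (cong to (proj₁ (g-inj S eq))) (strictlyInverseˡ i)
    v-to : ∀ i → v (to i) ≡ g S i zero
    v-to i = cong (λ i → g S i zero) (strictlyInverseʳ i)
    f-to : ∀ i j → f (to i) j ≡ g S i (suc j)
    f-to i j = cong (λ i → g S i (suc j)) (strictlyInverseʳ i)
    project-edge : ∀ {i j i′ j′} → g S i j ~ g S i′ j′ → to i ≡ to i′ ⊎ t (to i) (to i′) ≡ true
    project-edge {i} {j} {i′} {j′} h with cross S i j i′ j′ h
    ... | inj₁ refl          = inj₁ refl
    ... | inj₂ (refl , refl) = inj₂ (subst₂ _~_ (sym (v-to i)) (sym (v-to i′)) h)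
    -- A step within a banner projects to no step; a step between banners joins spine vertices and
    -- is an edge of `t`.
    project : ∀ {x y} → Walk (λ a b → adj G a b ≡ true) x y → Walk (λ a b → t a b ≡ true) (π x) (π y)
    project [] = []
    project {x} {y} (_∷_ {y = z} x~z zy) =
      [ (λ eq → subst (λ k → Walk (λ a b → t a b ≡ true) k (π y)) (sym eq) (project zy)) , _∷ project zy ]′
      (project-edge (subst₂ _~_ (sym (proj₂ (proj₂ (cover S x refl)))) (sym (proj₂ (proj₂ (cover S z refl)))) x~z))
    Edges : V → V → Set
    Edges x y = (∃[ i ] ∃[ k ] (t i k ≡ true × v i ≡ x × v k ≡ y))
              ⊎ false ≡ true
              ⊎ (∃[ i ] (UEdge (v i) (f i zero) x y ⊎ ∃[ j ] UEdge (f i j) (f i (next4 j)) x y))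
    banner-C₄ : ∀ i j → banner (suc i) (suc j) ≡ C₄-adj i j
    banner-C₄ zero    j = refl
    banner-C₄ (suc i) j = refl
    f-edge : ∀ i j → f i j ~ f i (next4 j)
    f-edge i j = trans (inner S (from i) (suc j) (suc (next4 j))) (trans (banner-C₄ j (next4 j)) (next4-adj j))
    c₄-edge : ∀ i j j′ → C₄-adj j j′ ≡ true → Edges (g S i (suc j)) (g S i (suc j′))
    c₄-edge i j j′ h = inj₂ (inj₂ (to i , inj₂ ([ (λ { refl → j , inj₁ (f-to i j , f-to i j′) })
                                                , (λ { refl → j′ , inj₂ (f-to i j′ , f-to i j) }) ]′ (C₄-adj⇒next4 j j′ h))))
    inner⇒ : ∀ i j j′ → banner j j′ ≡ true → Edges (g S i j) (g S i j′)
    inner⇒ i zero          (suc zero)    _ = inj₂ (inj₂ (to i , inj₁ (inj₁ (v-to i , f-to i zero))))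
    inner⇒ i (suc zero)    zero          _ = inj₂ (inj₂ (to i , inj₁ (inj₂ (v-to i , f-to i zero))))
    inner⇒ i (suc zero)    (suc j′)      h = c₄-edge i zero j′ h
    inner⇒ i (suc (suc j)) (suc j′)      h = c₄-edge i (suc j) j′ h
    edges⇒ : ∀ x y → x ~ y → Edges x y
    edges⇒ x y x~y with cover S x refl | cover S y refl
    ... | i , j , refl | i′ , j′ , refl with cross S i j i′ j′ x~y
    ...   | inj₁ refl          = inner⇒ i j j′ (trans (sym (inner S i j j′)) x~y)
    ...   | inj₂ (refl , refl) = inj₁ (to i , to i′ , subst₂ _~_ (sym (v-to i)) (sym (v-to i′)) x~y , v-to i , v-to i′)
    ⇒edges : ∀ x y → Edges x y → x ~ y
    ⇒edges x y (inj₁ (i , k , h , refl , refl)) = h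
    ⇒edges x y (inj₂ (inj₁ ()))
    ⇒edges x y (inj₂ (inj₂ (i , inj₁ (inj₁ (refl , refl))))) = inner S (from i) 0F 1F
    ⇒edges x y (inj₂ (inj₂ (i , inj₁ (inj₂ (refl , refl))))) = inner S (from i) 1F 0F
    ⇒edges x y (inj₂ (inj₂ (i , inj₂ (j , inj₁ (refl , refl))))) = f-edge i j
    ⇒edges x y (inj₂ (inj₂ (i , inj₂ (j , inj₂ (refl , refl))))) = ~-sym (f-edge i j)

  -- The isolation number and the cases of equality

  isolation-number : ∀ {D} → Iso full D → ∃[ k ] ιC′≡ G k
  isolation-number {D} I =
    let k , attained , minimal = least (λ k → anySubset? (λ D → isolating? D ×-dec ∣ D ∣ ℕ.≟ k))
                                       ∣ tabulate (mem D) ∣ (tabulate (mem D) , iso⇒isolating I , refl)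
    in k , attained , λ D iso → minimal ∣ D ∣ (D , iso , refl)

  ι≤length : ∀ {k D} → ιC′≡ G k → Iso full D → k ≤ length D
  ι≤length {D = D} (_ , minimal) I =
    ≤-trans (minimal (tabulate (mem D)) (iso⇒isolating I)) (≤-trans (≤-reflexive (∣∣-tabulate (mem D))) (cnt-mem D))

  double-6 : ∀ k → 2 * (6 * k) ≡ 12 * k
  double-6 = solve-∀

  6ι≤ : ∀ {k D b} → ιC′≡ G k → Iso full D → 12 * length D ≤ 2 * b → 6 * k ≤ b
  6ι≤ {k} ι I short = *-cancelˡ-≤ 2 (≤-trans (≤-reflexive (double-6 k)) (≤-trans (*-monoʳ-≤ 12 (ι≤length ι I)) short))

  good⇒6ι≤m : ∀ {k} → ιC′≡ G k → Good full → 6 * k ≤ ∥ G ∥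
  good⇒6ι≤m ι (D , I , short) = 6ι≤ ι I (≤-trans short (≤-reflexive handshake))

  2*-suc : ∀ {k} → 2 * k + 2 ≡ 2 * suc k
  2*-suc {k} = trans (+-comm (2 * k) 2) (sym (*-suc 2 k))

  weak-bound : ∀ {D : List V} → 12 * length D ≤ e full full + 2 → 12 * length D ≤ 2 * suc ∥ G ∥
  weak-bound short = ≤-trans short (≤-reflexive (trans (cong (_+ 2) handshake) 2*-suc))

  pure⇒PureSpecial : ∀ {k} → Connected G → Pure full k → 12 * k ≡ e full full + 2 → PureSpecial G ∥ G ∥
  pure⇒PureSpecial {zero}  conn S size = case trans size (+-comm (e full full) 2) of λ ()
  pure⇒PureSpecial {suc q} conn S size = q
    , trans (cong (_/ 6) suc-m) (m*n/n≡m (suc q) 6)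
    , subst (λ r → Σ (SpecialStr G q r) λ S → edgeCount (n G) (SpecialStr.tp S) ≡ 0)
        (sym (trans (cong (_% 6) suc-m) (m*n%n≡0 (suc q) 6))) (pure⇒special conn S)
    where
    suc-m : suc ∥ G ∥ ≡ suc q * 6
    suc-m = sym (trans (*-comm (suc q) 6)
      (*-cancelˡ-≡ _ _ 2 (trans (double-6 (suc q)) (trans size (trans (cong (_+ 2) handshake) 2*-suc)))))

  ext⇒extremal : Connected G → Ext full → PureSpecial G ∥ G ∥ ⊎ G ≅ Diamond ⊎ G ≅ C₅
  ext⇒extremal conn (pure K S _)                  = inj₁ (pure⇒PureSpecial conn S (size K))
  ext⇒extremal conn (sporadic _ (inj₁ (_ , C)) _) = inj₂ (inj₁ (copy⇒≅ {Diamond} C))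
  ext⇒extremal conn (sporadic _ (inj₂ (_ , C)) _) = inj₂ (inj₂ (copy⇒≅ {C₅} C))

  long-cycle⇒1≤ι : ∀ {k j} → ιC′≡ G k → 3 ≤ j → Cycle (adj G) j → 1 ≤ k
  long-cycle⇒1≤ι {j = j} ((D , iso , refl) , _) 3≤j C = ≰⇒> λ ∣D∣≤0 → iso j 3≤j C λ { i (u , u∈D , _) →
    1+n≰n (≤-trans (NonEmpty⇒1≤cnt (u , []=⇒lookup u∈D)) (≤-trans (≤-reflexive (sym (∣∣-cnt D))) ∣D∣≤0)) }

  five-edges : e full full ≡ 10 → ∥ G ∥ ≡ 5
  five-edges eq = *-cancelˡ-≡ _ _ 2 (trans (sym handshake) eq)

  -- With five edges the bound reads `6 * k ≤ 6`, and a long cycle rules out `k = 0`.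
  sporadic-equality : ∀ {k j} → ιC′≡ G k → 6 * k ≤ suc ∥ G ∥ → e full full ≡ 10 → 3 ≤ j → Cycle (adj G) j → 6 * k ≡ suc ∥ G ∥
  sporadic-equality ι bound ten 3≤j C =
    ≤-antisym bound (≤-trans (≤-reflexive (cong suc (five-edges ten))) (*-monoʳ-≤ 6 (long-cycle⇒1≤ι ι 3≤j C)))

  diamond-equality : ∀ {k} → ιC′≡ G k → 6 * k ≤ suc ∥ G ∥ → G ≅ Diamond → 6 * k ≡ suc ∥ G ∥
  diamond-equality ι bound iso with ≅⇒copy {Diamond} iso
  ... | h , C@((h-inj , _) , ad) = sporadic-equality ι bound (copy-ee C) ≤-refl
    (record { c = h ; inj = h-inj ; step = λ { 0F → ad 0F 1F ; 1F → ad 1F 2F ; 2F → ad 2F 3F } ; close = ad 3F 0F })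

  c₅-equality : ∀ {k} → ιC′≡ G k → 6 * k ≤ suc ∥ G ∥ → G ≅ C₅ → 6 * k ≡ suc ∥ G ∥
  c₅-equality ι bound iso with ≅⇒copy {C₅} iso
  ... | h , C@((h-inj , _) , ad) = sporadic-equality ι bound (copy-ee C) (n≤1+n 3)
    (record { c = h ; inj = h-inj ; step = λ { 0F → ad 0F 1F ; 1F → ad 1F 2F ; 2F → ad 2F 3F ; 3F → ad 3F 4F } ; close = ad 4F 0F })

  ι≤quotient : ∀ {k m} → 6 * k ≤ suc m → k ≤ suc m / 6
  ι≤quotient {k} bound = ≤-trans (≤-reflexive (trans (sym (m*n/n≡m k 6)) (cong (_/ 6) (*-comm k 6)))) (/-monoˡ-≤ 6 bound)

  -- The general bound gives the upper estimate. The lower one is trivial without constituents and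
  -- otherwise needs one vertex per constituent.
  special⇒ι : ∀ {k m} → ιC′≡ G k → 6 * k ≤ suc m → Special G m → k ≡ suc m / 6
  special⇒ι ι bound (inj₁ (q≡0 , _)) = trans (n≤0⇒n≡0 (≤-trans (ι≤quotient bound) (≤-reflexive q≡0))) (sym q≡0)
  special⇒ι ((D , iso , refl) , _) bound (inj₂ (q , q≡ , S)) =
    ≤-antisym (ι≤quotient bound) (≤-trans (≤-reflexive q≡) (constituents≤ S D iso))

  -- The number of edges of the remainder graph is `suc m % 6`; when it is zero, the quotient is
  -- exact.
  pure-equality : ∀ {k m} → ιC′≡ G k → 6 * k ≤ suc m → PureSpecial G m → 6 * k ≡ suc m
  pure-equality {k} {m} ι bound (q , q≡ , S , no-edges) = begin
    6 * k                        ≡⟨ *-comm 6 k ⟩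
    k * 6                        ≡⟨ cong (_* 6) (special⇒ι ι bound (inj₂ (q , q≡ , S))) ⟩
    suc m / 6 * 6                ≡⟨ cong (_+ suc m / 6 * 6) (trans (sym no-edges) (SpecialStr.tp-r S)) ⟩
    suc m % 6 + suc m / 6 * 6    ≡⟨ m≡m%n+[m/n]*n (suc m) 6 ⟨
    suc m                        ∎
    where open ≡-Reasoning

  Conclusion : ℕ → Set
  Conclusion k = ιC′≡ G k × 6 * k ≤ suc ∥ G ∥
    × ((6 * k ≡ suc ∥ G ∥) ⇔ (PureSpecial G ∥ G ∥ ⊎ G ≅ Diamond ⊎ G ≅ C₅))
    × (Special G ∥ G ∥ → k ≡ suc ∥ G ∥ / 6)

  isolation-bound : Connected G → NonC₄Outcome full → ∃ Conclusion
  isolation-bound conn o = conclude (weak o)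
    where
    extremal : ∀ {k} → ιC′≡ G k → 6 * k ≡ suc ∥ G ∥ → NonC₄Outcome full → PureSpecial G ∥ G ∥ ⊎ G ≅ Diamond ⊎ G ≅ C₅
    -- A good graph satisfies `6 * k ≤ m`, which excludes equality.
    extremal ι eq (inj₁ gd) = ⊥-elim (1+n≰n (≤-trans (≤-reflexive (sym eq)) (good⇒6ι≤m ι gd)))
    extremal ι eq (inj₂ E)  = ext⇒extremal conn E
    assemble : ∀ {k} → ιC′≡ G k → 6 * k ≤ suc ∥ G ∥ → Conclusion k
    assemble ι bound = ι , bound
      , mk⇔ (λ eq → extremal ι eq o) [ pure-equality ι bound , [ diamond-equality ι bound , c₅-equality ι bound ]′ ]′
      , special⇒ι ι bound
    conclude : ∃[ D ] (Iso full D × 12 * length D ≤ e full full + 2) → ∃ Conclusion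
    conclude (D , I , short) = number (isolation-number I)
      where
      number : ∃[ k ] ιC′≡ G k → ∃ Conclusion
      number (k , ι) = k , assemble ι (6ι≤ ι I (weak-bound {D} short))

  isolation : Connected G → ¬ (G ≅ C₄) → ∃ Conclusion
  isolation conn G≇C₄ = [ isolation-bound conn , (λ (_ , C) → ⊥-elim (G≇C₄ (copy⇒≅ {C₄} C))) ]′ (outcome full (connected⇒cut conn))

theorem1p4 : (G : Graph) (m : ℕ) → Connected G → ∥ G ∥ ≡ m → ¬ (G ≅ C₄) →
    Σ ℕ λ k → ιC′≡ G k
    × 6 * k ≤ suc m
    × ((6 * k ≡ suc m) ⇔ (PureSpecial G m ⊎ G ≅ Diamond ⊎ G ≅ C₅))
    × (Special G m → k ≡ suc m / 6)
theorem1p4 G _ conn refl = Isolation.isolation G conn
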